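{- Let $r > \ell \ge 2$ be integers. For every $\varepsilon > 0$ there exists $\varepsilon' > 0$ such that the following holds. If $G$ is a graph with $n$ vertices, where $r$ divides $n$, such that $\delta(G) \ge \frac{r-\ell}{r-\ell+1}n + \varepsilon n$ and $\alpha_\ell(G) \le \varepsilon' n$, then $G$ contains a $K_r$-factor.
   Context: For a graph $G$, $\delta(G)$ is its minimum degree. $\alpha_\ell(G)$ denotes the maximum size of a set $U \subseteq V(G)$ such that the induced subgraph $G[U]$ contains no copy of $K_\ell$ (so $\alpha_2(G)$ is the independence number). For a graph $H$, an $H$-factor of $G$ is a collection of vertex-disjoint copies of $H$ in $G$ (not necessarily induced) which together cover all vertices of $G$. -}

module Defs where

open import Data.Nat using (ℕ; suc; _∸_)
open import Data.Bool using (Bool; true; false)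
open import Data.Fin using (Fin)
open import Data.Fin.Subset using (Subset; _∈_; ∣_∣)
open import Data.Vec using (tabulate)
open import Data.Integer using (+_)
open import Data.Rational using (ℚ; _/_; _+_; _*_)
open import Data.Product using (Σ; ∃; _×_)
open import Relation.Nullary using (¬_)
open import Relation.Binary.PropositionalEquality using (_≡_; _≢_)

record Graph (n : ℕ) : Set where
  field
    adj    : Fin n → Fin n → Bool
    sym    : ∀ u v → adj u v ≡ adj v u
    irrefl : ∀ v → adj v v ≡ false
open Graph public

ℕ→ℚ : ℕ → ℚ
ℕ→ℚ m = + m / 1

nbhd : ∀ {n} → Graph n → Fin n → Subset n
nbhd G v = tabulate (adj G v)

deg : ∀ {n} → Graph n → Fin n → ℕ
deg G v = ∣ nbhd G v ∣

MinDegGE : ∀ {n} → Graph n → ℚ → Set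
MinDegGE G d = ∀ v → d Data.Rational.≤ ℕ→ℚ (deg G v)

-- a copy of K_k: k vertices, pairwise adjacent (hence distinct, by irreflexivity)
IsClique : ∀ {n} → Graph n → (k : ℕ) → (Fin k → Fin n) → Set
IsClique G k f = ∀ i j → i ≢ j → adj G (f i) (f j) ≡ true

HasCliqueIn : ∀ {n} → Graph n → (k : ℕ) → Subset n → Set
HasCliqueIn {n} G k U = Σ (Fin k → Fin n) λ f → (∀ i → f i ∈ U) × IsClique G k f

AlphaLE : ∀ {n} → Graph n → (k : ℕ) → ℚ → Set
AlphaLE G k a = ∀ U → ¬ HasCliqueIn G k U → ℕ→ℚ ∣ U ∣ Data.Rational.≤ a

HasKFactor : ∀ {n} → Graph n → (r : ℕ) → Set
HasKFactor {n} G r =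
  Σ ℕ λ m → Σ (Fin m → Fin r → Fin n) λ F →
    (∀ i → IsClique G r (F i)) ×
    (∀ i j i' j' → F i j ≡ F i' j' → (i ≡ i') × (j ≡ j')) ×
    (∀ v → Σ (Fin m) λ i → Σ (Fin r) λ j → F i j ≡ v)

{-# OPTIONS --safe #-}
-- Let k = r - ℓ + 1 ≥ 2, so that any k vertices have at least εn common neighbours, among which there is a K_ℓ.
--
-- Light cliques.  For every weighting w ≥ 0 of a dense vertex set U there is a K_r of weight at most about r times
-- the average: take the set C of the lightest few vertices, choose k - 1 further vertices one after the other,
-- each of minimal weight among the common neighbours that keep a positive proportion of C adjacent to all of them,
-- and finish with a K_ℓ inside what is left of C.  The i-th vertex has at least a (1 - i/k)-fraction of U above it.
--
-- Spreading.  Adding cliques to W one by one, with D_v = |Q| deg_W(v) - |W| deg_Q(v) and w(x) the sum of D_v over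
-- the neighbours v of x, a light clique keeps the potential Σ D_v² small.  Hence W is spread evenly over the
-- neighbourhoods of all but few vertices, and removing W and these few vertices preserves the density of the rest;
-- iterating this a bounded number of times covers almost everything.
--
-- Absorption.  Any two vertices u, v have an (r-1)-clique in their common neighbourhood, so every r-set R has an
-- absorber: a set Γ such that both Γ and Γ ∪ R have a K_r-factor.  Interleave a spread set X = {x₁, x₂, …} with
-- blocks J₁, J₂, … of r vertices and give absorbers to boundedly many r-sets around each xᵢ, so that unmatched
-- vertices can be carried from each block to the next; then any subset of X can be removed from X and the absorbers,
-- subject to divisibility by r.  The leftover of the almost perfect tiling is covered by cliques with their
-- other r - 1 vertices in X, and the remainder of X is absorbed.
module Submission where

-- The obstacle to tiling greedily is that the removed cliques may use up the neighbourhoods of some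
-- vertices and with them the slack in the degrees. A random clique of a perfect fractional tiling
-- would meet all neighbourhoods in proportion. By linear programming duality, such a fractional
-- tiling exists exactly when every weighting has a clique of at most average weight. Light cliques
-- are this dual form, and they allow a deterministic choice: w is in essence the gradient of the
-- potential. The potential then grows linearly instead of quadratically in the number of cliques,
-- and a Chebyshev argument bounds the bad vertices by a constant multiple of ε′n, however many
-- cliques are taken. The leftover of the tiling is small but linear in n, so X has linear size and
-- only boundedly many absorbers per vertex of X fit. Hence not every r-set in X can have one, and
-- the chain of blocks limits the r-sets that can be called for. Everything is stated in integers: a
-- density 1 - 1/e appears as an inequality multiplied by e, and lists up to permutation stand for
-- vertex sets.

module CliqueFactors where

  open import Algebra.Bundles using (CommutativeSemiring)
  open import Data.Bool using (Bool; true; false; not; if_then_else_; T?)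
  open import Data.Bool.Properties using (T-≡)
  open import Data.Fin as Fin using (Fin; zero; suc; cast)
  open import Data.Fin.Properties as FinP using (cast-is-id)
  open import Data.Fin.Subset using (Subset; ⁅_⁆) renaming (_∈_ to _∈ₛ_; ∣_∣ to ∣_∣ₛ)
  open import Data.Fin.Subset.Properties using (x∈⁅y⁆⇒x≡y; ∣⁅x⁆∣≡1)
  open import Data.Integer as ℤ using (ℤ; +_; -[1+_]; ∣_∣)
  open import Data.Integer.Properties as ℤP using ()
  import Data.Integer.Tactic.RingSolver as ℤSolver
  open import Data.List using (List; []; _∷_; _++_; [_]; length; concat; map; lookup; upTo; downFrom; take; drop; replicate; filterᵇ; tabulate; allFin)
  open import Data.List.Properties using (length-++; length-map; length-upTo; length-take; length-drop; length-replicate; length-tabulate; take++drop≡id; drop-all; ++-identityʳ; concat-++)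
  open import Data.List.Membership.Propositional using (_∈_; find)
  open import Data.List.Membership.Propositional.Properties using (∈-map⁺; ∈-upTo⁺; ∈-allFin; ∈-lookup; ∈-++⁺ˡ; ∈-++⁺ʳ; ∈-++⁻; ∈-filter⁺; ∈-∃++)
  open import Data.List.Membership.DecPropositional using () renaming (_∈?_ to mem?)
  open import Data.List.Relation.Binary.Permutation.Propositional using (_↭_; refl; prep; swap; trans; ↭-refl; ↭-sym; ↭-trans; ↭-reflexive; ↭⇒↭ₛ; module PermutationReasoning)
  open import Data.List.Relation.Binary.Permutation.Propositional.Properties using (shift; shifts; ++⁺; ++⁺ˡ; ++⁺ʳ; ++-assoc; ++-comm; ↭-length; All-resp-↭; ∈-resp-↭)
  open import Data.List.Relation.Binary.Sublist.Propositional as Sub using ([]; _∷_; _∷ʳ_; from∈)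
  open import Data.List.Relation.Binary.Sublist.Propositional.Properties as SubP using ()
  open import Data.List.Relation.Binary.Subset.Propositional using (_⊆_)
  open import Data.List.Relation.Unary.All as All using (All; []; _∷_)
  open import Data.List.Relation.Unary.All.Properties as AllP using ()
  open import Data.List.Relation.Unary.AllPairs using (AllPairs; []; _∷_)
  open import Data.List.Relation.Unary.AllPairs.Properties as APP using ()
  open import Data.List.Relation.Unary.Any as Any using (Any; here; there; any?; index)
  open import Data.List.Relation.Unary.Any.Properties using (lookup-index)
  open import Data.List.Relation.Unary.Unique.Propositional using (Unique)
  open import Data.List.Relation.Unary.Unique.Propositional.Properties using (allFin⁺)
  open import Data.Nat using (ℕ; zero; suc; _+_; _*_; _∸_; _^_; _/_; _%_; _⊓_; _≤_; _<_; _≤ᵇ_; _≤?_; z≤n; s≤s; NonZero; >-nonZero)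
  open import Data.Nat.DivMod using (m/n*n≤m; m≡m%n+[m/n]*n; m%n<n; m≥n⇒m/n>0)
  open import Data.Nat.Divisibility using (_∣_; divides; ∣m+n∣m⇒∣n; ∣⇒≤)
  import Data.Nat.Properties as ℕP
  open import Data.Nat.Tactic.RingSolver using (solve-∀)
  open import Data.Product using (Σ; ∃-syntax; _×_; _,_; proj₁; proj₂)
  open import Data.Rational as ℚ using (ℚ; mkℚ; toℚᵘ; Positive)
  open import Data.Rational.Properties as ℚP using ()
  open import Data.Rational.Unnormalised as ℚᵘ using (mkℚᵘ)
  open import Data.Rational.Unnormalised.Properties as ℚᵘP using ()
  open import Data.Sum using (_⊎_; inj₁; inj₂)
  open import Data.Unit using (⊤; tt)
  open import Data.Vec as Vec using ()
  open import Data.Vec.Properties using (lookup∘tabulate; []=⇒lookup)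
  open import Defs using (Graph; adj; irrefl; ℕ→ℚ; IsClique; HasCliqueIn; AlphaLE; HasKFactor)
  import Defs
  open import Function using (_∘_; id; Equivalence)
  open import Level using (Level)
  open import Relation.Binary.PropositionalEquality as ≡ using (_≡_; _≢_; cong; cong₂; subst)
  open import Relation.Nullary using (¬_; Dec; yes; no; does; contradiction)
  open import Relation.Nullary.Decidable using (dec-true)

  -- Finite sums over lists in a commutative semiring

  module Sum {c : Level} (R : CommutativeSemiring c c) {A : Set} where
    open CommutativeSemiring R
      using (Carrier; _≈_; 0#; +-cong; +-identityˡ; +-assoc; +-comm; distribˡ; zeroʳ; +-commutativeSemigroup)
      renaming (_+_ to _⊕_; _*_ to _⊗_; refl to ≈-refl; sym to ≈-sym; trans to ≈-trans)
    open import Algebra.Properties.CommutativeSemigroup +-commutativeSemigroup using (interchange)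

    ∑ : List A → (A → Carrier) → Carrier
    ∑ []       f = 0#
    ∑ (x ∷ xs) f = f x ⊕ ∑ xs f

    ∑-cong : ∀ xs {f g : A → Carrier} → (∀ x → f x ≈ g x) → ∑ xs f ≈ ∑ xs g
    ∑-cong []       f≈g = ≈-refl
    ∑-cong (x ∷ xs) f≈g = +-cong (f≈g x) (∑-cong xs f≈g)

    ∑-++ : ∀ xs ys (f : A → Carrier) → ∑ (xs ++ ys) f ≈ ∑ xs f ⊕ ∑ ys f
    ∑-++ []       ys f = ≈-sym (+-identityˡ _)
    ∑-++ (x ∷ xs) ys f = ≈-trans (+-cong ≈-refl (∑-++ xs ys f)) (≈-sym (+-assoc _ _ _))

    ∑-↭ : ∀ {xs ys} (f : A → Carrier) → xs ↭ ys → ∑ xs f ≈ ∑ ys f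
    ∑-↭ f refl          = ≈-refl
    ∑-↭ f (prep x p)    = +-cong ≈-refl (∑-↭ f p)
    ∑-↭ f (swap x y p)  = ≈-trans (+-cong ≈-refl (+-cong ≈-refl (∑-↭ f p)))
      (≈-trans (≈-sym (+-assoc _ _ _)) (≈-trans (+-cong (+-comm _ _) ≈-refl) (+-assoc _ _ _)))
    ∑-↭ f (trans p q)   = ≈-trans (∑-↭ f p) (∑-↭ f q)

    ∑-+ : ∀ xs (f g : A → Carrier) → ∑ xs (λ x → f x ⊕ g x) ≈ ∑ xs f ⊕ ∑ xs g
    ∑-+ []       f g = ≈-sym (+-identityˡ _)
    ∑-+ (x ∷ xs) f g = ≈-trans (+-cong ≈-refl (∑-+ xs f g)) (interchange _ _ _ _)

    ∑-* : ∀ xs c (f : A → Carrier) → ∑ xs (λ x → c ⊗ f x) ≈ c ⊗ ∑ xs f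
    ∑-* []       c f = ≈-sym (zeroʳ c)
    ∑-* (x ∷ xs) c f = ≈-trans (+-cong ≈-refl (∑-* xs c f)) (≈-sym (distribˡ c _ _))

    ∑-0 : ∀ xs → ∑ xs (λ _ → 0#) ≈ 0#
    ∑-0 []       = ≈-refl
    ∑-0 (x ∷ xs) = ≈-trans (+-identityˡ _) (∑-0 xs)

  module Swap {c : Level} (R : CommutativeSemiring c c) {A B : Set} where
    open CommutativeSemiring R using (Carrier; _≈_; +-cong) renaming (refl to ≈-refl; sym to ≈-sym; trans to ≈-trans)
    module SA = Sum R {A}
    module SB = Sum R {B}

    ∑-swap : ∀ xs ys (f : A → B → Carrier) →
      SA.∑ xs (λ x → SB.∑ ys (f x)) ≈ SB.∑ ys (λ y → SA.∑ xs (λ x → f x y))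
    ∑-swap []       ys f = ≈-sym (SB.∑-0 ys)
    ∑-swap (x ∷ xs) ys f = ≈-trans (+-cong ≈-refl (∑-swap xs ys f)) (≈-sym (SB.∑-+ ys _ _))

  open module ℕΣ {A : Set} = Sum ℕP.+-*-commutativeSemiring {A} public
  open module ℕSwap {A B : Set} = Swap ℕP.+-*-commutativeSemiring {A} {B} public using (∑-swap)

  open ℕP

  -- Counting, and lists as multisets

  𝟙 : Bool → ℕ
  𝟙 b = if b then 1 else 0

  module _ {A : Set} where

    ∑-mono : ∀ {xs} {f g : A → ℕ} → All (λ x → f x ≤ g x) xs → ∑ xs f ≤ ∑ xs g
    ∑-mono []       = z≤n
    ∑-mono (p ∷ ps) = +-mono-≤ p (∑-mono ps)

    ∑-const : ∀ (xs : List A) c → ∑ xs (λ _ → c) ≡ length xs * c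
    ∑-const []       c = ≡.refl
    ∑-const (x ∷ xs) c = cong (λ z → c + z) (∑-const xs c)

    ∑-≤ : ∀ {xs : List A} {f c} → All (λ x → f x ≤ c) xs → ∑ xs f ≤ length xs * c
    ∑-≤ {xs} {f} {c} p = ≤-trans (∑-mono p) (≤-reflexive (∑-const xs c))

    ∑-≥ : ∀ {xs : List A} {f c} → All (λ x → c ≤ f x) xs → length xs * c ≤ ∑ xs f
    ∑-≥ {xs} {f} {c} p = ≤-trans (≤-reflexive (≡.sym (∑-const xs c))) (∑-mono p)

    infix 4 _⊑_
    -- Multiset inclusion with the complement kept as a witness. It ignores order, so vertices can
    -- be removed and regrouped freely.
    record _⊑_ (xs ys : List A) : Set where
      constructor sub
      field
        {rest}    : List A
        partition : ys ↭ xs ++ rest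

    ⊑-refl : ∀ {xs} → xs ⊑ xs
    ⊑-refl {xs} = sub (↭-reflexive (≡.sym (++-identityʳ xs)))

    ⊑-trans : ∀ {xs ys zs} → xs ⊑ ys → ys ⊑ zs → xs ⊑ zs
    ⊑-trans {xs} (sub {us} p) (sub {vs} q) = sub (trans q (trans (++⁺ʳ vs p) (++-assoc xs us vs)))

    ⊑-++ˡ : ∀ xs ys → xs ⊑ xs ++ ys
    ⊑-++ˡ xs ys = sub ↭-refl

    ∑-⊑ : ∀ {xs ys} (f : A → ℕ) → xs ⊑ ys → ∑ xs f ≤ ∑ ys f
    ∑-⊑ {xs} f (sub {zs} p) rewrite ∑-↭ f p | ∑-++ xs zs f = m≤m+n _ _

    length-⊑ : ∀ {xs ys} → xs ⊑ ys → length xs ≤ length ys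
    length-⊑ {xs} (sub {zs} p) rewrite ↭-length p | length-++ xs {zs} = m≤m+n _ _

    All-⊑ : ∀ {p} {P : A → Set p} {xs ys} → xs ⊑ ys → All P ys → All P xs
    All-⊑ {xs = xs} (sub {zs} p) a = AllP.++⁻ˡ xs (All-resp-↭ p a)

    ⊑⇒∈ : ∀ {xs ys} {x : A} → xs ⊑ ys → x ∈ xs → x ∈ ys
    ⊑⇒∈ (sub {zs} p) m = ∈-resp-↭ (↭-sym p) (∈-++⁺ˡ m)

    ∈⇒↭ : ∀ {x : A} {xs} → x ∈ xs → ∃[ ys ] xs ↭ x ∷ ys
    ∈⇒↭ {x} m with ∈-∃++ m
    ... | ys , zs , ≡.refl = ys ++ zs , shift x ys zs

    partition-↭ : ∀ (p : A → Bool) xs → xs ↭ filterᵇ p xs ++ filterᵇ (not ∘ p) xs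
    partition-↭ p [] = refl
    partition-↭ p (x ∷ xs) with p x
    ... | true  = prep x (partition-↭ p xs)
    ... | false = trans (prep x (partition-↭ p xs)) (↭-sym (shift x (filterᵇ p xs) _))

    filter-⊑ : ∀ (p : A → Bool) xs → filterᵇ p xs ⊑ xs
    filter-⊑ p xs = sub (partition-↭ p xs)

    filter-All : ∀ (p : A → Bool) xs → All (λ x → p x ≡ true) (filterᵇ p xs)
    filter-All p xs = All.map (Equivalence.to T-≡) (AllP.all-filter (T? ∘ p) xs)

    count : (A → Bool) → List A → ℕ
    count p xs = ∑ xs (𝟙 ∘ p)

    length-filterᵇ : ∀ (p : A → Bool) xs → length (filterᵇ p xs) ≡ count p xs
    length-filterᵇ p [] = ≡.refl
    length-filterᵇ p (x ∷ xs) with p x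
    ... | true  = cong suc (length-filterᵇ p xs)
    ... | false = length-filterᵇ p xs

    count+count-not : ∀ (p : A → Bool) xs → count p xs + count (not ∘ p) xs ≡ length xs
    count+count-not p xs = ≡.trans
      (cong₂ _+_ (≡.sym (length-filterᵇ p xs)) (≡.sym (length-filterᵇ (not ∘ p) xs)))
      (≡.trans (≡.sym (length-++ (filterᵇ p xs))) (≡.sym (↭-length (partition-↭ p xs))))

    count-All : ∀ {p : A → Bool} {xs} → All (λ x → p x ≡ true) xs → count p xs ≡ length xs
    count-All []       = ≡.refl
    count-All (q ∷ qs) rewrite q = cong suc (count-All qs)

    count-⊑ : ∀ {p : A → Bool} {xs ys} → xs ⊑ ys → All (λ x → p x ≡ true) xs → length xs ≤ count p ys
    count-⊑ {p} s a = ≤-trans (≤-reflexive (≡.sym (count-All a))) (∑-⊑ (𝟙 ∘ p) s)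

  -- Puts a submultiset into the order of the ambient list; the absorbing chain has to meet its
  -- vertices in that order.
  ⊑⇒sublist : ∀ {A : Set} {xs ys : List A} → xs ⊑ ys → ∃[ zs ] (zs Sub.⊆ ys) × xs ↭ zs
  ⊑⇒sublist {A} (sub {us} p) = go p (SubP.++⁺ʳ us Sub.⊆-refl)
    where
    go : ∀ {xs ys ws : List A} → ys ↭ ws → xs Sub.⊆ ws → ∃[ zs ] (zs Sub.⊆ ys) × xs ↭ zs
    go refl s = _ , s , refl
    go (prep x p) (.x ∷ʳ s) with go p s
    ... | zs , t , q = zs , x ∷ʳ t , q
    go (prep x p) (≡.refl ∷ s) with go p s
    ... | zs , t , q = x ∷ zs , ≡.refl ∷ t , prep x q
    go (swap x y p) (.y ∷ʳ .x ∷ʳ s) with go p s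
    ... | zs , t , q = zs , x ∷ʳ y ∷ʳ t , q
    go (swap x y p) (.y ∷ʳ ≡.refl ∷ s) with go p s
    ... | zs , t , q = x ∷ zs , ≡.refl ∷ y ∷ʳ t , prep x q
    go (swap x y p) (≡.refl ∷ .x ∷ʳ s) with go p s
    ... | zs , t , q = y ∷ zs , x ∷ʳ ≡.refl ∷ t , prep y q
    go (swap x y p) (≡.refl ∷ ≡.refl ∷ s) with go p s
    ... | zs , t , q = x ∷ y ∷ zs , ≡.refl ∷ ≡.refl ∷ t , swap y x q
    go (trans p p′) s with go p′ s
    ... | zs , t , q with go p t
    ... | zs′ , t′ , q′ = zs′ , t′ , ↭-trans q q′

  ++-interchange : ∀ {A : Set} (ws xs ys zs : List A) → (ws ++ xs) ++ (ys ++ zs) ↭ (ws ++ ys) ++ (xs ++ zs)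
  ++-interchange ws xs ys zs = ↭-trans (++-assoc ws xs (ys ++ zs))
    (↭-trans (++⁺ˡ ws (shifts xs ys)) (↭-sym (++-assoc ws ys (xs ++ zs))))

  -- Arithmetic of greedy choices: `suc m` disjoint pieces of at most `c` vertices are taken from a
  -- list, where more than `x + c` vertices suffice for one search. `room-one` permits the next
  -- search, `room-rest` the remaining ones.
  room-one : ∀ x c m {p} → x + c * suc m < p → x + c < p
  room-one x c m lt = ≤-trans (s≤s (+-monoʳ-≤ x (m≤m*n c (suc m)))) lt

  room-rest : ∀ x c m g {p q} → x + c * suc m < p → p ≡ g + q → g ≤ c → x + c * m < q
  room-rest x c m g {p} {q} lt eq g≤c = +-cancelˡ-< c (x + c * m) q (begin-strict
    c + (x + c * m)   ≡⟨ arith c x (c * m) ⟩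
    x + (c + c * m)   ≡⟨ cong (λ z → x + z) (*-suc c m) ⟨
    x + c * suc m     <⟨ lt ⟩
    p                 ≡⟨ eq ⟩
    g + q             ≤⟨ +-monoˡ-≤ q g≤c ⟩
    c + q             ∎)
    where
    open ≤-Reasoning
    arith : ∀ c x y → c + (x + y) ≡ x + (c + y)
    arith = solve-∀

  length-↭-++ : ∀ {A : Set} {P : List A} S {P′} → P ↭ S ++ P′ → length P ≡ length S + length P′
  length-↭-++ S e = ≡.trans (↭-length e) (length-++ S)

  length-++-≤ : ∀ {A : Set} (xs : List A) {ys} c m → length xs ≤ c → length ys ≤ c * m → length (xs ++ ys) ≤ c * suc m
  length-++-≤ xs c m p q = ≤-trans (≤-reflexive (length-++ xs)) (≤-trans (+-mono-≤ p q) (≤-reflexive (≡.sym (*-suc c m))))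

  ↭-++-assoc : ∀ {A : Set} {P P₁ : List A} xs ys zs → P ↭ xs ++ P₁ → P₁ ↭ ys ++ zs → P ↭ (xs ++ ys) ++ zs
  ↭-++-assoc xs ys zs p q = ↭-trans p (↭-trans (++⁺ˡ xs q) (↭-sym (++-assoc xs ys zs)))

  rest-⊑ : ∀ {A : Set} {P U : List A} S {P′} → P ↭ S ++ P′ → P ⊑ U → P′ ⊑ U
  rest-⊑ S {P′} e = ⊑-trans (sub (↭-trans e (++-comm S P′)))

  ≤ᵇ-true : ∀ {m n} → m ≤ n → (m ≤ᵇ n) ≡ true
  ≤ᵇ-true p = Equivalence.to T-≡ (≤⇒≤ᵇ p)

  ≤ᵇ-true⁻ : ∀ {m n} → (m ≤ᵇ n) ≡ true → m ≤ n
  ≤ᵇ-true⁻ {m} {n} p = ≤ᵇ⇒≤ m n (Equivalence.from T-≡ p)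

  ≤ᵇ-false : ∀ {m n} → n < m → (m ≤ᵇ n) ≡ false
  ≤ᵇ-false {m} {n} p with m ≤ᵇ n in eq
  ... | false = ≡.refl
  ... | true  = contradiction (≤ᵇ-true⁻ {m} {n} eq) (<⇒≱ p)

  𝟙-≤ᵇ-mono : ∀ {m n m′ n′} → (m ≤ n → m′ ≤ n′) → 𝟙 (m ≤ᵇ n) ≤ 𝟙 (m′ ≤ᵇ n′)
  𝟙-≤ᵇ-mono {m} {n} {m′} {n′} f with m ≤? n
  ... | yes p rewrite ≤ᵇ-true p | ≤ᵇ-true (f p) = ≤-refl
  ... | no ¬p rewrite ≤ᵇ-false (≰⇒> ¬p) = z≤n

  𝟙≤1 : ∀ b → 𝟙 b ≤ 1
  𝟙≤1 true  = ≤-refl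
  𝟙≤1 false = z≤n

  -- Layer-cake sums and quantiles of a weight

  layers : ∀ M x → ∑ (downFrom M) (λ θ → 𝟙 (suc θ ≤ᵇ x)) ≡ M ⊓ x
  layers zero    x = ≡.refl
  layers (suc M) x with suc M ≤? x
  ... | yes p rewrite ≤ᵇ-true p = ≡.trans (cong suc (≡.trans (layers M x) (m≤n⇒m⊓n≡m (<⇒≤ p)))) (≡.sym (m≤n⇒m⊓n≡m p))
  ... | no ¬p rewrite ≤ᵇ-false (≰⇒> ¬p) =
    ≡.trans (layers M x) (≡.trans (m≥n⇒m⊓n≡n (≤-pred (≰⇒> ¬p))) (≡.sym (m≥n⇒m⊓n≡n (<⇒≤ (≰⇒> ¬p)))))

  layers-≥ : ∀ {M x} → x ≤ M → ∑ (downFrom M) (λ θ → 𝟙 (suc θ ≤ᵇ x)) ≡ x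
  layers-≥ {M} {x} p = ≡.trans (layers M x) (m≥n⇒m⊓n≡n p)

  -- In the application `g t` counts the elements of weight at least `t`. Read from the last entry
  -- to the first, the entries have at least y/k, 2y/k, 3y/k, ... elements above them.
  data Levels (y k : ℕ) (g : ℕ → ℕ) : List ℕ → Set where
    []  : Levels y k g []
    _∷_ : ∀ {t ts} → suc (length ts) * y ≤ k * g t → Levels y k g ts → Levels y k g (t ∷ ts)

  ∑-∈ : ∀ {A : Set} (f : A → ℕ) {x xs} → x ∈ xs → f x ≤ ∑ xs f
  ∑-∈ f (here ≡.refl) = m≤m+n _ _
  ∑-∈ f (there m) = ≤-trans (∑-∈ f m) (m≤n+m _ _)

  ∑-cong-∈ : ∀ {A : Set} xs {f g : A → ℕ} → (∀ {x} → x ∈ xs → f x ≡ g x) → ∑ xs f ≡ ∑ xs g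
  ∑-cong-∈ []       eq = ≡.refl
  ∑-cong-∈ (x ∷ xs) eq = cong₂ _+_ (eq (here ≡.refl)) (∑-cong-∈ xs (eq ∘ there))

  module _ {A : Set} (U : List A) (w : A → ℕ) where

    above : ℕ → ℕ
    above t = count (λ z → t ≤ᵇ w z) U

    above-mono : ∀ {s t} → s ≤ t → above t ≤ above s
    above-mono {s} {t} p = ∑-mono (All.universal (λ z → 𝟙-≤ᵇ-mono {t} {w z} {s} {w z} (≤-trans p)) U)

    -- At most suc (length ts) entries are counted, from the first entry above θ on.
    levels-layer : ∀ {y k ts} → Levels y k above ts → ∀ θ →
      y * ∑ ts (λ t → 𝟙 (suc θ ≤ᵇ t)) ≤ k * above (suc θ)
    levels-layer {y} [] θ rewrite *-zeroʳ y = z≤n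
    levels-layer {y} {k} {t ∷ ts} (p ∷ ps) θ with suc θ ≤? t
    ... | no ¬q rewrite ≤ᵇ-false (≰⇒> ¬q) = levels-layer ps θ
    ... | yes q = begin
        y * ∑ (t ∷ ts) (λ t → 𝟙 (suc θ ≤ᵇ t))   ≤⟨ *-monoʳ-≤ y (∑-≤ {xs = t ∷ ts} {c = 1} (All.universal (λ t → 𝟙≤1 (suc θ ≤ᵇ t)) (t ∷ ts))) ⟩
        y * (suc (length ts) * 1)               ≡⟨ cong (y *_) (*-identityʳ (suc (length ts))) ⟩
        y * suc (length ts)                     ≡⟨ *-comm y (suc (length ts)) ⟩
        suc (length ts) * y                     ≤⟨ p ⟩
        k * above t                             ≤⟨ *-monoʳ-≤ k (above-mono q) ⟩
        k * above (suc θ)                       ∎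
      where open ≤-Reasoning

    -- Layer cake: the bound of `levels-layer` at each height is summed over all heights, which
    -- turns both counts into sums of weights. `M` only has to be at least every weight and every
    -- entry.
    levels-sum : ∀ {y k ts} → Levels y k above ts → y * ∑ ts id ≤ k * ∑ U w
    levels-sum {y} {k} {ts} ls = begin
      y * ∑ ts id                                                    ≡⟨ cong (y *_) (∑-cong-∈ ts λ m → layers-≥ (≤-trans (∑-∈ id m) (m≤n+m _ (∑ U w)))) ⟨
      y * ∑ ts (λ t → ∑ (downFrom M) (λ θ → 𝟙 (suc θ ≤ᵇ t)))         ≡⟨ cong (y *_) (∑-swap ts (downFrom M) _) ⟩
      y * ∑ (downFrom M) (λ θ → ∑ ts (λ t → 𝟙 (suc θ ≤ᵇ t)))         ≡⟨ ∑-* (downFrom M) y _ ⟨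
      ∑ (downFrom M) (λ θ → y * ∑ ts (λ t → 𝟙 (suc θ ≤ᵇ t)))         ≤⟨ ∑-mono (All.universal (levels-layer ls) (downFrom M)) ⟩
      ∑ (downFrom M) (λ θ → k * above (suc θ))                       ≡⟨ ∑-* (downFrom M) k _ ⟩
      k * ∑ (downFrom M) (λ θ → ∑ U (λ z → 𝟙 (suc θ ≤ᵇ w z)))        ≡⟨ cong (k *_) (∑-swap (downFrom M) U _) ⟩
      k * ∑ U (λ z → ∑ (downFrom M) (λ θ → 𝟙 (suc θ ≤ᵇ w z)))        ≡⟨ cong (k *_) (∑-cong-∈ U λ m → layers-≥ (≤-trans (∑-∈ w m) (m≤m+n _ _))) ⟩
      k * ∑ U w                                                      ∎
      where
      open ≤-Reasoning
      M = ∑ U w + ∑ ts id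

    -- A quantile: `τ` is the least value such that `s` elements have weight at most `τ`, so fewer
    -- than `s` lie strictly below it when `τ` is positive.
    threshold : ∀ s y → length U ≡ s + y → ∃[ τ ] s ≤ count (λ z → w z ≤ᵇ τ) U × y ≤ above τ
    threshold s y |U| with search (∑ U w)
      where
      below : ℕ → ℕ
      below τ = count (λ z → w z ≤ᵇ τ) U
      search : ∀ M → below M < s ⊎ (∃[ τ ] s ≤ below τ × y ≤ above τ)
      search zero with s ≤? below 0
      ... | no ¬p = inj₁ (≰⇒> ¬p)
      ... | yes p = inj₂ (0 , p , ≤-trans (m≤n+m y s) (≤-reflexive (≡.trans (≡.sym |U|)
                      (≡.sym (count-All (All.universal (λ z → ≤ᵇ-true {0} {w z} z≤n) U))))))
      search (suc M) with search M
      ... | inj₂ found = inj₂ found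
      ... | inj₁ lt with s ≤? below (suc M)
      ...   | no ¬p = inj₁ (≰⇒> ¬p)
      ...   | yes p = inj₂ (suc M , p , +-cancelˡ-≤ s _ _ (begin
        s + y                                             ≡⟨ |U| ⟨
        length U                                          ≡⟨ count+count-not (λ z → w z ≤ᵇ M) U ⟨
        below M + count (λ z → not (w z ≤ᵇ M)) U          ≤⟨ +-mono-≤ (<⇒≤ lt) (∑-mono (All.universal (λ z → flip-≤ (w z)) U)) ⟩
        s + above (suc M)                                 ∎))
        where
        open ≤-Reasoning
        flip-≤ : ∀ x → 𝟙 (not (x ≤ᵇ M)) ≤ 𝟙 (suc M ≤ᵇ x)
        flip-≤ x with x ≤? M
        ... | yes q rewrite ≤ᵇ-true q = z≤n
        ... | no ¬q rewrite ≤ᵇ-false (≰⇒> ¬q) | ≤ᵇ-true (≰⇒> ¬q) = ≤-refl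
    ... | inj₂ found = found
    ... | inj₁ lt = contradiction lt (≤⇒≯ (≤-trans (m≤m+n s y) (≤-reflexive (≡.trans (≡.sym |U|)
                      (≡.sym (count-All {xs = U} (All.tabulate λ m → ≤ᵇ-true (∑-∈ w m))))))))

  minimal : ∀ {A : Set} (w : A → ℕ) {x : A} {xs} → x ∈ xs → ∃[ y ] y ∈ xs × All (λ z → w y ≤ w z) xs
  minimal w {xs = x ∷ []} _ = x , here ≡.refl , ≤-refl ∷ []
  minimal w {xs = x ∷ xs@(_ ∷ _)} _ with minimal w {xs = xs} (here ≡.refl)
  ... | y , y∈ , le with ≤-total (w x) (w y)
  ...   | inj₁ p = x , here ≡.refl , ≤-refl ∷ All.map (≤-trans p) le
  ...   | inj₂ p = y , there y∈ , p ∷ le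

  -- Integer sums and passing between naturals and integers

  open module ℤΣ {A : Set} = Sum ℤP.+-*-commutativeSemiring {A} public
    renaming (∑ to ∑ᶻ; ∑-cong to ∑ᶻ-cong; ∑-++ to ∑ᶻ-++; ∑-↭ to ∑ᶻ-↭; ∑-+ to ∑ᶻ-+; ∑-* to ∑ᶻ-*; ∑-0 to ∑ᶻ-0)
  open module ℤSwap {A B : Set} = Swap ℤP.+-*-commutativeSemiring {A} {B} public using () renaming (∑-swap to ∑ᶻ-swap)

  module _ {A : Set} where

    pos-∑ : ∀ (xs : List A) f → + ∑ xs f ≡ ∑ᶻ xs (λ x → + f x)
    pos-∑ []       f = ≡.refl
    pos-∑ (x ∷ xs) f = ≡.trans (ℤP.pos-+ (f x) (∑ xs f)) (cong (λ z → + f x ℤ.+ z) (pos-∑ xs f))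

    ∑ᶻ-const : ∀ (xs : List A) c → ∑ᶻ xs (λ _ → c) ≡ + length xs ℤ.* c
    ∑ᶻ-const []       c = ≡.refl
    ∑ᶻ-const (x ∷ xs) c = ≡.trans (cong (λ z → c ℤ.+ z) (∑ᶻ-const xs c)) (e (+ length xs) c)
      where
      e : ∀ n c → c ℤ.+ n ℤ.* c ≡ (+ 1 ℤ.+ n) ℤ.* c
      e = ℤSolver.solve-∀

  ∣i∣*∣i∣ : ∀ i → + (∣ i ∣ * ∣ i ∣) ≡ i ℤ.* i
  ∣i∣*∣i∣ (+ n)    = ℤP.pos-* n n
  ∣i∣*∣i∣ -[1+ n ] = ≡.refl

  ≤-from-≡ : ∀ {i p q} → i ℤ.+ + p ≡ + q → i ℤ.≤ + q
  ≤-from-≡ {i} {p} {q} eq = ℤP.≤-trans (ℤP.i≤i+j i (+ p)) (ℤP.≤-reflexive eq)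

  ∣-∣-≤ : ∀ {x y m} → x ≤ m → y ≤ m → ∣ + x ℤ.- + y ∣ ≤ m
  ∣-∣-≤ {x} {y} {m} p q with ≤-total x y
  ... | inj₁ x≤y = ≤-trans (≤-reflexive (≡.trans (cong ∣_∣ (ℤP.m-n≡m⊖n x y)) (ℤP.∣⊖∣-≤ x≤y))) (≤-trans (m∸n≤m y x) q)
  ... | inj₂ y≤x = ≤-trans (≤-reflexive (cong ∣_∣ (≡.trans (ℤP.m-n≡m⊖n x y) (ℤP.⊖-≥ y≤x)))) (≤-trans (m∸n≤m x y) p)

  ≤-from-difference : ∀ {x y d} → + x ℤ.+ d ≡ + y → (x ≤ y + ∣ d ∣) × (y ≤ x + ∣ d ∣)
  ≤-from-difference {x} {y} {d} eq = first , second
    where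
    first : x ≤ y + ∣ d ∣
    first = ≤-trans (≤-reflexive (cong ∣_∣ (≡.trans (e (+ x) d) (cong (ℤ._- d) eq)))) (ℤP.∣i-j∣≤∣i∣+∣j∣ (+ y) d)
      where
      e : ∀ x d → x ≡ x ℤ.+ d ℤ.- d
      e = ℤSolver.solve-∀
    second : y ≤ x + ∣ d ∣
    second = ≤-trans (≤-reflexive (cong ∣_∣ (≡.sym eq))) (ℤP.∣i+j∣≤∣i∣+∣j∣ (+ x) d)

  -- The choice of constants

  module Constants (κ e k r C : ℕ) where

    -- With 1 / e ≤ ε, ε′ = 1 / E and a = ⌊n / E⌋ as the unit of length: X consists of 2eτ′a cliques, each of the
    -- p phases of the almost perfect tiling removes τa cliques, and it stops at νa vertices; b₀a and l₀a bound the
    -- number of bad vertices for X and for one phase.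
    s₀ ρ h₁ b₀ g p l₀ R τ τ′ E′ ν : ℕ
    s₀ = (8 * (4 * e) * k) ^ suc κ + r
    ρ  = 2 * (suc C * (2 * e * r)) + 32 * e * r + 2
    h₁ = 2 * e * k * ρ
    b₀ = 9 * s₀ * (h₁ * h₁)
    g  = 16 * e * r + r + 2
    p  = 2 * e * ρ * g
    l₀ = 9 * s₀ * (4 * (p * (4 * e) * k) * (4 * (p * (4 * e) * k)))
    R  = s₀ + 4 * (p * (4 * e) * l₀) + 16 * e + p * l₀
    τ  = suc r * b₀ + 2 + R
    τ′ = g * τ
    E′ = ρ * τ′
    ν  = 16 * e * (r * τ) + (s₀ + r * τ) + 4 * (p * (4 * e) * l₀) + 16 * e

    opaque
      E : ℕ
      E = e * E′

    module Bounds (e>0 : 0 < e) (k>0 : 0 < k) (r>0 : 0 < r) where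

      private
        open ≤-Reasoning
        instance
          nze : NonZero e
          nze = >-nonZero e>0
          nzr : NonZero r
          nzr = >-nonZero r>0

        lemma-c₂ : ∀ e r ρ t a {n} → 32 * e * r ≤ ρ → e * (ρ * t) * a ≤ n → 4 * (4 * e) * (r * (2 * e * t * a)) ≤ n
        lemma-c₂ e r ρ t a {n} le En = begin
          4 * (4 * e) * (r * (2 * e * t * a))   ≡⟨ i e r t a ⟩
          32 * e * r * (e * t * a)              ≤⟨ *-monoˡ-≤ (e * t * a) le ⟩
          ρ * (e * t * a)                       ≡⟨ j ρ e t a ⟩
          e * (ρ * t) * a                       ≤⟨ En ⟩
          n                                     ∎
          where
          i : ∀ e r t a → 4 * (4 * e) * (r * (2 * e * t * a)) ≡ 32 * e * r * (e * t * a)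
          i = solve-∀
          j : ∀ ρ e t a → ρ * (e * t * a) ≡ e * (ρ * t) * a
          j = solve-∀

        lemma-c₃ : ∀ e r ρ t a s {n} → 0 < e → 2 * e * r + 1 ≤ ρ → s ≤ t → e * (ρ * t) * a ≤ n → s * a + r * (2 * e * t * a) ≤ n
        lemma-c₃ e r ρ t a s {n} e>0 le st En = begin
          s * a + r * (2 * e * t * a)      ≤⟨ +-monoˡ-≤ _ (*-monoˡ-≤ a st) ⟩
          t * a + r * (2 * e * t * a)      ≡⟨ i t a r e ⟩
          (2 * e * r + 1) * (t * a)        ≤⟨ *-monoˡ-≤ (t * a) le ⟩
          ρ * (t * a)                      ≤⟨ m≤n*m (ρ * (t * a)) e {{>-nonZero e>0}} ⟩
          e * (ρ * (t * a))                ≡⟨ j e ρ t a ⟩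
          e * (ρ * t) * a                  ≤⟨ En ⟩
          n                                ∎
          where
          i : ∀ t a r e → t * a + r * (2 * e * t * a) ≡ (2 * e * r + 1) * (t * a)
          i = solve-∀
          j : ∀ e ρ t a → e * (ρ * (t * a)) ≡ e * (ρ * t) * a
          j = solve-∀

        lemma-c₄ : ∀ e k r ρ t a {n} → 0 < r → n ≤ 2 * (e * (ρ * t) * a) → 2 * e * k * n ≤ 2 * e * k * ρ * (r * (2 * e * t * a))
        lemma-c₄ e k r ρ t a {n} r>0 nE = begin
          2 * e * k * n                            ≤⟨ *-monoʳ-≤ (2 * e * k) nE ⟩
          2 * e * k * (2 * (e * (ρ * t) * a))      ≡⟨ i e k ρ t a ⟩
          2 * e * k * ρ * (2 * e * t * a)          ≤⟨ *-monoʳ-≤ (2 * e * k * ρ) (m≤n*m (2 * e * t * a) r {{>-nonZero r>0}}) ⟩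
          2 * e * k * ρ * (r * (2 * e * t * a))    ∎
          where
          i : ∀ e k ρ t a → 2 * e * k * (2 * (e * (ρ * t) * a)) ≡ 2 * e * k * ρ * (2 * e * t * a)
          i = solve-∀

        lemma-c₆ : ∀ C e r q t a b s h → suc r * b + 1 ≤ t → b * a ≡ 9 * (s * a) * h →
          2 * (r * (2 * e * t * a) + C * (r * (2 * e * t * a)) + suc r * (9 * (s * a) * h) + a) ≤ (2 * (suc C * (2 * e * r)) + q + 2) * t * a
        lemma-c₆ C e r q t a b s h le eq = begin
          2 * (r * (2 * e * t * a) + C * (r * (2 * e * t * a)) + suc r * (9 * (s * a) * h) + a)
            ≡⟨ cong (λ z → 2 * (r * (2 * e * t * a) + C * (r * (2 * e * t * a)) + suc r * z + a)) eq ⟨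
          2 * (r * (2 * e * t * a) + C * (r * (2 * e * t * a)) + suc r * (b * a) + a)
            ≡⟨ i r e t a C b ⟩
          2 * (suc C * (2 * e * r)) * t * a + 2 * (suc r * b + 1) * a
            ≤⟨ +-monoʳ-≤ (2 * (suc C * (2 * e * r)) * t * a) (*-monoˡ-≤ a (*-monoʳ-≤ 2 le)) ⟩
          2 * (suc C * (2 * e * r)) * t * a + 2 * t * a
            ≤⟨ m≤m+n _ (q * t * a) ⟩
          2 * (suc C * (2 * e * r)) * t * a + 2 * t * a + q * t * a
            ≡⟨ j (2 * (suc C * (2 * e * r))) t a q ⟩
          (2 * (suc C * (2 * e * r)) + q + 2) * t * a ∎
          where
          i : ∀ r e t a C b → 2 * (r * (2 * e * t * a) + C * (r * (2 * e * t * a)) + suc r * (b * a) + a) ≡ 2 * (suc C * (2 * e * r)) * t * a + 2 * (suc r * b + 1) * a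
          i = solve-∀
          j : ∀ x t a q → x * t * a + 2 * t * a + q * t * a ≡ (x + q + 2) * t * a
          j = solve-∀

        -- Here the constants could run in a circle: X must exceed r times the leftover, whose bound
        -- `ν` contains multiples of `τ`. The factor `g` in `τ′` pays for these multiples, and `τ`
        -- itself contains the remaining part `R`. This is consistent because `p` and `l₀` depend on
        -- `g` but not on `τ`.
        lemma-d₆ : ∀ b r e s y z w → 0 < r →
          b + 1 + r * (16 * e * (r * (suc r * b + 2 + (s + y + z + w))) + (s + r * (suc r * b + 2 + (s + y + z + w))) + y + z + w)
            < r * ((16 * e * r + r + 2) * (suc r * b + 2 + (s + y + z + w)))
        lemma-d₆ b (suc r′) e s y z w _ = ≤-trans (m≤m+n _ _) (≤-reflexive (i b r′ e s y z w))
          where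
          i : ∀ b r′ e s y z w →
            suc (b + 1 + suc r′ * (16 * e * (suc r′ * (suc (suc r′) * b + 2 + (s + y + z + w))) + (s + suc r′ * (suc (suc r′) * b + 2 + (s + y + z + w))) + y + z + w))
            + (suc r′ * (suc (suc r′) * b + 2) + r′ * (suc (suc r′) * b + 2 + (s + y + z + w)) + suc r′ * b + (s + y + z + w))
            ≡ suc r′ * ((16 * e * suc r′ + suc r′ + 2) * (suc (suc r′) * b + 2 + (s + y + z + w)))
          i = solve-∀

        step-a : ∀ p q k s a → 9 * (s * a) * (4 * (p * q * k) * (4 * (p * q * k))) ≡ 9 * s * (4 * (p * q * k) * (4 * (p * q * k))) * a
        step-a = solve-∀

        b-a : ∀ s h a → 9 * s * h * a ≡ 9 * (s * a) * h
        b-a = solve-∀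

        32er≤ρ : 32 * e * r ≤ ρ
        32er≤ρ = ≤-trans (m≤n+m (32 * e * r) (2 * (suc C * (2 * e * r)))) (m≤m+n _ 2)

        2er+1≤ρ : 2 * e * r + 1 ≤ ρ
        2er+1≤ρ = +-mono-≤ (≤-trans (*-monoˡ-≤ r (*-monoˡ-≤ e (m≤m+n 2 30))) (m≤n+m (32 * e * r) (2 * (suc C * (2 * e * r))))) (s≤s z≤n)

        1≤g : 1 ≤ g
        1≤g = ≤-trans (s≤s z≤n) (m≤n+m 2 (16 * e * r + r))

        1≤ρ : 1 ≤ ρ
        1≤ρ = ≤-trans (s≤s z≤n) (m≤n+m 2 (2 * (suc C * (2 * e * r)) + 32 * e * r))

        τ≤τ′ : τ ≤ τ′
        τ≤τ′ = m≤n*m τ g {{>-nonZero 1≤g}}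

        R≤τ : R ≤ τ
        R≤τ = m≤n+m R (suc r * b₀ + 2)

        s₀≤τ′ : s₀ ≤ τ′
        s₀≤τ′ = ≤-trans (≤-trans (m≤m+n s₀ _) (≤-trans (m≤m+n _ (16 * e)) (m≤m+n _ (p * l₀)))) (≤-trans R≤τ τ≤τ′)

        16e≤τ : 16 * e ≤ τ
        16e≤τ = ≤-trans (≤-trans (m≤n+m (16 * e) (s₀ + 4 * (p * (4 * e) * l₀))) (m≤m+n _ (p * l₀))) R≤τ

        4*4e : ∀ e → 4 * (4 * e) ≡ 16 * e
        4*4e = solve-∀

      p>0 : 0 < p
      p>0 = *-mono-≤ {1} {2 * e * ρ} (*-mono-≤ {1} {2 * e} (*-mono-≤ {1} {2} (s≤s z≤n) e>0) 1≤ρ) 1≤g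

      h₁>0 : 0 < h₁
      h₁>0 = *-mono-≤ {1} {2 * e * k} (*-mono-≤ {1} {2 * e} (*-mono-≤ {1} {2} (s≤s z≤n) e>0) k>0) 1≤ρ

      opaque
        unfolding E

        E>0 : 0 < E
        E>0 = *-mono-≤ {1} {e} e>0 (*-mono-≤ {1} {ρ} 1≤ρ (≤-trans (≤-trans (s≤s z≤n) (≤-trans (m≤n+m 2 (suc r * b₀)) (m≤m+n _ R))) τ≤τ′))

      -- `c₁` to `c₇` provide X and the room for the absorbing structure, `d₁` to `d₅` run the
      -- phases, and `d₆` makes X large enough to cover the leftover. As n is within a factor 2 of
      -- `E * a`, it can be compared with multiples of `a` from both sides.
      module Conditions {a n : ℕ} (a>0 : 0 < a) (En : E * a ≤ n) (nE : n ≤ 2 * (E * a)) where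

        private
          instance
            nza : NonZero a
            nza = >-nonZero a>0

          opaque
            unfolding E

            En′ : e * E′ * a ≤ n
            En′ = En

            nE′ : n ≤ 2 * (e * E′ * a)
            nE′ = nE

        s T₁ x′ n′ T N₀ : ℕ
        s  = s₀ * a
        T₁ = 2 * e * τ′ * a
        x′ = r * τ′ * a
        n′ = E′ * a
        T  = τ * a
        N₀ = ν * a

        lt : (8 * (4 * e) * k) ^ suc κ * a < s
        lt = *-monoˡ-< a (≤-trans (≤-reflexive (+-comm 1 _)) (+-monoʳ-≤ ((8 * (4 * e) * k) ^ suc κ) r>0))

        r≤s : r ≤ s
        r≤s = ≤-trans (m≤n+m r ((8 * (4 * e) * k) ^ suc κ)) (m≤m*n s₀ a)

        c₁ : 4 * (4 * e) ≤ n
        c₁ = begin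
          4 * (4 * e)   ≡⟨ 4*4e e ⟩
          16 * e        ≤⟨ 16e≤τ ⟩
          τ             ≤⟨ τ≤τ′ ⟩
          τ′            ≤⟨ m≤n*m τ′ ρ {{>-nonZero 1≤ρ}} ⟩
          E′            ≤⟨ m≤n*m E′ e ⟩
          e * E′        ≤⟨ m≤m*n (e * E′) a ⟩
          e * E′ * a    ≤⟨ En′ ⟩
          n             ∎

        c₂ : 4 * (4 * e) * (r * T₁) ≤ n
        c₂ = lemma-c₂ e r ρ τ′ a 32er≤ρ En′

        c₃ : s + r * T₁ ≤ n
        c₃ = lemma-c₃ e r ρ τ′ a s₀ e>0 2er+1≤ρ s₀≤τ′ En′

        c₄ : 2 * e * k * n ≤ h₁ * (r * T₁)
        c₄ = lemma-c₄ e k r ρ τ′ a r>0 nE′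

        c₅ : e * n′ ≤ n
        c₅ = ≤-trans (≤-reflexive (≡.sym (*-assoc e E′ a))) En′

        c₆ : 2 * (r * T₁ + C * (r * T₁) + suc r * (9 * s * (h₁ * h₁)) + a) ≤ n′
        c₆ = lemma-c₆ C e r (32 * e * r) τ′ a b₀ s₀ (h₁ * h₁)
          (≤-trans (≤-trans (+-monoʳ-≤ (suc r * b₀) (s≤s z≤n)) (m≤m+n (suc r * b₀ + 2) R)) τ≤τ′) (b-a s₀ (h₁ * h₁) a)

        c₇ : r * T₁ ≡ 2 * e * x′
        c₇ = i r e τ′ a
          where
          i : ∀ r e t a → r * (2 * e * t * a) ≡ 2 * e * (r * t * a)
          i = solve-∀

        d₁ : 4 * (4 * e) ≤ N₀
        d₁ = ≤-trans (≤-reflexive (4*4e e)) (≤-trans (m≤n+m (16 * e) (16 * e * (r * τ) + (s₀ + r * τ) + 4 * (p * (4 * e) * l₀))) (m≤m*n ν a))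

        d₂ : 4 * (4 * e) * (r * T) ≤ N₀
        d₂ = ≤-trans (≤-reflexive (i e r τ a)) (*-monoˡ-≤ a (≤-trans (m≤m+n (16 * e * (r * τ)) _) (≤-trans (m≤m+n _ (4 * (p * (4 * e) * l₀))) (m≤m+n _ (16 * e)))))
          where
          i : ∀ e r t a → 4 * (4 * e) * (r * (t * a)) ≡ 16 * e * (r * t) * a
          i = solve-∀

        d₃ : s + r * T ≤ N₀
        d₃ = ≤-trans (≤-reflexive (i s₀ r τ a)) (*-monoˡ-≤ a (≤-trans (m≤n+m (s₀ + r * τ) (16 * e * (r * τ))) (≤-trans (m≤m+n _ (4 * (p * (4 * e) * l₀))) (m≤m+n _ (16 * e)))))
          where
          i : ∀ s r t a → s * a + r * (t * a) ≡ (s + r * t) * a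
          i = solve-∀

        d₄ : 4 * (p * (4 * e) * (9 * s * (4 * (p * (4 * e) * k) * (4 * (p * (4 * e) * k))))) ≤ N₀
        d₄ = begin
          4 * (p * (4 * e) * (9 * s * (4 * (p * (4 * e) * k) * (4 * (p * (4 * e) * k)))))   ≡⟨ cong (λ z → 4 * (p * (4 * e) * z)) (step-a p (4 * e) k s₀ a) ⟩
          4 * (p * (4 * e) * (l₀ * a))                                                      ≡⟨ i (p * (4 * e)) l₀ a ⟩
          4 * (p * (4 * e) * l₀) * a                                                        ≤⟨ *-monoˡ-≤ a (≤-trans (m≤n+m (4 * (p * (4 * e) * l₀)) (16 * e * (r * τ) + (s₀ + r * τ))) (m≤m+n _ (16 * e))) ⟩
          N₀                                                                                ∎
          where
          i : ∀ x l a → 4 * (x * (l * a)) ≡ 4 * (x * l) * a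
          i = solve-∀

        d₅ : n ≤ p * (r * T)
        d₅ = begin
          n                            ≤⟨ nE′ ⟩
          2 * (e * E′ * a)                ≡⟨ i e ρ g τ a ⟩
          p * (τ * a)                  ≤⟨ *-monoʳ-≤ p (m≤n*m (τ * a) r) ⟩
          p * (r * T)                  ∎
          where
          i : ∀ e ρ g t a → 2 * (e * (ρ * (g * t)) * a) ≡ 2 * e * ρ * g * (t * a)
          i = solve-∀

        d₆ : 9 * s * (h₁ * h₁) + a + r * (N₀ + p * (9 * s * (4 * (p * (4 * e) * k) * (4 * (p * (4 * e) * k))))) < x′
        d₆ = begin-strict
          9 * s * (h₁ * h₁) + a + r * (N₀ + p * (9 * s * (4 * (p * (4 * e) * k) * (4 * (p * (4 * e) * k)))))
            ≡⟨ cong₂ (λ y z → y + a + r * (N₀ + p * z)) (≡.sym (b-a s₀ (h₁ * h₁) a)) (step-a p (4 * e) k s₀ a) ⟩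
          b₀ * a + a + r * (ν * a + p * (l₀ * a))
            ≡⟨ i b₀ a r ν p l₀ ⟩
          (b₀ + 1 + r * (ν + p * l₀)) * a
            <⟨ *-monoˡ-< a (lemma-d₆ b₀ r e s₀ (4 * (p * (4 * e) * l₀)) (16 * e) (p * l₀) r>0) ⟩
          r * (g * τ) * a ∎
          where
          i : ∀ b a r v p l → b * a + a + r * (v * a + p * (l * a)) ≡ (b + 1 + r * (v + p * l)) * a
          i = solve-∀

  -- Size of the absorbing structure per vertex of X: a block of r vertices, and an absorber of r(r
  -- + 1) vertices for each of the 1 + 2r sets offered at that block.
  blowup : ℕ → ℕ
  blowup r = r + r * suc r * (1 + 2 * r)

  inverse-ε′ : (κ ℓ e : ℕ) → ℕ
  inverse-ε′ κ ℓ e = Constants.E κ e (2 + κ) (1 + κ + ℓ) (blowup (1 + κ + ℓ))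

  inverse-ε′>0 : ∀ κ ℓ {e} → 0 < e → 0 < inverse-ε′ κ ℓ e
  inverse-ε′>0 κ ℓ {e} e>0 = Constants.Bounds.E>0 κ e (2 + κ) (1 + κ + ℓ) (blowup (1 + κ + ℓ)) e>0 (s≤s z≤n) (s≤s z≤n)

  -- Cliques and neighbourhoods

  module Cliques {A : Set} (adj : A → A → Bool)
    (adj-sym : ∀ x y → adj x y ≡ adj y x) (adj-irrefl : ∀ x → adj x x ≡ false) where

    Adj : A → A → Set
    Adj x y = adj x y ≡ true

    Clique : ℕ → List A → Set
    Clique m xs = length xs ≡ m × AllPairs Adj xs

    N : A → List A → List A
    N v = filterᵇ (adj v)

    -- Density is expressed by bounds on non-neighbours because these pass to sublists. A vertex
    -- counts as its own non-neighbour.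
    deg nd : List A → A → ℕ
    deg P v = count (adj v) P
    nd  P v = count (not ∘ adj v) P

    N-Adj : ∀ v P {x} → x ∈ N v P → Adj v x
    N-Adj v P = All.lookup (filter-All (adj v) P)

    N-⊆ : ∀ v P → N v P ⊆ P
    N-⊆ v P = ⊑⇒∈ (filter-⊑ (adj v) P)

    deg+nd : ∀ P v → deg P v + nd P v ≡ length P
    deg+nd P v = count+count-not (adj v) P

    nd-⊑ : ∀ {P Q} → P ⊑ Q → ∀ v → nd P v ≤ nd Q v
    nd-⊑ s v = ∑-⊑ _ s

    extend : ∀ {m S v P} → Clique m S → S ⊆ N v P → Clique (suc m) (v ∷ S)
    extend {v = v} {P} (l , c) s = cong suc l , (All.tabulate (N-Adj v P ∘ s) ∷ c)

    -- Adjacency is irreflexive, so a clique has no repeated entry and membership alone yields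
    -- multiset inclusion.
    clique-⊑ : ∀ {S P} → AllPairs Adj S → S ⊆ P → S ⊑ P
    clique-⊑ {[]}    {P} []      s = sub refl
    clique-⊑ {x ∷ S} {P} (a ∷ c) s with ∈⇒↭ (s (here ≡.refl))
    ... | P′ , p with clique-⊑ {S} {P′} c s′
      where
      s′ : S ⊆ P′
      s′ m with ∈-resp-↭ p (s (there m))
      ... | there m′     = m′
      ... | here ≡.refl = contradiction (≡.trans (≡.sym (All.lookup a m)) (adj-irrefl x)) λ ()
    ... | sub q = sub (↭-trans p (prep x q))

    nonempty : ∀ k m {P : List A} → m < k * length P → ∃[ x ] x ∈ P
    nonempty k m {[]}    lt rewrite *-zeroʳ k = contradiction lt λ ()
    nonempty k m {x ∷ P} lt = x , here ≡.refl

  -- The potential of a partial tiling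

  module Potential {A : Set} (adj : A → A → Bool)
    (adj-sym : ∀ x y → adj x y ≡ adj y x) (adj-irrefl : ∀ x → adj x x ≡ false) (Q : List A) where

    open Cliques adj adj-sym adj-irrefl

    q M : ℕ
    q = length Q
    M = q * (q * q)

    deg≤ : ∀ P v → deg P v ≤ length P
    deg≤ P v = ≤-trans (m≤m+n (deg P v) (nd P v)) (≤-reflexive (deg+nd P v))

    -- vanishes if v has the same proportion of neighbours in W as in Q
    D : List A → A → ℤ
    D W v = + q ℤ.* + deg W v ℤ.- + length W ℤ.* + deg Q v

    Φ : List A → ℕ
    Φ W = ∑ Q (λ v → ∣ D W v ∣ * ∣ D W v ∣)

    -- The linear part of the change of `Φ` when x joins `W` is `2 * q` times this weight, minus a
    -- term that does not depend on x.
    wt : List A → A → ℤ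
    wt W x = ∑ᶻ Q (λ v → D W v ℤ.* + 𝟙 (adj v x))

    ∑-wt : ∀ W P → ∑ᶻ P (wt W) ≡ ∑ᶻ Q (λ v → D W v ℤ.* + deg P v)
    ∑-wt W P = ≡.trans (∑ᶻ-swap P Q _) (∑ᶻ-cong Q λ v →
      ≡.trans (∑ᶻ-* P (D W v) _) (cong (λ z → D W v ℤ.* z) (≡.sym (pos-∑ P (λ x → 𝟙 (adj v x))))))

    pos-Φ : ∀ W → + Φ W ≡ ∑ᶻ Q (λ v → D W v ℤ.* D W v)
    pos-Φ W = ≡.trans (pos-∑ Q _) (∑ᶻ-cong Q λ v → ∣i∣*∣i∣ (D W v))

    -- so the average of wt over W is at least its average over Q
    Φ-correlation : ∀ W → + q ℤ.* ∑ᶻ W (wt W) ≡ + Φ W ℤ.+ + length W ℤ.* ∑ᶻ Q (wt W)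
    Φ-correlation W = begin
      + q ℤ.* ∑ᶻ W (wt W)                                       ≡⟨ cong (λ z → + q ℤ.* z) (∑-wt W W) ⟩
      + q ℤ.* ∑ᶻ Q (λ v → D W v ℤ.* + deg W v)                  ≡⟨ ∑ᶻ-* Q (+ q) _ ⟨
      ∑ᶻ Q (λ v → + q ℤ.* (D W v ℤ.* + deg W v))                ≡⟨ ∑ᶻ-cong Q (λ v → e (+ q) (+ deg W v) (+ length W) (+ deg Q v)) ⟩
      ∑ᶻ Q (λ v → D W v ℤ.* D W v ℤ.+ + length W ℤ.* (D W v ℤ.* + deg Q v))
                                                                ≡⟨ ∑ᶻ-+ Q _ _ ⟩
      ∑ᶻ Q (λ v → D W v ℤ.* D W v) ℤ.+ ∑ᶻ Q (λ v → + length W ℤ.* (D W v ℤ.* + deg Q v))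
                                                                ≡⟨ cong₂ ℤ._+_ (≡.sym (pos-Φ W)) (≡.trans (∑ᶻ-* Q (+ length W) _) (cong (λ z → + length W ℤ.* z) (≡.sym (∑-wt W Q)))) ⟩
      + Φ W ℤ.+ + length W ℤ.* ∑ᶻ Q (wt W)                      ∎
      where
      open ≡.≡-Reasoning
      e : ∀ n x R y → n ℤ.* ((n ℤ.* x ℤ.- R ℤ.* y) ℤ.* x) ≡
        (n ℤ.* x ℤ.- R ℤ.* y) ℤ.* (n ℤ.* x ℤ.- R ℤ.* y) ℤ.+ R ℤ.* ((n ℤ.* x ℤ.- R ℤ.* y) ℤ.* y)
      e = ℤSolver.solve-∀

    gain : List A → List A → ℤ
    gain W K = + q ℤ.* ∑ᶻ K (wt W) ℤ.- + length K ℤ.* ∑ᶻ Q (wt W)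

    -- `D` is additive in the list, so expanding the square leaves twice the cross term, which is
    -- `gain`. It is negative when `K` is lighter on average than `Q`.
    Φ-step : ∀ W K → + Φ (K ++ W) ≡ + Φ W ℤ.+ (+ 2 ℤ.* gain W K ℤ.+ + Φ K)
    Φ-step W K = begin
      + Φ (K ++ W)                                ≡⟨ pos-Φ (K ++ W) ⟩
      ∑ᶻ Q (λ v → D (K ++ W) v ℤ.* D (K ++ W) v)  ≡⟨ ∑ᶻ-cong Q pointwise ⟩
      ∑ᶻ Q (λ v → f v ℤ.+ (+ 2 ℤ.* g v ℤ.+ h v))  ≡⟨ ∑ᶻ-+ Q f (λ v → + 2 ℤ.* g v ℤ.+ h v) ⟩
      ∑ᶻ Q f ℤ.+ ∑ᶻ Q (λ v → + 2 ℤ.* g v ℤ.+ h v) ≡⟨ cong₂ ℤ._+_ (≡.sym (pos-Φ W)) (∑ᶻ-+ Q (λ v → + 2 ℤ.* g v) h) ⟩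
      + Φ W ℤ.+ (∑ᶻ Q (λ v → + 2 ℤ.* g v) ℤ.+ ∑ᶻ Q h)
        ≡⟨ cong (λ z → + Φ W ℤ.+ z) (cong₂ ℤ._+_ (≡.trans (∑ᶻ-* Q (+ 2) g) (cong (λ z → + 2 ℤ.* z) linear)) (≡.sym (pos-Φ K))) ⟩
      + Φ W ℤ.+ (+ 2 ℤ.* gain W K ℤ.+ + Φ K)      ∎
      where
      open ≡.≡-Reasoning
      f g h : A → ℤ
      f v = D W v ℤ.* D W v
      g v = + q ℤ.* (D W v ℤ.* + deg K v) ℤ.+ (ℤ.- + length K) ℤ.* (D W v ℤ.* + deg Q v)
      h v = D K v ℤ.* D K v
      e : ∀ n x x′ R R′ y → (n ℤ.* (x′ ℤ.+ x) ℤ.- (R′ ℤ.+ R) ℤ.* y) ℤ.* (n ℤ.* (x′ ℤ.+ x) ℤ.- (R′ ℤ.+ R) ℤ.* y) ≡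
        (n ℤ.* x ℤ.- R ℤ.* y) ℤ.* (n ℤ.* x ℤ.- R ℤ.* y) ℤ.+
        (+ 2 ℤ.* (n ℤ.* ((n ℤ.* x ℤ.- R ℤ.* y) ℤ.* x′) ℤ.+ (ℤ.- R′) ℤ.* ((n ℤ.* x ℤ.- R ℤ.* y) ℤ.* y))
          ℤ.+ (n ℤ.* x′ ℤ.- R′ ℤ.* y) ℤ.* (n ℤ.* x′ ℤ.- R′ ℤ.* y))
      e = ℤSolver.solve-∀
      D-++ : ∀ v → D (K ++ W) v ≡ + q ℤ.* (+ deg K v ℤ.+ + deg W v) ℤ.- (+ length K ℤ.+ + length W) ℤ.* + deg Q v
      D-++ v = cong₂ (λ x y → + q ℤ.* x ℤ.- y ℤ.* + deg Q v)
        (≡.trans (cong +_ (∑-++ K W _)) (ℤP.pos-+ (deg K v) (deg W v)))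
        (≡.trans (cong +_ (length-++ K)) (ℤP.pos-+ (length K) (length W)))
      pointwise : ∀ v → D (K ++ W) v ℤ.* D (K ++ W) v ≡ f v ℤ.+ (+ 2 ℤ.* g v ℤ.+ h v)
      pointwise v = ≡.trans (cong₂ ℤ._*_ (D-++ v) (D-++ v)) (e (+ q) (+ deg W v) (+ deg K v) (+ length W) (+ length K) (+ deg Q v))
      linear : ∑ᶻ Q g ≡ gain W K
      linear = ≡.trans (∑ᶻ-+ Q (λ v → + q ℤ.* (D W v ℤ.* + deg K v)) (λ v → (ℤ.- + length K) ℤ.* (D W v ℤ.* + deg Q v))) (cong₂ ℤ._+_
        (≡.trans (∑ᶻ-* Q (+ q) (λ v → D W v ℤ.* + deg K v)) (cong (λ z → + q ℤ.* z) (≡.sym (∑-wt W K))))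
        (≡.trans (∑ᶻ-* Q (ℤ.- + length K) (λ v → D W v ℤ.* + deg Q v)) (≡.trans (cong (λ z → (ℤ.- + length K) ℤ.* z) (≡.sym (∑-wt W Q)))
          (≡.sym (ℤP.neg-distribˡ-* (+ length K) (∑ᶻ Q (wt W)))))))

    Φ-≤ : ∀ K → Φ K ≤ length K * length K * M
    Φ-≤ K = ≤-trans (∑-≤ (All.universal (λ v → *-mono-≤ (bound v) (bound v)) Q)) (≤-reflexive (e q (length K)))
      where
      e : ∀ q l → q * (q * l * (q * l)) ≡ l * l * (q * (q * q))
      e = solve-∀
      bound : ∀ v → ∣ D K v ∣ ≤ q * length K
      bound v = ≤-trans (≤-reflexive (cong ∣_∣ (cong₂ ℤ._-_ (≡.sym (ℤP.pos-* q (deg K v))) (≡.sym (ℤP.pos-* (length K) (deg Q v))))))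
        (∣-∣-≤ (*-monoʳ-≤ q (deg≤ K v)) (≤-trans (*-monoʳ-≤ (length K) (deg≤ Q v)) (≤-reflexive (*-comm (length K) q))))

    module _ (W : List A) (|W|≤q : length W ≤ q) where

      -- Light cliques are found for weights in ℕ. Adding `q * q` for every v in `Q`, adjacent or
      -- not, makes all terms nonnegative and raises the weight of each x by the same `M`, so
      -- comparisons of averages are unaffected.
      shifted : A → A → ℕ
      shifted x v = if adj v x then q * deg W v + (q * q ∸ length W * deg Q v) else q * q

      wt⁺ : A → ℕ
      wt⁺ x = ∑ Q (shifted x)

      private
        WQ≤ : ∀ v → length W * deg Q v ≤ q * q
        WQ≤ v = *-mono-≤ |W|≤q (deg≤ Q v)

      pos-shifted : ∀ x v → + shifted x v ≡ D W v ℤ.* + 𝟙 (adj v x) ℤ.+ + (q * q)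
      pos-shifted x v with adj v x
      ... | false = e (D W v) (+ (q * q))
        where
        e : ∀ d y → y ≡ d ℤ.* + 0 ℤ.+ y
        e = ℤSolver.solve-∀
      ... | true = begin
          + (q * deg W v + (q * q ∸ length W * deg Q v))
            ≡⟨ ℤP.pos-+ (q * deg W v) _ ⟩
          + (q * deg W v) ℤ.+ + (q * q ∸ length W * deg Q v)
            ≡⟨ cong₂ ℤ._+_ (ℤP.pos-* q (deg W v)) (≡.trans (≡.sym (ℤP.⊖-≥ (WQ≤ v))) (≡.sym (ℤP.m-n≡m⊖n (q * q) (length W * deg Q v)))) ⟩
          + q ℤ.* + deg W v ℤ.+ (+ (q * q) ℤ.- + (length W * deg Q v))
            ≡⟨ cong (λ z → + q ℤ.* + deg W v ℤ.+ (+ (q * q) ℤ.- z)) (ℤP.pos-* (length W) (deg Q v)) ⟩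
          + q ℤ.* + deg W v ℤ.+ (+ (q * q) ℤ.- + length W ℤ.* + deg Q v)
            ≡⟨ e (+ q ℤ.* + deg W v) (+ (q * q)) (+ length W ℤ.* + deg Q v) ⟩
          D W v ℤ.* + 1 ℤ.+ + (q * q) ∎
        where
        open ≡.≡-Reasoning
        e : ∀ x y z → x ℤ.+ (y ℤ.- z) ≡ (x ℤ.- z) ℤ.* + 1 ℤ.+ y
        e = ℤSolver.solve-∀

      pos-wt⁺ : ∀ x → + wt⁺ x ≡ wt W x ℤ.+ + M
      pos-wt⁺ x = ≡.trans (pos-∑ Q _) (≡.trans (∑ᶻ-cong Q (pos-shifted x)) (≡.trans (∑ᶻ-+ Q _ _)
        (cong (λ z → wt W x ℤ.+ z) (≡.trans (∑ᶻ-const Q (+ (q * q))) (≡.sym (ℤP.pos-* q (q * q)))))))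

      pos-∑wt⁺ : ∀ P → + ∑ P wt⁺ ≡ ∑ᶻ P (wt W) ℤ.+ + length P ℤ.* + M
      pos-∑wt⁺ P = ≡.trans (pos-∑ P _) (≡.trans (∑ᶻ-cong P pos-wt⁺) (≡.trans (∑ᶻ-+ P _ _) (cong (λ z → ∑ᶻ P (wt W) ℤ.+ z) (∑ᶻ-const P (+ M)))))

      wt⁺-≤ : ∀ x → wt⁺ x ≤ 2 * M
      wt⁺-≤ x = ≤-trans (∑-≤ {xs = Q} {c = 2 * (q * q)} (All.universal bound Q)) (≤-reflexive (e q))
        where
        e : ∀ q → q * (2 * (q * q)) ≡ 2 * (q * (q * q))
        e = solve-∀
        bound : ∀ v → shifted x v ≤ 2 * (q * q)
        bound v with adj v x
        ... | false = m≤m+n (q * q) _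
        ... | true  = +-mono-≤ (*-monoʳ-≤ q (≤-trans (deg≤ W v) |W|≤q)) (≤-trans (m∸n≤m (q * q) (length W * deg Q v)) (≤-reflexive (≡.sym (+-identityʳ (q * q)))))

      -- |U| gain + (q g + r Φ) = 2 s r M q, where g is the slack in `le′`.
      gain-≤ : ∀ {K U s y} → Q ↭ W ++ U → length U ≡ s + y → 0 < length U → q ≤ 2 * length U →
        y * ∑ K wt⁺ ≤ length K * ∑ U wt⁺ → gain W K ℤ.≤ + (4 * s * length K * M)
      gain-≤ {K} {U} {s} {y} Q↭ |U| U>0 q≤2U le = ℤP.*-cancelˡ-≤-pos _ _ (+ length U) {{ℤ.positive (ℤ.+<+ U>0)}} (begin
        + u ℤ.* gain W K                    ≤⟨ ≤-from-≡ {p = q * g + r * Φ W} main ⟩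
        + (2 * s * r * M * q)               ≤⟨ ℤ.+≤+ (*-monoʳ-≤ (2 * s * r * M) q≤2U) ⟩
        + (2 * s * r * M * (2 * u))         ≡⟨ cong +_ (e₅ s r M u) ⟩
        + (u * (4 * s * r * M))             ≡⟨ ℤP.pos-* u _ ⟩
        + u ℤ.* + (4 * s * r * M)           ∎)
        where
        open ℤP.≤-Reasoning
        u r : ℕ
        u = length U
        r = length K
        e₅ : ∀ s r M u → 2 * s * r * M * (2 * u) ≡ u * (4 * s * r * M)
        e₅ = solve-∀
        -- The light clique is compared with y = |U| - s only; the missing s copies of its weight
        -- are bounded crudely by `2 * M` per vertex. Moreover `W` is on average at least as heavy
        -- as `Q`, so `U` is at most as heavy: this is how `h₂` and `h₃` enter.
        le′ : u * ∑ K wt⁺ ≤ r * ∑ U wt⁺ + 2 * s * r * M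
        le′ = ≤-trans (≤-reflexive (≡.trans (cong (_* ∑ K wt⁺) |U|) (≡.trans (*-distribʳ-+ (∑ K wt⁺) s y) (+-comm (s * ∑ K wt⁺) _))))
          (+-mono-≤ le (≤-trans (*-monoʳ-≤ s (∑-≤ {xs = K} {c = 2 * M} (All.universal wt⁺-≤ K))) (≤-reflexive (e₆ s r M))))
          where
          e₆ : ∀ s r M → s * (r * (2 * M)) ≡ 2 * s * r * M
          e₆ = solve-∀
        g : ℕ
        g = r * ∑ U wt⁺ + 2 * s * r * M ∸ u * ∑ K wt⁺
        SK SU SW SQ Mᶻ uᶻ rᶻ gᶻ Φᶻ Wᶻ sᶻ : ℤ
        SK = ∑ᶻ K (wt W)
        SU = ∑ᶻ U (wt W)
        SW = ∑ᶻ W (wt W)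
        SQ = ∑ᶻ Q (wt W)
        Mᶻ = + M
        uᶻ = + u
        rᶻ = + r
        gᶻ = + g
        Φᶻ = + Φ W
        Wᶻ = + length W
        sᶻ = + s
        pos-2srM : + (2 * s * r * M) ≡ + 2 ℤ.* sᶻ ℤ.* rᶻ ℤ.* Mᶻ
        pos-2srM = ≡.trans (ℤP.pos-* (2 * s * r) M) (cong (ℤ._* Mᶻ) (≡.trans (ℤP.pos-* (2 * s) r) (cong (ℤ._* rᶻ) (ℤP.pos-* 2 s))))
        h₁ : uᶻ ℤ.* (SK ℤ.+ rᶻ ℤ.* Mᶻ) ℤ.+ gᶻ ≡ rᶻ ℤ.* (SU ℤ.+ uᶻ ℤ.* Mᶻ) ℤ.+ + 2 ℤ.* sᶻ ℤ.* rᶻ ℤ.* Mᶻ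
        h₁ = ≡.trans (cong (ℤ._+ gᶻ) (≡.trans (cong (λ z → uᶻ ℤ.* z) (≡.sym (pos-∑wt⁺ K))) (≡.sym (ℤP.pos-* u _))))
          (≡.trans (≡.sym (ℤP.pos-+ (u * ∑ K wt⁺) g)) (≡.trans (cong +_ (m+[n∸m]≡n le′)) (≡.trans (ℤP.pos-+ (r * ∑ U wt⁺) _)
            (cong₂ ℤ._+_ (≡.trans (ℤP.pos-* r _) (cong (λ z → rᶻ ℤ.* z) (pos-∑wt⁺ U))) pos-2srM))))
        qᶻ : + q ≡ Wᶻ ℤ.+ uᶻ
        qᶻ = ≡.trans (cong +_ (≡.trans (↭-length Q↭) (length-++ W))) (ℤP.pos-+ (length W) u)
        h₂ : (Wᶻ ℤ.+ uᶻ) ℤ.* SW ≡ Φᶻ ℤ.+ Wᶻ ℤ.* SQ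
        h₂ = ≡.trans (cong (ℤ._* SW) (≡.sym qᶻ)) (Φ-correlation W)
        h₃ : SQ ≡ SW ℤ.+ SU
        h₃ = ≡.trans (∑ᶻ-↭ (wt W) Q↭) (∑ᶻ-++ W U (wt W))
        combine : ∀ SK SU SW SQ Mᶻ u r g Φ W s →
          u ℤ.* (SK ℤ.+ r ℤ.* Mᶻ) ℤ.+ g ≡ r ℤ.* (SU ℤ.+ u ℤ.* Mᶻ) ℤ.+ + 2 ℤ.* s ℤ.* r ℤ.* Mᶻ →
          (W ℤ.+ u) ℤ.* SW ≡ Φ ℤ.+ W ℤ.* SQ → SQ ≡ SW ℤ.+ SU →
          u ℤ.* ((W ℤ.+ u) ℤ.* SK ℤ.- r ℤ.* SQ) ℤ.+ ((W ℤ.+ u) ℤ.* g ℤ.+ r ℤ.* Φ) ≡ + 2 ℤ.* s ℤ.* r ℤ.* Mᶻ ℤ.* (W ℤ.+ u)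
        combine SK SU SW .(SW ℤ.+ SU) Mᶻ u r g Φ W s h₁ h₂ ≡.refl =
          ≡.trans (c₁ SK SU SW Mᶻ u r g Φ W s)
            (≡.trans (cong₂ (λ y z → (W ℤ.+ u) ℤ.* y ℤ.+ r ℤ.* (Φ ℤ.+ W ℤ.* (SW ℤ.+ SU) ℤ.- z) ℤ.- (W ℤ.+ u) ℤ.* (r ℤ.* (SU ℤ.+ u ℤ.* Mᶻ)))
              h₁ h₂) (c₂ SU SW Mᶻ u r Φ W s))
          where
          c₁ : ∀ SK SU SW Mᶻ u r g Φ W s → u ℤ.* ((W ℤ.+ u) ℤ.* SK ℤ.- r ℤ.* (SW ℤ.+ SU)) ℤ.+ ((W ℤ.+ u) ℤ.* g ℤ.+ r ℤ.* Φ) ≡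
            (W ℤ.+ u) ℤ.* (u ℤ.* (SK ℤ.+ r ℤ.* Mᶻ) ℤ.+ g) ℤ.+ r ℤ.* (Φ ℤ.+ W ℤ.* (SW ℤ.+ SU) ℤ.- (W ℤ.+ u) ℤ.* SW) ℤ.- (W ℤ.+ u) ℤ.* (r ℤ.* (SU ℤ.+ u ℤ.* Mᶻ))
          c₁ = ℤSolver.solve-∀
          c₂ : ∀ SU SW Mᶻ u r Φ W s →
            (W ℤ.+ u) ℤ.* (r ℤ.* (SU ℤ.+ u ℤ.* Mᶻ) ℤ.+ + 2 ℤ.* s ℤ.* r ℤ.* Mᶻ) ℤ.+ r ℤ.* (Φ ℤ.+ W ℤ.* (SW ℤ.+ SU) ℤ.- (Φ ℤ.+ W ℤ.* (SW ℤ.+ SU))) ℤ.- (W ℤ.+ u) ℤ.* (r ℤ.* (SU ℤ.+ u ℤ.* Mᶻ))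
            ≡ + 2 ℤ.* s ℤ.* r ℤ.* Mᶻ ℤ.* (W ℤ.+ u)
          c₂ = ℤSolver.solve-∀
        main : + u ℤ.* gain W K ℤ.+ + (q * g + r * Φ W) ≡ + (2 * s * r * M * q)
        main = ≡.trans (cong₂ (λ x y → + u ℤ.* (x ℤ.* SK ℤ.- rᶻ ℤ.* SQ) ℤ.+ y) qᶻ
                 (≡.trans (ℤP.pos-+ (q * g) _) (cong₂ ℤ._+_ (≡.trans (ℤP.pos-* q g) (cong (ℤ._* gᶻ) qᶻ)) (ℤP.pos-* r _))))
          (≡.trans (combine SK SU SW SQ Mᶻ uᶻ rᶻ gᶻ Φᶻ Wᶻ sᶻ h₁ h₂ h₃)
            (≡.trans (cong₂ ℤ._*_ (≡.sym pos-2srM) (≡.sym qᶻ)) (≡.sym (ℤP.pos-* (2 * s * r * M) q))))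

    Φ-grow : ∀ {W K x} → gain W K ℤ.≤ + x → Φ (K ++ W) ≤ Φ W + (2 * x + length K * length K * M)
    Φ-grow {W} {K} {x} le = ℤP.drop‿+≤+ (begin
      + Φ (K ++ W)                                        ≡⟨ Φ-step W K ⟩
      + Φ W ℤ.+ (+ 2 ℤ.* gain W K ℤ.+ + Φ K)              ≤⟨ ℤP.+-monoʳ-≤ (+ Φ W) (ℤP.+-mono-≤ (ℤP.*-monoˡ-≤-nonNeg (+ 2) le) (ℤ.+≤+ (Φ-≤ K))) ⟩
      + Φ W ℤ.+ (+ 2 ℤ.* + x ℤ.+ + (length K * length K * M))
        ≡⟨ cong (λ z → + Φ W ℤ.+ (z ℤ.+ + (length K * length K * M))) (ℤP.pos-* 2 x) ⟨
      + (Φ W + (2 * x + length K * length K * M))         ∎)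
      where open ℤP.≤-Reasoning

  -- Greedy cliques in dense lists

  module Tiling {A : Set} (adj : A → A → Bool)
    (adj-sym : ∀ x y → adj x y ≡ adj y x) (adj-irrefl : ∀ x → adj x x ≡ false)
    (V : List A) (κ ℓ a : ℕ) (ℓ>0 : 0 < ℓ) (a>0 : 0 < a)
    (alpha : ∀ {P} → P ⊑ V → a < length P → ∃[ S ] Cliques.Clique adj adj-sym adj-irrefl ℓ S × (∀ {x} → x ∈ S → x ∈ P))
    where

    open Cliques adj adj-sym adj-irrefl

    opaque
      k r : ℕ
      k = 2 + κ
      r = 1 + κ + ℓ

    -- Restricting `P` to one neighbourhood lowers `k * length P` by at most `B`. As long as `B` is
    -- below the length of `U`, k - 1 restrictions leave a positive part of `U`.
    Dense : ℕ → List A → List A → Set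
    Dense B U vs = All (λ v → k * nd U v ≤ B) vs

    N-size : ∀ {U B P v} → P ⊑ U → k * nd U v ≤ B → k * length P ≤ k * length (N v P) + B
    N-size {U} {B} {P} {v} s d = begin
      k * length P                        ≡⟨ cong (k *_) (≡.sym (deg+nd P v)) ⟩
      k * (deg P v + nd P v)              ≡⟨ *-distribˡ-+ k (deg P v) (nd P v) ⟩
      k * deg P v + k * nd P v            ≤⟨ +-mono-≤ (≤-reflexive (cong (k *_) (≡.sym (length-filterᵇ (adj v) P))))
                                              (≤-trans (*-monoʳ-≤ k (nd-⊑ s v)) d) ⟩
      k * length (N v P) + B              ∎
      where open ≤-Reasoning

    opaque
      unfolding k r

      -- Each of the `i` greedy vertices costs at most `B`; the more than `a` vertices that remain
      -- contain the K_ℓ.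
      clique-in : ∀ {U B} → U ⊑ V → Dense B U U → ∀ i {P} → P ⊑ U →
        i * B + k * a < k * length P → ∃[ S ] Clique (i + ℓ) S × S ⊆ P
      clique-in UV dense zero {P} PU lt = alpha (⊑-trans PU UV) (*-cancelˡ-< k a (length P) lt)
      clique-in {U} {B} UV dense (suc i) {P} PU lt with nonempty k (suc i * B + k * a) {P} lt
      ... | v , v∈P with clique-in UV dense i {N v P} (⊑-trans (filter-⊑ (adj v) P) PU)
                        (+-cancelʳ-< B (i * B + k * a) (k * length (N v P)) (begin-strict
                          i * B + k * a + B           ≡⟨ arith B (i * B) (k * a) ⟩
                          suc i * B + k * a           <⟨ lt ⟩
                          k * length P                ≤⟨ N-size {U} {B} {P} {v} PU (All.lookup dense (⊑⇒∈ PU v∈P)) ⟩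
                          k * length (N v P) + B      ∎))
        where
        open ≤-Reasoning
        arith : ∀ B x y → x + y + B ≡ B + x + y
        arith = solve-∀
      ... | S , c , s = v ∷ S , extend {v = v} {P} c s , sub′
        where
        sub′ : v ∷ S ⊆ P
        sub′ (here ≡.refl) = v∈P
        sub′ (there m) = N-⊆ v P (s m)

      r-clique-in : ∀ {U B} → U ⊑ V → Dense B U U → ∀ {P} → P ⊑ U →
        B + a < length P → ∃[ S ] Clique r S × S ⊆ P
      r-clique-in {U} {B} UV dense {P} PU lt = clique-in UV dense (suc κ) PU (begin-strict
        suc κ * B + k * a   ≤⟨ +-monoˡ-≤ (k * a) (m≤n+m (suc κ * B) B) ⟩
        k * B + k * a       ≡⟨ ≡.sym (*-distribˡ-+ k B a) ⟩
        k * (B + a)         <⟨ *-monoʳ-< k lt ⟩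
        k * length P        ∎)
        where open ≤-Reasoning

      -- The two neighbourhoods cost `B + B` and the `κ` greedy vertices `κ * B`, together `k * B`.
      -- The case u = v is allowed and merely completes one vertex to a K_r.
      swap-in : ∀ {U B} → U ⊑ V → Dense B U U → ∀ {u v} → k * nd U u ≤ B → k * nd U v ≤ B → ∀ {P} → P ⊑ U →
        B + a < length P → ∃[ S ] (S ⊑ P) × Clique r (u ∷ S) × Clique r (v ∷ S)
      swap-in {U} {B} UV dense {u} {v} du dv {P} PU lt
        with clique-in UV dense κ {N u (N v P)} (⊑-trans (filter-⊑ (adj u) (N v P)) (⊑-trans (filter-⊑ (adj v) P) PU))
               (+-cancelʳ-< (B + B) (κ * B + k * a) (k * length (N u (N v P))) (begin-strict
                 κ * B + k * a + (B + B)                 ≡⟨ rearrange B κ a ⟩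
                 k * (B + a)                             <⟨ *-monoʳ-< k lt ⟩
                 k * length P                            ≤⟨ N-size {U} {B} {P} {v} PU dv ⟩
                 k * length (N v P) + B                  ≤⟨ +-monoˡ-≤ B (N-size {U} {B} {N v P} {u} (⊑-trans (filter-⊑ (adj v) P) PU) du) ⟩
                 k * length (N u (N v P)) + B + B        ≡⟨ +-assoc (k * length (N u (N v P))) B B ⟩
                 k * length (N u (N v P)) + (B + B)      ∎))
        where
        open ≤-Reasoning
        rearrange : ∀ B κ a → κ * B + (2 + κ) * a + (B + B) ≡ (2 + κ) * (B + a)
        rearrange = solve-∀
      ... | S , c , s = S , clique-⊑ (proj₂ c) (N-⊆ v P ∘ N-⊆ u (N v P) ∘ s)
                      , extend {v = u} {N v P} c s , extend {v = v} {P} c (N-⊆ u (N v P) ∘ s)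

      k≡ : k ≡ 2 + κ
      k≡ = ≡.refl

      r≡ : r ≡ 1 + κ + ℓ
      r≡ = ≡.refl

    -- Tilings and absorption

    -- Repeated vertices are tolerated here; the cliques become disjoint only when `xs` is the
    -- vertex list without repetitions.
    Tile : List A → Set
    Tile xs = ∃[ Ks ] All (Clique r) Ks × concat Ks ↭ xs

    tile-[] : Tile []
    tile-[] = [] , [] , refl

    tile-clique : ∀ {K} → Clique r K → Tile K
    tile-clique {K} c = K ∷ [] , c ∷ [] , ↭-reflexive (++-identityʳ K)

    tile-↭ : ∀ {xs ys} → xs ↭ ys → Tile xs → Tile ys
    tile-↭ p (Ks , c , q) = Ks , c , ↭-trans q p

    tile-++ : ∀ {xs ys} → Tile xs → Tile ys → Tile (xs ++ ys)
    tile-++ (Ks , c , p) (Ls , d , q) = Ks ++ Ls , AllP.++⁺ c d , ↭-trans (↭-reflexive (≡.sym (concat-++ Ks Ls))) (++⁺ p q)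

    tile-∣ : ∀ {xs} → Tile xs → r ∣ length xs
    tile-∣ {xs} (Ks , c , p) = subst (r ∣_) (↭-length p) (go Ks c)
      where
      go : ∀ Ks → All (Clique r) Ks → r ∣ length (concat Ks)
      go [] [] = divides 0 ≡.refl
      go (K ∷ Ks) ((l , _) ∷ c) with go Ks c
      ... | divides q eq = divides (suc q) (≡.trans (length-++ K) (cong₂ _+_ l eq))

    module _ {U : List A} {B : ℕ} (UV : U ⊑ V) (dense : Dense B U U) where

      -- The common part `S` makes `Rs` and `Ys` interchangeable. With `Rs` equal to `Ys` it serves
      -- to cover prescribed vertices by cliques whose other vertices lie in `P`.
      swaps-in : ∀ Rs Ys → length Rs ≡ length Ys → Dense B U Rs → Dense B U Ys → ∀ {P} → P ⊑ U →
        B + a + r * length Rs < length P →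
        ∃[ S ] ∃[ P′ ] P ↭ S ++ P′ × length S ≤ r * length Rs × Tile (Rs ++ S) × Tile (Ys ++ S)
      swaps-in [] [] _ _ _ {P} PU lt = [] , P , refl , z≤n , tile-[] , tile-[]
      swaps-in (p ∷ Rs) (y ∷ Ys) eq (dp ∷ dRs) (dy ∷ dYs) {P} PU lt =
        let m = length Rs
            S , sub {P₁} e₁ , cp , cy = swap-in UV dense dp dy PU (≤-trans (s≤s (m≤m+n (B + a) r)) (room-one (B + a) r m lt))
            |S|≤r = ≤-trans (n≤1+n (length S)) (≤-reflexive (proj₁ cp))
            S₁ , P₂ , e₂ , l , tR , tY = swaps-in Rs Ys (suc-injective eq) dRs dYs (rest-⊑ S e₁ PU)
                                           (room-rest (B + a) r m (length S) lt (length-↭-++ S e₁) |S|≤r)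
        in S ++ S₁ , P₂ , ↭-++-assoc S S₁ P₂ e₁ e₂ , length-++-≤ S r m |S|≤r l
         , join S S₁ p Rs cp tR , join S S₁ y Ys cy tY
        where
        join : ∀ S S₁ p Rs → Clique r (p ∷ S) → Tile (Rs ++ S₁) → Tile (p ∷ Rs ++ S ++ S₁)
        join S S₁ p Rs c t = tile-↭ (prep p (shifts S Rs)) (tile-++ (tile-clique c) t)

      -- Γ = Y ++ S with S a list of (r-1)-cliques, each completed either by a vertex of Y or by one of R
      absorber : ∀ R → length R ≡ r → Dense B U R → ∀ {P} → P ⊑ U → B + a + r * suc r < length P →
        ∃[ Γ ] ∃[ P′ ] P ↭ Γ ++ P′ × length Γ ≤ r * suc r × Tile Γ × Tile (R ++ Γ)
      absorber R |R| dR {P} PU lt =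
        let Y , cY , Y⊆P = r-clique-in UV dense PU (≤-trans (s≤s (m≤m+n (B + a) r)) (room-one (B + a) r r lt))
            sub {P₁} e₁ = clique-⊑ (proj₂ cY) Y⊆P
            |Y|≤r = ≤-reflexive (proj₁ cY)
            S , P₂ , e₂ , l , tR , tY = swaps-in R Y (≡.trans |R| (≡.sym (proj₁ cY))) dR
              (All-⊑ (⊑-trans (sub e₁) PU) dense) (rest-⊑ Y e₁ PU)
              (subst (λ m → B + a + r * m < length P₁) (≡.sym |R|) (room-rest (B + a) r r (length Y) lt (length-↭-++ Y e₁) |Y|≤r))
        in Y ++ S , P₂ , ↭-++-assoc Y S P₂ e₁ e₂ , length-++-≤ Y r r |Y|≤r (subst (λ m → length S ≤ r * m) |R| l)
         , tY , tile-↭ (shifts Y R) (tile-++ (tile-clique cY) tR)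

      -- The sets in `Rs` may overlap, only their absorbers are taken disjointly. Chosen sets are
      -- tiled together with their absorbers, the other absorbers on their own.
      absorbers : ∀ Rs → All (λ R → length R ≡ r × Dense B U R) Rs → ∀ {P} → P ⊑ U →
        B + a + r * suc r * length Rs < length P →
        ∃[ Γ ] ∃[ P′ ] P ↭ Γ ++ P′ × length Γ ≤ r * suc r * length Rs ×
          (∀ {Rs′} → Rs′ Sub.⊆ Rs → Tile (concat Rs′ ++ Γ))
      absorbers [] [] {P} PU lt = [] , P , refl , z≤n , λ { [] → tile-[] }
      absorbers (R ∷ Rs) ((|R| , dR) ∷ ds) {P} PU lt =
        let c = r * suc r
            m = length Rs
            γ , P₁ , e₁ , l₁ , t₀ , t₁ = absorber R |R| dR PU (room-one (B + a) c m lt)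
            Γ , P₂ , e₂ , l₂ , t = absorbers Rs ds (rest-⊑ γ e₁ PU) (room-rest (B + a) c m (length γ) lt (length-↭-++ γ e₁) l₁)
        in γ ++ Γ , P₂ , ↭-++-assoc γ Γ P₂ e₁ e₂ , length-++-≤ γ c m l₁ l₂ , select γ Γ t₀ t₁ t
        where
        select : ∀ γ Γ → Tile γ → Tile (R ++ γ) → (∀ {Rs′} → Rs′ Sub.⊆ Rs → Tile (concat Rs′ ++ Γ)) →
          ∀ {Rs′} → Rs′ Sub.⊆ R ∷ Rs → Tile (concat Rs′ ++ γ ++ Γ)
        select γ Γ t₀ t₁ t {Rs′} (.R ∷ʳ s) = tile-↭ (shifts γ (concat Rs′)) (tile-++ t₀ (t s))
        select γ Γ t₀ t₁ t {_ ∷ Rs′} (≡.refl ∷ s) = tile-↭ (++-interchange R γ (concat Rs′) Γ) (tile-++ t₁ (t s))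

    -- In state i the last r - 1 - i vertices of `I` are unmatched. If x is present, they are
    -- matched with x and i vertices of `J`, which leaves `J` in state i - 1. If x is absent,
    -- `pass-block` takes i + 1 vertices of `J` and the state stays i. So the number carried counts
    -- the vertices present so far modulo r.
    open-block : List A → A → List A → ℕ → List A
    open-block I x J i = drop (suc i) I ++ x ∷ take i J

    pass-block : List A → List A → ℕ → List A
    pass-block I J i = drop (suc i) I ++ take (suc i) J

    -- All sets that any subset of X can call for at this block: two for each state, and `J` itself
    -- for the return from state 0. Their number does not depend on the length of the chain.
    options : List A → A → List A → List (List A)
    options I x J = map (open-block I x J) (upTo r) ++ map (pass-block I J) (upTo r) ++ [ J ]

    chain : List A → List (A × List A) → List (List A)
    chain I []             = []
    chain I ((x , J) ∷ xs) = options I x J ++ chain J xs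

    blocks : List (A × List A) → List A
    blocks = concat ∘ map proj₂

    open∈ : ∀ I x J i {Rs Rs′} → i < r → Rs′ Sub.⊆ Rs → open-block I x J i ∷ Rs′ Sub.⊆ options I x J ++ Rs
    open∈ I x J i i<r s = SubP.++⁺ (SubP.++⁺ʳ _ (from∈ (∈-map⁺ (open-block I x J) (∈-upTo⁺ i<r)))) s

    pass∈ : ∀ I x J i {Rs Rs′} → i < r → Rs′ Sub.⊆ Rs → pass-block I J i ∷ Rs′ Sub.⊆ options I x J ++ Rs
    pass∈ I x J i i<r s = SubP.++⁺
      (SubP.++⁺ˡ (map (open-block I x J) (upTo r)) (SubP.++⁺ʳ _ (from∈ (∈-map⁺ (pass-block I J) (∈-upTo⁺ i<r))))) s

    open-close∈ : ∀ I x J i {Rs Rs′} → i < r → Rs′ Sub.⊆ Rs → open-block I x J i ∷ J ∷ Rs′ Sub.⊆ options I x J ++ Rs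
    open-close∈ I x J i i<r s = SubP.++⁺ (SubP.++⁺ (from∈ (∈-map⁺ (open-block I x J) (∈-upTo⁺ i<r)))
      (SubP.++⁺ˡ (map (pass-block I J) (upTo r)) Sub.⊆-refl)) s

    -- The vertices not yet matched are carried from each block to the next as a suffix of the block;
    -- c is what remains at the end.
    chain-partition : ∀ I xs → length I ≡ r → All (λ xJ → length (proj₂ xJ) ≡ r) xs → ∀ i → i < r →
      ∀ {ys} → ys Sub.⊆ map proj₁ xs →
      ∃[ Rs ] ∃[ c ] (Rs Sub.⊆ chain I xs) × length c < r × concat Rs ++ c ↭ drop (suc i) I ++ ys ++ blocks xs
    chain-partition I [] |I| [] i i<r [] = [] , drop (suc i) I , [] ,
      ≤-trans (s≤s (≤-reflexive (length-drop (suc i) I))) (≤-trans (∸-monoʳ-< (s≤s z≤n) (≤-trans i<r (≤-reflexive (≡.sym |I|)))) (≤-reflexive |I|)) ,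
      ↭-reflexive (≡.sym (++-identityʳ _))
    chain-partition I ((x , J) ∷ xs) |I| (|J| ∷ l) i i<r {ys} (.x ∷ʳ s) =
      let Rs , c , s′ , c<r , e = chain-partition J xs |J| l i i<r s
          D = drop (suc i) I ; T = take (suc i) J ; D′ = drop (suc i) J
      in pass-block I J i ∷ Rs , c , pass∈ I x J i i<r s′ , c<r , (begin
        ((D ++ T) ++ concat Rs) ++ c         ↭⟨ ++-assoc (D ++ T) (concat Rs) c ⟩
        (D ++ T) ++ concat Rs ++ c           ↭⟨ ++⁺ˡ (D ++ T) e ⟩
        (D ++ T) ++ D′ ++ ys ++ blocks xs    ↭⟨ regroup D T D′ ys (blocks xs) ⟩
        D ++ ys ++ (T ++ D′) ++ blocks xs    ≡⟨ cong (λ z → D ++ ys ++ z ++ blocks xs) (take++drop≡id (suc i) J) ⟩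
        D ++ ys ++ J ++ blocks xs            ∎)
      where
      open PermutationReasoning
      regroup : ∀ (D T D′ ys bs : List A) → (D ++ T) ++ D′ ++ ys ++ bs ↭ D ++ ys ++ (T ++ D′) ++ bs
      regroup D T D′ ys bs = begin
        (D ++ T) ++ D′ ++ ys ++ bs     ↭⟨ ++-assoc D T _ ⟩
        D ++ T ++ D′ ++ ys ++ bs       ↭⟨ ++⁺ˡ D (↭-sym (++-assoc T D′ _)) ⟩
        D ++ (T ++ D′) ++ ys ++ bs     ↭⟨ ++⁺ˡ D (shifts (T ++ D′) ys) ⟩
        D ++ ys ++ (T ++ D′) ++ bs     ∎
    -- The r - 1 carried vertices and x already form a set, so `J` is matched on its own and nothing
    -- is carried: the state becomes r - 1 = κ + ℓ.
    chain-partition I ((x , J) ∷ xs) |I| (|J| ∷ l) zero i<r {.x ∷ ys} (≡.refl ∷ s) =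
      let Rs , c , s′ , c<r , e = chain-partition J xs |J| l (κ + ℓ) (≤-reflexive (≡.sym r≡)) s
          D = drop 1 I
      in open-block I x J 0 ∷ J ∷ Rs , c , open-close∈ I x J 0 i<r s′ , c<r , (begin
        ((D ++ [ x ]) ++ J ++ concat Rs) ++ c                       ↭⟨ ++-assoc (D ++ [ x ]) _ c ⟩
        (D ++ [ x ]) ++ (J ++ concat Rs) ++ c                       ↭⟨ ++⁺ˡ (D ++ [ x ]) (++-assoc J (concat Rs) c) ⟩
        (D ++ [ x ]) ++ J ++ concat Rs ++ c                         ↭⟨ ++⁺ˡ (D ++ [ x ]) (++⁺ˡ J e) ⟩
        (D ++ [ x ]) ++ J ++ drop (suc (κ + ℓ)) J ++ ys ++ blocks xs
          ≡⟨ cong (λ z → (D ++ [ x ]) ++ J ++ z ++ ys ++ blocks xs) (drop-all (suc (κ + ℓ)) J (≤-reflexive (≡.trans |J| r≡))) ⟩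
        (D ++ [ x ]) ++ J ++ ys ++ blocks xs                        ↭⟨ ++⁺ˡ (D ++ [ x ]) (shifts J ys) ⟩
        (D ++ [ x ]) ++ ys ++ J ++ blocks xs                        ↭⟨ ++-assoc D [ x ] _ ⟩
        D ++ x ∷ ys ++ J ++ blocks xs                               ∎)
      where open PermutationReasoning
    chain-partition I ((x , J) ∷ xs) |I| (|J| ∷ l) (suc i) i<r {.x ∷ ys} (≡.refl ∷ s) =
      let Rs , c , s′ , c<r , e = chain-partition J xs |J| l i (<-trans (n<1+n i) i<r) s
          D = drop (2 + i) I ; T = take (suc i) J ; D′ = drop (suc i) J
      in open-block I x J (suc i) ∷ Rs , c , open∈ I x J (suc i) i<r s′ , c<r , (begin
        ((D ++ x ∷ T) ++ concat Rs) ++ c          ↭⟨ ++-assoc (D ++ x ∷ T) (concat Rs) c ⟩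
        (D ++ x ∷ T) ++ concat Rs ++ c            ↭⟨ ++⁺ˡ (D ++ x ∷ T) e ⟩
        (D ++ x ∷ T) ++ D′ ++ ys ++ blocks xs     ↭⟨ ++-assoc D (x ∷ T) _ ⟩
        D ++ x ∷ T ++ D′ ++ ys ++ blocks xs       ↭⟨ ++⁺ˡ D (prep x (↭-sym (++-assoc T D′ _))) ⟩
        D ++ x ∷ (T ++ D′) ++ ys ++ blocks xs     ↭⟨ ++⁺ˡ D (prep x (shifts (T ++ D′) ys)) ⟩
        D ++ x ∷ ys ++ (T ++ D′) ++ blocks xs     ≡⟨ cong (λ z → D ++ x ∷ ys ++ z ++ blocks xs) (take++drop≡id (suc i) J) ⟩
        D ++ x ∷ ys ++ J ++ blocks xs             ∎)
      where open PermutationReasoning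

    length-options : ∀ I x J → length (options I x J) ≡ 1 + 2 * r
    length-options I x J = begin
      length (options I x J)
        ≡⟨ length-++ (map (open-block I x J) (upTo r)) ⟩
      length (map (open-block I x J) (upTo r)) + length (map (pass-block I J) (upTo r) ++ [ J ])
        ≡⟨ cong₂ _+_ (len (open-block I x J)) (≡.trans (length-++ (map (pass-block I J) (upTo r))) (cong (_+ 1) (len (pass-block I J)))) ⟩
      r + (r + 1)
        ≡⟨ arith r ⟩
      1 + 2 * r ∎
      where
      open ≡.≡-Reasoning
      len : ∀ (f : ℕ → List A) → length (map f (upTo r)) ≡ r
      len f = ≡.trans (length-map f (upTo r)) (length-upTo r)
      arith : ∀ r → r + (r + 1) ≡ 1 + 2 * r
      arith = solve-∀

    length-chain : ∀ I xs → length (chain I xs) ≡ (1 + 2 * r) * length xs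
    length-chain I []             = ≡.sym (*-zeroʳ (1 + 2 * r))
    length-chain I ((x , J) ∷ xs) = ≡.trans (length-++ (options I x J))
      (≡.trans (cong₂ _+_ (length-options I x J) (length-chain J xs)) (≡.sym (*-suc (1 + 2 * r) (length xs))))

    chain-All : ∀ {p} {Q : A → Set p} I xs → length I ≡ r → All (λ xJ → length (proj₂ xJ) ≡ r) xs →
      All Q I → All Q (map proj₁ xs) → All Q (blocks xs) → All (λ R → length R ≡ r × All Q R) (chain I xs)
    chain-All I [] |I| [] qI qx qb = []
    chain-All {Q = Q} I ((x , J) ∷ xs) |I| (|J| ∷ l) qI (qx ∷ qxs) qb =
      AllP.++⁺ (AllP.++⁺ (AllP.map⁺ (AllP.applyUpTo⁺₁ id r opn)) (AllP.++⁺ (AllP.map⁺ (AllP.applyUpTo⁺₁ id r pass)) ((|J| , qJ) ∷ [])))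
               (chain-All J xs |J| l qJ qxs (AllP.++⁻ʳ J qb))
      where
      qJ = AllP.++⁻ˡ J qb
      opn : ∀ {i} → i < r → length (open-block I x J i) ≡ r × All Q (open-block I x J i)
      opn {i} i<r = (begin
        length (open-block I x J i)              ≡⟨ length-++ (drop (suc i) I) ⟩
        length (drop (suc i) I) + suc (length (take i J))
          ≡⟨ cong₂ (λ y z → y + suc z) (length-drop (suc i) I) (length-take i J) ⟩
        length I ∸ suc i + suc (i ⊓ length J)
          ≡⟨ cong₂ (λ y z → y ∸ suc i + suc (i ⊓ z)) |I| |J| ⟩
        r ∸ suc i + suc (i ⊓ r)       ≡⟨ cong (λ z → r ∸ suc i + suc z) (m≤n⇒m⊓n≡m (<⇒≤ i<r)) ⟩
        r ∸ suc i + suc i                        ≡⟨ m∸n+n≡m i<r ⟩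
        r                                        ∎)
        , AllP.++⁺ (AllP.drop⁺ (suc i) qI) (qx ∷ AllP.take⁺ i qJ)
        where open ≡.≡-Reasoning
      pass : ∀ {i} → i < r → length (pass-block I J i) ≡ r × All Q (pass-block I J i)
      pass {i} i<r = (begin
        length (pass-block I J i)                ≡⟨ length-++ (drop (suc i) I) ⟩
        length (drop (suc i) I) + length (take (suc i) J)
          ≡⟨ cong₂ _+_ (length-drop (suc i) I) (length-take (suc i) J) ⟩
        length I ∸ suc i + (suc i ⊓ length J)
          ≡⟨ cong₂ (λ y z → y ∸ suc i + (suc i ⊓ z)) |I| |J| ⟩
        r ∸ suc i + (suc i ⊓ r)     ≡⟨ cong (λ z → r ∸ suc i + z) (m≤n⇒m⊓n≡m i<r) ⟩
        r ∸ suc i + suc i                        ≡⟨ m∸n+n≡m i<r ⟩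
        r                                        ∎)
        , AllP.++⁺ (AllP.drop⁺ (suc i) qI) (AllP.take⁺ (suc i) qJ)
        where open ≡.≡-Reasoning

    attach-blocks : ∀ X {P : List A} → r * length X ≤ length P →
      ∃[ xs ] ∃[ P′ ] map proj₁ xs ≡ X × All (λ xJ → length (proj₂ xJ) ≡ r) xs × P ↭ blocks xs ++ P′
    attach-blocks []      {P} le = [] , P , ≡.refl , [] , refl
    attach-blocks (x ∷ X) {P} le =
      let le′ = ≤-trans (≤-reflexive (≡.sym (*-suc r (length X)))) le
          J = take r P
          xs , P′ , eq , l , e = attach-blocks X {drop r P} (≤-trans (m+n≤o⇒m≤o∸n (r * length X) (≤-trans (≤-reflexive (+-comm (r * length X) r)) le′))
                   (≤-reflexive (≡.sym (length-drop r P))))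
      in (x , J) ∷ xs , P′ , cong (x ∷_) eq , ≡.trans (length-take r P) (m≤n⇒m⊓n≡m (≤-trans (m≤m+n r _) le′)) ∷ l ,
         ↭-trans (↭-reflexive (≡.sym (take++drop≡id r P))) (↭-trans (++⁺ˡ J e) (↭-sym (++-assoc J (blocks xs) P′)))

    C₀ : ℕ
    C₀ = r + r * suc r * (1 + 2 * r)

    length-blocks : ∀ xs → All (λ xJ → length (proj₂ xJ) ≡ r) xs → length (blocks xs) ≡ r * length xs
    length-blocks [] [] = ≡.sym (*-zeroʳ r)
    length-blocks ((x , J) ∷ xs) (|J| ∷ l) =
      ≡.trans (length-++ J) (≡.trans (cong₂ _+_ |J| (length-blocks xs l)) (≡.sym (*-suc r (length xs))))

    Absorbing : List A → List A → Set
    Absorbing X P = ∃[ Γ ] ∃[ P′ ] P ↭ Γ ++ P′ × length Γ ≤ C₀ * length X ×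
      (∀ {Y} → Y ⊑ X → r ∣ length Y + length Γ → Tile (Y ++ Γ))

    module Chain (xs : List (A × List A)) (l : All (λ xJ → length (proj₂ xJ) ≡ r) xs) (I : List A) (|I| : length I ≡ r)
      (Γ : List A) (tile : ∀ {Rs} → Rs Sub.⊆ chain I xs → Tile (concat Rs ++ Γ)) where

      close : ∀ c {Z T} → length c < r → r ∣ length c → Z ++ c ↭ T → Tile Z → Tile T
      close []      {Z} c<r r∣c e t = tile-↭ e (tile-↭ (↭-reflexive (≡.sym (++-identityʳ Z))) t)
      close (x ∷ c)     c<r r∣c e t = contradiction (∣⇒≤ r∣c) (<⇒≱ c<r)

      -- Fewer than r vertices stay unmatched, and r divides their number because everything else is
      -- tiled; hence there are none.
      absorb-ys : ∀ {Y ys Rs c} → Y ↭ ys → r ∣ length Y + length (blocks xs ++ Γ) → Rs Sub.⊆ chain I xs → length c < r →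
        concat Rs ++ c ↭ drop (suc (κ + ℓ)) I ++ ys ++ blocks xs → Tile (Y ++ blocks xs ++ Γ)
      absorb-ys {Y} {ys} {Rs} {c} Y↭ys r∣ s c<r e = close c c<r
        (∣m+n∣m⇒∣n (subst (r ∣_) (≡.trans (≡.sym (length-++ Y)) (length-↭-++ (concat Rs ++ Γ) (↭-sym e″))) r∣) (tile-∣ (tile s)))
        e″ (tile s)
        where
        open PermutationReasoning
        e′ : concat Rs ++ c ↭ Y ++ blocks xs
        e′ = begin
          concat Rs ++ c                                 ↭⟨ e ⟩
          drop (suc (κ + ℓ)) I ++ ys ++ blocks xs        ≡⟨ cong (_++ ys ++ blocks xs) (drop-all (suc (κ + ℓ)) I (≤-reflexive (≡.trans |I| r≡))) ⟩
          ys ++ blocks xs                                ↭⟨ ++⁺ʳ (blocks xs) Y↭ys ⟨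
          Y ++ blocks xs                                 ∎
        e″ : (concat Rs ++ Γ) ++ c ↭ Y ++ blocks xs ++ Γ
        e″ = begin
          (concat Rs ++ Γ) ++ c      ↭⟨ ++-assoc (concat Rs) Γ c ⟩
          concat Rs ++ Γ ++ c        ↭⟨ ++⁺ˡ (concat Rs) (++-comm Γ c) ⟩
          concat Rs ++ c ++ Γ        ↭⟨ ++-assoc (concat Rs) c Γ ⟨
          (concat Rs ++ c) ++ Γ      ↭⟨ ++⁺ʳ Γ e′ ⟩
          (Y ++ blocks xs) ++ Γ      ↭⟨ ++-assoc Y (blocks xs) Γ ⟩
          Y ++ blocks xs ++ Γ        ∎

      absorb : ∀ {Y} → Y ⊑ map proj₁ xs → r ∣ length Y + length (blocks xs ++ Γ) → Tile (Y ++ blocks xs ++ Γ)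
      absorb YX r∣ =
        let ys , s₀ , Y↭ys = ⊑⇒sublist YX
            Rs , c , s , c<r , e = chain-partition I xs |I| l (κ + ℓ) (≤-reflexive (≡.sym r≡)) s₀
        in absorb-ys Y↭ys r∣ s c<r e

    absorb-chain : ∀ {B} → Dense B V V → ∀ v → v ∈ V → ∀ xs {P P₁} → map proj₁ xs ⊑ V → P ⊑ V →
      All (λ xJ → length (proj₂ xJ) ≡ r) xs → P ↭ blocks xs ++ P₁ →
      B + a + C₀ * length xs < length P → Absorbing (map proj₁ xs) P
    absorb-chain {B} dense v v∈V xs {P} {P₁} XV PV l e₁ lt = collect (absorbers ⊑-refl dense (chain I xs)
        (chain-All I xs |I| l (AllP.replicate⁺ r (All.lookup dense v∈V)) (All-⊑ XV dense) (All-⊑ (sub e₁) (All-⊑ PV dense)))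
        (rest-⊑ (blocks xs) e₁ PV) room)
      where
      open ≤-Reasoning
      c m : ℕ
      c = r * suc r
      m = length xs
      -- A dummy block in front of the first one. The chain starts in state r - 1, so no vertex of
      -- it is ever matched, and r copies of one vertex will do.
      I : List A
      I = replicate r v
      |I| : length I ≡ r
      |I| = length-replicate r
      |blocks| : length (blocks xs) ≡ r * m
      |blocks| = length-blocks xs l
      arith : ∀ x c r n → x + c * ((1 + 2 * r) * n) + r * n ≡ x + (r + c * (1 + 2 * r)) * n
      arith = solve-∀
      arith′ : ∀ c r n → r * n + c * ((1 + 2 * r) * n) ≡ (r + c * (1 + 2 * r)) * n
      arith′ = solve-∀
      room : B + a + c * length (chain I xs) < length P₁
      room = +-cancelʳ-< (length (blocks xs)) _ _ (begin-strict
        B + a + c * length (chain I xs) + length (blocks xs)   ≡⟨ cong₂ (λ y z → B + a + c * y + z) (length-chain I xs) |blocks| ⟩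
        B + a + c * ((1 + 2 * r) * m) + r * m                  ≡⟨ arith (B + a) c r m ⟩
        B + a + C₀ * m                                         <⟨ lt ⟩
        length P                                               ≡⟨ length-↭-++ (blocks xs) e₁ ⟩
        length (blocks xs) + length P₁                         ≡⟨ +-comm (length (blocks xs)) (length P₁) ⟩
        length P₁ + length (blocks xs)                         ∎)
      collect : ∃[ Γ ] ∃[ P′ ] P₁ ↭ Γ ++ P′ × length Γ ≤ c * length (chain I xs) ×
        (∀ {Rs} → Rs Sub.⊆ chain I xs → Tile (concat Rs ++ Γ)) → Absorbing (map proj₁ xs) P
      collect (Γ , P₂ , e₂ , len , tile) = blocks xs ++ Γ , P₂ , ↭-++-assoc (blocks xs) Γ P₂ e₁ e₂ , (begin
        length (blocks xs ++ Γ)                ≡⟨ length-++ (blocks xs) ⟩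
        length (blocks xs) + length Γ          ≤⟨ +-mono-≤ (≤-reflexive |blocks|) (≤-trans len (≤-reflexive (cong (c *_) (length-chain I xs)))) ⟩
        r * m + c * ((1 + 2 * r) * m)          ≡⟨ arith′ c r m ⟩
        C₀ * m                                 ≡⟨ cong (C₀ *_) (length-map proj₁ xs) ⟨
        C₀ * length (map proj₁ xs)             ∎)
        , Chain.absorb xs l I |I| Γ tile

    absorbing-set : ∀ {B} → Dense B V V → ∀ {X P} → X ⊑ V → P ⊑ V → B + a + C₀ * length X < length P → Absorbing X P
    absorbing-set dense {X} {[]} XV PV ()
    absorbing-set {B} dense {X} {P@(v ∷ _)} XV PV lt = attach (attach-blocks X {P} rX≤P)
      where
      open ≤-Reasoning
      rX≤P : r * length X ≤ length P
      rX≤P = begin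
        r * length X                 ≤⟨ *-monoˡ-≤ (length X) (m≤m+n r (r * suc r * (1 + 2 * r))) ⟩
        C₀ * length X                ≤⟨ m≤n+m (C₀ * length X) (B + a) ⟩
        B + a + C₀ * length X        ≤⟨ <⇒≤ lt ⟩
        length P                     ∎
      attach : ∃[ xs ] ∃[ P₁ ] map proj₁ xs ≡ X × All (λ xJ → length (proj₂ xJ) ≡ r) xs × P ↭ blocks xs ++ P₁ → Absorbing X P
      attach (xs , P₁ , ≡.refl , l , e) = absorb-chain dense v (⊑⇒∈ PV (here ≡.refl)) xs XV PV l e
        (subst (λ z → B + a + C₀ * z < length P) (length-map proj₁ xs) lt)

    -- Cliques of small weight

    deg-swap : ∀ C P → ∑ C (deg P) ≡ ∑ P (deg C)
    deg-swap C P = ≡.trans (∑-swap C P _) (∑-cong P λ z → ∑-cong C λ x → cong 𝟙 (adj-sym x z))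

    -- `c` is the unit of slack. By `fine`, discarding the vertices joined to less than a 1/m
    -- proportion of `C` costs only `c` in the double counting; `slack` pays for this and for the
    -- `c` in the invariant of `pick`.
    module Light {U : List A} {B c m : ℕ} (UV : U ⊑ V) (dense : Dense B U U)
      (slack : B + (c + c) ≤ length U) (fine : k * length U ≤ m * c) (m>0 : 0 < m) (w : A → ℕ) where

      u : ℕ
      u = length U

      popular : List A → List A → List A
      popular P C = filterᵇ (λ z → length C ≤ᵇ m * deg C z) P

      -- Double counting the pairs (x , z) in C × P with x adjacent to z.
      popular-size : ∀ {P C} → P ⊑ U → C ⊑ U → 0 < length C → k * length P ≤ B + k * length (popular P C) + c
      popular-size {P} {C} PU CU C>0 = *-cancelˡ-≤ (m * length C) (begin
        m * |C| * (k * |P|)                            ≡⟨ e₁ m |C| (k * |P|) ⟩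
        m * (|C| * (k * |P|))                          ≤⟨ *-monoʳ-≤ m (∑-≥ {xs = C} {c = k * |P|} (All.map below (All-⊑ CU dense))) ⟩
        m * ∑ C (λ x → k * deg P x + B)                ≡⟨ cong (m *_) (≡.trans (∑-+ C _ _) (cong₂ _+_ (∑-* C k _) (∑-const C B))) ⟩
        m * (k * ∑ C (deg P) + |C| * B)                ≡⟨ cong (λ z → m * (k * z + |C| * B)) (deg-swap C P) ⟩
        m * (k * ∑ P (deg C) + |C| * B)                ≡⟨ e₂ m k (∑ P (deg C)) |C| B ⟩
        k * (m * ∑ P (deg C)) + m * |C| * B            ≡⟨ cong (λ z → k * z + m * |C| * B) (∑-* P m _) ⟨
        k * ∑ P (λ z → m * deg C z) + m * |C| * B      ≤⟨ +-monoˡ-≤ _ (*-monoʳ-≤ k (∑-mono (All.universal above′ P))) ⟩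
        k * ∑ P (λ z → m * |C| * 𝟙 (q z) + |C|) + m * |C| * B
                                                       ≡⟨ cong (λ z → k * z + m * |C| * B) (≡.trans (∑-+ P _ _) (cong₂ _+_ (≡.trans (∑-* P (m * |C|) _) (cong (m * |C| *_) (≡.sym (length-filterᵇ q P)))) (∑-const P |C|))) ⟩
        k * (m * |C| * |Y| + |P| * |C|) + m * |C| * B  ≡⟨ e₃ k m |C| |Y| |P| B ⟩
        m * |C| * (B + k * |Y|) + |C| * (k * |P|)      ≤⟨ +-monoʳ-≤ _ (*-monoʳ-≤ |C| (≤-trans (*-monoʳ-≤ k (length-⊑ PU)) fine)) ⟩
        m * |C| * (B + k * |Y|) + |C| * (m * c)        ≡⟨ e₄ m |C| (B + k * |Y|) c ⟩
        m * |C| * (B + k * |Y| + c)                    ∎)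
        where
        open ≤-Reasoning
        |C| |P| |Y| : ℕ
        |C| = length C
        |P| = length P
        |Y| = length (popular P C)
        q : A → Bool
        q z = |C| ≤ᵇ m * deg C z
        instance
          nz : NonZero (m * length C)
          nz = m*n≢0 m (length C) {{>-nonZero m>0}} {{>-nonZero C>0}}
        e₁ : ∀ m x y → m * x * y ≡ m * (x * y)
        e₁ = solve-∀
        e₂ : ∀ m k d x B → m * (k * d + x * B) ≡ k * (m * d) + m * x * B
        e₂ = solve-∀
        e₃ : ∀ k m x y p B → k * (m * x * y + p * x) + m * x * B ≡ m * x * (B + k * y) + x * (k * p)
        e₃ = solve-∀
        e₄ : ∀ m x y c → m * x * y + x * (m * c) ≡ m * x * (y + c)
        e₄ = solve-∀
        below : ∀ {x} → k * nd U x ≤ B → k * |P| ≤ k * deg P x + B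
        below {x} d = begin
          k * |P|                     ≡⟨ cong (k *_) (deg+nd P x) ⟨
          k * (deg P x + nd P x)      ≡⟨ *-distribˡ-+ k (deg P x) (nd P x) ⟩
          k * deg P x + k * nd P x    ≤⟨ +-monoʳ-≤ _ (≤-trans (*-monoʳ-≤ k (nd-⊑ PU x)) d) ⟩
          k * deg P x + B             ∎
        above′ : ∀ z → m * deg C z ≤ m * |C| * 𝟙 (q z) + |C|
        above′ z with |C| ≤? m * deg C z
        ... | yes p rewrite ≤ᵇ-true p | *-identityʳ (m * |C|) =
          ≤-trans (*-monoʳ-≤ m (≤-trans (m≤m+n (deg C z) (nd C z)) (≤-reflexive (deg+nd C z)))) (m≤m+n _ _)
        ... | no ¬p = ≤-trans (<⇒≤ (≰⇒> ¬p)) (m≤n+m _ _)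

      -- The slack absorbs both `c`, so the popular vertices still number at least (j + 1)u/k, and
      -- all weigh at least as much as the lightest of them, z. Passing to the neighbourhood of z
      -- costs only `B`, hence at most one `u` of the invariant.
      pick-one : 0 < u → ∀ j {P C} → P ⊑ U → C ⊑ U → 0 < length C → suc (suc j) * u ≤ k * length P + c →
        ∃[ z ] z ∈ P × suc j * u ≤ k * above U w (w z) × length C ≤ m * length (N z C) × suc j * u ≤ k * length (N z P) + c
      pick-one u>0 j {P} {C} PU CU C>0 le = select (minimal w (proj₂ (nonempty k 0 {Y} (≤-trans u>0 (≤-trans (m≤m+n u (j * u)) le₁)))))
        where
        open ≤-Reasoning
        Y = popular P C
        YP : Y ⊑ P
        YP = filter-⊑ (λ z → length C ≤ᵇ m * deg C z) P
        e₁ : ∀ B y c → B + y + c + c ≡ B + (c + c) + y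
        e₁ = solve-∀
        e₂ : ∀ y B c → y + B + c ≡ B + (y + c)
        e₂ = solve-∀
        le₁ : suc j * u ≤ k * length Y
        le₁ = +-cancelˡ-≤ u _ _ (begin
          u + suc j * u                       ≤⟨ le ⟩
          k * length P + c                    ≤⟨ +-monoˡ-≤ c (popular-size PU CU C>0) ⟩
          B + k * length Y + c + c            ≡⟨ e₁ B (k * length Y) c ⟩
          B + (c + c) + k * length Y          ≤⟨ +-monoˡ-≤ _ slack ⟩
          u + k * length Y                    ∎)
        select : ∃[ z ] z ∈ Y × All (λ x → w z ≤ w x) Y →
          ∃[ z ] z ∈ P × suc j * u ≤ k * above U w (w z) × length C ≤ m * length (N z C) × suc j * u ≤ k * length (N z P) + c
        select (z , z∈Y , z-min) = z , ⊑⇒∈ YP z∈Y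
          , ≤-trans le₁ (*-monoʳ-≤ k (count-⊑ {p = λ x → w z ≤ᵇ w x} {Y} {U} (⊑-trans YP PU)
              (All.map (λ {x} p → ≤ᵇ-true {w z} {w x} p) z-min)))
          , ≤-trans (≤ᵇ-true⁻ {length C} {m * deg C z} (All.lookup (filter-All (λ z → length C ≤ᵇ m * deg C z) P) z∈Y))
              (≤-reflexive (cong (m *_) (≡.sym (length-filterᵇ (adj z) C))))
          , +-cancelˡ-≤ u _ _ (begin
              u + suc j * u                        ≤⟨ le ⟩
              k * length P + c                     ≤⟨ +-monoˡ-≤ c (N-size {U} {B} {P} {z} PU (All.lookup dense (⊑⇒∈ (⊑-trans YP PU) z∈Y))) ⟩
              k * length (N z P) + B + c           ≡⟨ e₂ (k * length (N z P)) B c ⟩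
              B + (k * length (N z P) + c)         ≤⟨ +-monoˡ-≤ _ (≤-trans (m≤m+n B (c + c)) slack) ⟩
              u + (k * length (N z P) + c)         ∎)

      record Pick (y j : ℕ) (P C : List A) : Set where
        field
          ys C′  : List A
          clique : Clique j ys
          ys⊆P   : ys ⊆ P
          C′⊑C   : C′ ⊑ C
          joined : All (λ z → All (Adj z) C′) ys
          large  : length C ≤ m ^ j * length C′
          levels : Levels y k (above U w) (map w ys)

      pick-cons : ∀ {y j P C z} → y ≤ u → z ∈ P → suc j * u ≤ k * above U w (w z) → length C ≤ m * length (N z C) →
        Pick y j (N z P) (N z C) → Pick y (suc j) P C
      pick-cons {y} {j} {P} {C} {z} y≤u z∈P lz z-pop p = record
        { ys     = z ∷ ys
        ; C′     = C′
        ; clique = extend {v = z} {P} clique ys⊆P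
        ; ys⊆P   = λ { (here ≡.refl) → z∈P ; (there n) → N-⊆ z P (ys⊆P n) }
        ; C′⊑C   = ⊑-trans C′⊑C (filter-⊑ (adj z) C)
        ; joined = All-⊑ C′⊑C (filter-All (adj z) C) ∷ joined
        ; large  = begin
             length C                      ≤⟨ z-pop ⟩
             m * length (N z C)            ≤⟨ *-monoʳ-≤ m large ⟩
             m * (m ^ j * length C′)       ≡⟨ *-assoc m (m ^ j) (length C′) ⟨
             m ^ suc j * length C′         ∎
        ; levels = (begin
             suc (length (map w ys)) * y                   ≡⟨ cong (λ l → suc l * y) (≡.trans (length-map w ys) (proj₁ clique)) ⟩
             suc j * y                                     ≤⟨ *-monoʳ-≤ (suc j) y≤u ⟩
             suc j * u                                     ≤⟨ lz ⟩
             k * above U w (w z)                           ∎) ∷ levels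
        }
        where
        open ≤-Reasoning
        open Pick p

      pick : ∀ {y} → y ≤ u → 0 < u → ∀ j {P C} → P ⊑ U → C ⊑ U → 0 < length C → suc j * u ≤ k * length P + c → Pick y j P C
      pick y≤u u>0 zero {P} {C} PU CU C>0 le = record
        { ys = [] ; C′ = C ; clique = ≡.refl , [] ; ys⊆P = λ () ; C′⊑C = ⊑-refl ; joined = []
        ; large = ≤-reflexive (≡.sym (+-identityʳ _)) ; levels = [] }
      pick {y} y≤u u>0 (suc j) {P} {C} PU CU C>0 le = cont (pick-one u>0 j {P} {C} PU CU C>0 le)
        where
        positive : ∀ l → 0 < m * l → 0 < l
        positive zero    p rewrite *-zeroʳ m = p
        positive (suc l) p = s≤s z≤n
        cont : ∃[ z ] z ∈ P × suc j * u ≤ k * above U w (w z) × length C ≤ m * length (N z C) × suc j * u ≤ k * length (N z P) + c →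
          Pick y (suc j) P C
        cont (z , z∈P , lz , z-pop , le₂) = pick-cons y≤u z∈P lz z-pop
          (pick y≤u u>0 j {N z P} {N z C} (⊑-trans (filter-⊑ (adj z) P) PU) (⊑-trans (filter-⊑ (adj z) C) CU)
               (positive (length (N z C)) (≤-trans C>0 z-pop)) le₂)

      LightClique : ℕ → Set
      LightClique y = ∃[ K ] Clique r K × (K ⊆ U) × y * ∑ K w ≤ r * ∑ U w

      -- The K_ℓ cannot be chosen by weight, so it is sought among the lightest vertices, of weight
      -- at most `τ`. Then `τ` and the weights of the κ + 1 chosen vertices are k numbers with about
      -- k/k, (k - 1)/k, ..., 1/k of `U` above them, and `levels-sum` bounds their sum by about k
      -- times the average.
      light-clique : 0 < ℓ → ∀ {s y} → length U ≡ s + y → m ^ suc κ * a < s → LightClique y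
      light-clique ℓ>0 {s} {y} |U| lt = locate (threshold U w s y |U|)
        where
        open ≤-Reasoning
        s>0 : 0 < s
        s>0 = ≤-trans (s≤s z≤n) lt
        y≤u : y ≤ u
        y≤u = ≤-trans (m≤n+m y s) (≤-reflexive (≡.sym |U|))
        u>0 : 0 < u
        u>0 = ≤-trans s>0 (≤-trans (m≤m+n s y) (≤-reflexive (≡.sym |U|)))
        ∑-map : ∀ ys → ∑ ys w ≡ ∑ (map w ys) id
        ∑-map []       = ≡.refl
        ∑-map (x ∷ ys) = cong (λ z → w x + z) (∑-map ys)
        e : ∀ y x τ l → y * (x + suc l * τ) ≡ y * (τ + x) + l * (y * τ)
        e = solve-∀
        e′ : ∀ κ l → 2 + κ + l ≡ 1 + κ + suc l
        e′ = solve-∀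

        module _ (τ : ℕ) (s≤ : s ≤ count (λ z → w z ≤ᵇ τ) U) (y≤ : y ≤ above U w τ) where

          C : List A
          C = filterᵇ (λ z → w z ≤ᵇ τ) U
          CU : C ⊑ U
          CU = filter-⊑ (λ z → w z ≤ᵇ τ) U
          s≤C : s ≤ length C
          s≤C = ≤-trans s≤ (≤-reflexive (≡.sym (length-filterᵇ (λ z → w z ≤ᵇ τ) U)))
          τ-point : ∀ z → τ * 𝟙 (τ ≤ᵇ w z) ≤ w z
          τ-point z with τ ≤? w z
          ... | yes p rewrite ≤ᵇ-true p | *-identityʳ τ = p
          ... | no ¬p rewrite ≤ᵇ-false (≰⇒> ¬p) | *-zeroʳ τ = z≤n
          τ-avg : y * τ ≤ ∑ U w
          τ-avg = begin
            y * τ                               ≤⟨ *-monoˡ-≤ τ y≤ ⟩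
            above U w τ * τ                     ≡⟨ *-comm _ τ ⟩
            τ * above U w τ                     ≡⟨ ∑-* U τ _ ⟨
            ∑ U (λ z → τ * 𝟙 (τ ≤ᵇ w z))        ≤⟨ ∑-mono (All.universal τ-point U) ⟩
            ∑ U w                               ∎

          finish : (p : Pick y (suc κ) U C) → ∃[ S ] Clique ℓ S × (∀ {x} → x ∈ S → x ∈ Pick.C′ p) → LightClique y
          finish p (S , clS , S⊆C′) = ys ++ S
            , (≡.trans (length-++ ys) (≡.trans (cong₂ _+_ (proj₁ clique) (proj₁ clS)) (≡.sym r≡))
              , APP.++⁺ (proj₂ clique) (proj₂ clS) (All.map (λ p → All.tabulate (All.lookup p ∘ S⊆C′)) joined))
            , (λ n → in-U (∈-++⁻ ys n))
            , bound ℓ ℓ>0 ≡.refl (proj₁ clS)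
            where
            open Pick p
            S⊆C : S ⊆ C
            S⊆C n = ⊑⇒∈ C′⊑C (S⊆C′ n)
            in-U : ∀ {x} → x ∈ ys ⊎ x ∈ S → x ∈ U
            in-U (inj₁ n) = ys⊆P n
            in-U (inj₂ n) = ⊑⇒∈ CU (S⊆C n)
            S-light : All (λ z → w z ≤ τ) S
            S-light = All.tabulate λ {x} n → ≤ᵇ-true⁻ {w x} {τ} (All.lookup (filter-All (λ z → w z ≤ᵇ τ) U) (S⊆C n))
            weights : y * (τ + ∑ ys w) ≤ k * ∑ U w
            weights = ≤-trans (≤-reflexive (cong (λ z → y * (τ + z)) (∑-map ys))) (levels-sum U w (_∷_ {t = τ} (begin
              suc (length (map w ys)) * y    ≡⟨ cong (λ l → suc l * y) (≡.trans (length-map w ys) (proj₁ clique)) ⟩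
              (2 + κ) * y                    ≡⟨ cong (_* y) k≡ ⟨
              k * y                          ≤⟨ *-monoʳ-≤ k y≤ ⟩
              k * above U w τ                ∎) levels))
            bound : ∀ l → 0 < l → l ≡ ℓ → length S ≡ l → y * ∑ (ys ++ S) w ≤ r * ∑ U w
            bound (suc l) _ l≡ℓ |S| = begin
              y * ∑ (ys ++ S) w                 ≡⟨ cong (y *_) (∑-++ ys S w) ⟩
              y * (∑ ys w + ∑ S w)              ≤⟨ *-monoʳ-≤ y (+-monoʳ-≤ (∑ ys w) (≤-trans (∑-≤ S-light) (≤-reflexive (cong (_* τ) |S|)))) ⟩
              -- One vertex of `S` is counted as the level `τ`, the other ℓ - 1 are charged to the
              -- average by `τ-avg`; k + (ℓ - 1) = r.
              y * (∑ ys w + suc l * τ)          ≡⟨ e y (∑ ys w) τ l ⟩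
              y * (τ + ∑ ys w) + l * (y * τ)    ≤⟨ +-mono-≤ weights (*-monoʳ-≤ l τ-avg) ⟩
              k * ∑ U w + l * ∑ U w             ≡⟨ *-distribʳ-+ (∑ U w) k l ⟨
              (k + l) * ∑ U w                   ≡⟨ cong (_* ∑ U w) (≡.trans (cong (_+ l) k≡) (≡.trans (e′ κ l)
                                                     (≡.trans (cong (λ z → 1 + κ + z) l≡ℓ) (≡.sym r≡)))) ⟩
              r * ∑ U w                         ∎

          search : Pick y (suc κ) U C → LightClique y
          search p = finish p (alpha (⊑-trans (Pick.C′⊑C p) (⊑-trans CU UV))
            (*-cancelˡ-< (m ^ suc κ) a (length (Pick.C′ p)) (≤-trans lt (≤-trans s≤C (Pick.large p)))))

        locate : ∃[ τ ] s ≤ count (λ z → w z ≤ᵇ τ) U × y ≤ above U w τ → LightClique y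
        locate (τ , s≤ , y≤) = search τ s≤ y≤ (pick y≤u u>0 (suc κ) {U} {C τ s≤ y≤} ⊑-refl (CU τ s≤ y≤) (≤-trans s>0 (s≤C τ s≤ y≤))
          (≤-trans (≤-reflexive (cong (_* u) (≡.sym k≡))) (m≤m+n (k * u) c)))

    -- Well-spread families of cliques

    -- `low` is linear in `t`, whereas a general `W` of this size only has the bound (rt)²M. A new
    -- clique adds at most 2 · 4srM through `gain` and at most r²M ≤ srM by its own potential,
    -- whence the 9.
    record Spread (Q : List A) (s t : ℕ) : Set where
      open Potential adj adj-sym adj-irrefl Q
      field
        W U   : List A
        split : Q ↭ W ++ U
        |W|   : length W ≡ r * t
        tile  : Tile W
        low   : Φ W ≤ t * (9 * s * r * M)

    module Iterate {Q : List A} {B c m s T : ℕ} (QV : Q ⊑ V) (dense : Dense B Q Q)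
      (slack : B + (c + c) + r * T ≤ length Q) (fine : k * length Q ≤ m * c) (m>0 : 0 < m)
      (lt : m ^ suc κ * a < s) (r≤s : r ≤ s) (s+rT≤q : s + r * T ≤ length Q) (half : 2 * (r * T) ≤ length Q) where

      open Potential adj adj-sym adj-irrefl Q

      spread-suc : ∀ {t} → t < T → Spread Q s t → Spread Q s (suc t)
      spread-suc {t} t<T S = next (Light.light-clique {U} {B} {c} {m} (⊑-trans UQ QV)
          (All.map (λ {v} d → ≤-trans (*-monoʳ-≤ k (nd-⊑ UQ v)) d) (All-⊑ UQ dense))
          (cancel-≤ (≤-trans slack q≤rT+u))
          (≤-trans (*-monoʳ-≤ k (length-⊑ UQ)) fine) m>0 (wt⁺ W |W|≤q) ℓ>0 {s} {y} |U| lt)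
        where
        open Spread S
        u : ℕ
        u = length U
        UQ : U ⊑ Q
        UQ = sub (↭-trans split (++-comm W U))
        q≡ : q ≡ r * t + u
        q≡ = ≡.trans (↭-length split) (≡.trans (length-++ W) (cong (_+ u) |W|))
        q≤rT+u : q ≤ u + r * T
        q≤rT+u = ≤-trans (≤-reflexive q≡) (≤-trans (≤-reflexive (+-comm (r * t) u)) (+-monoʳ-≤ u (*-monoʳ-≤ r (<⇒≤ t<T))))
        cancel-≤ : ∀ {x} → x + r * T ≤ u + r * T → x ≤ u
        cancel-≤ {x} = +-cancelʳ-≤ (r * T) x u
        |W|≤q : length W ≤ q
        |W|≤q = ≤-trans (≤-reflexive |W|) (≤-trans (m≤m+n (r * t) u) (≤-reflexive (≡.sym q≡)))
        s≤u : s ≤ u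
        s≤u = cancel-≤ (≤-trans s+rT≤q q≤rT+u)
        y : ℕ
        y = u ∸ s
        |U| : u ≡ s + y
        |U| = ≡.sym (m+[n∸m]≡n s≤u)
        q≤2u : q ≤ 2 * u
        q≤2u = +-cancelʳ-≤ q q (2 * u) (begin
          q + q                       ≤⟨ +-mono-≤ q≤rT+u q≤rT+u ⟩
          u + r * T + (u + r * T)     ≡⟨ e u (r * T) ⟩
          2 * u + 2 * (r * T)         ≤⟨ +-monoʳ-≤ (2 * u) half ⟩
          2 * u + q                   ∎)
          where
          open ≤-Reasoning
          e : ∀ u x → u + x + (u + x) ≡ 2 * u + 2 * x
          e = solve-∀
        next : ∃[ K ] Clique r K × (K ⊆ U) × y * ∑ K (wt⁺ W |W|≤q) ≤ r * ∑ U (wt⁺ W |W|≤q) → Spread Q s (suc t)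
        next (K , clK , K⊆U , le) with clique-⊑ (proj₂ clK) K⊆U
        ... | sub {U′} U↭ = record
          { W = K ++ W
          ; U = U′
          ; split = ↭-trans split (↭-trans (++⁺ˡ W U↭) (↭-trans (shifts W K) (↭-sym (++-assoc K W U′))))
          ; |W| = ≡.trans (length-++ K) (≡.trans (cong₂ _+_ (proj₁ clK) |W|) (≡.sym (*-suc r t)))
          ; tile = tile-++ (tile-clique clK) tile
          ; low = begin
              Φ (K ++ W)                                                         ≤⟨ Φ-grow {W} {K} gain≤ ⟩
              Φ W + (2 * (4 * s * length K * M) + length K * length K * M)       ≡⟨ cong (λ l → Φ W + (2 * (4 * s * l * M) + l * l * M)) (proj₁ clK) ⟩
              Φ W + (2 * (4 * s * r * M) + r * r * M)                            ≤⟨ +-mono-≤ low (+-monoʳ-≤ _ (*-monoˡ-≤ M (*-monoˡ-≤ r r≤s))) ⟩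
              t * (9 * s * r * M) + (2 * (4 * s * r * M) + s * r * M)            ≡⟨ e t s r M ⟩
              suc t * (9 * s * r * M)                                            ∎
          }
          where
          open ≤-Reasoning
          e : ∀ t s r M → t * (9 * s * r * M) + (2 * (4 * s * r * M) + s * r * M) ≡ suc t * (9 * s * r * M)
          e = solve-∀
          gain≤ : gain W K ℤ.≤ + (4 * s * length K * M)
          gain≤ = gain-≤ W |W|≤q {K} {U} {s} {y} split |U| (≤-trans (≤-trans (s≤s z≤n) lt) s≤u) q≤2u
            (≤-trans le (≤-reflexive (cong (_* ∑ U (wt⁺ W |W|≤q)) (≡.sym (proj₁ clK)))))

      spread : ∀ t → t ≤ T → Spread Q s t
      spread zero    _ = record { W = [] ; U = Q ; split = refl ; |W| = ≡.sym (*-zeroʳ r) ; tile = tile-[]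
        ; low = ≤-trans (≤-reflexive zero-Φ) z≤n }
        where
        zero-Φ : Φ [] ≡ 0
        zero-Φ = ≡.trans (∑-cong Q λ v → cong (λ d → ∣ d ∣ * ∣ d ∣) (e (+ q) (+ deg Q v))) (∑-0 Q)
          where
          e : ∀ x y → x ℤ.* + 0 ℤ.- + 0 ℤ.* y ≡ + 0
          e = ℤSolver.solve-∀
      spread (suc t) t<T = spread-suc t<T (spread t (<⇒≤ t<T))

    -- `upper` and `lower`: a good vertex has nearly the same proportion of non-neighbours in W as in Q.
    record Phase (Q : List A) (s T h : ℕ) : Set where
      field
        W U   : List A
        split : Q ↭ W ++ U
        |W|   : length W ≡ r * T
        tile  : Tile W
        good  : A → Bool
        few   : count (not ∘ good) Q ≤ 9 * s * (h * h)
        upper : ∀ v → good v ≡ true → h * (length Q * nd W v) ≤ h * (length W * nd Q v) + length Q * length Q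
        lower : ∀ v → good v ≡ true → h * (length W * nd Q v) ≤ h * (length Q * nd W v) + length Q * length Q

    -- Chebyshev: h² times the contribution of a bad vertex to `Φ W` exceeds q⁴, while `Φ W` is at
    -- most 9sq⁴ because rT ≤ q. So the bound on bad vertices does not involve `T`. Up to sign `D`
    -- is the same for non-neighbours, as `deg` and `nd` add up to the length.
    spread⇒phase : ∀ {Q s T} → 0 < length Q → r * T ≤ length Q → ∀ h → Spread Q s T → Phase Q s T h
    spread⇒phase {Q} {s} {T} q>0 rT≤q h S = record
      { W = W ; U = U ; split = split ; |W| = |W| ; tile = tile ; good = good ; few = few
      ; upper = λ v g → scale v g (proj₁ (balance v)) ; lower = λ v g → scale v g (proj₂ (balance v)) }
      where
      open Spread S
      open Potential adj adj-sym adj-irrefl Q using (q; M; D; Φ)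
      open ≤-Reasoning
      good : A → Bool
      good v = h * ∣ D W v ∣ ≤ᵇ q * q
      instance
        nzq : NonZero (q * q * (q * q))
        nzq = m*n≢0 (q * q) (q * q) {{m*n≢0 q q {{>-nonZero q>0}} {{>-nonZero q>0}}}} {{m*n≢0 q q {{>-nonZero q>0}} {{>-nonZero q>0}}}}
      bad-point : ∀ v → q * q * (q * q) * 𝟙 (not (good v)) ≤ h * h * (∣ D W v ∣ * ∣ D W v ∣)
      bad-point v with h * ∣ D W v ∣ ≤? q * q
      ... | yes p rewrite ≤ᵇ-true p | *-zeroʳ (q * q * (q * q)) = z≤n
      ... | no ¬p rewrite ≤ᵇ-false (≰⇒> ¬p) = begin
        q * q * (q * q) * 1                        ≡⟨ *-identityʳ _ ⟩
        q * q * (q * q)                            ≤⟨ *-mono-≤ (<⇒≤ (≰⇒> ¬p)) (<⇒≤ (≰⇒> ¬p)) ⟩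
        h * ∣ D W v ∣ * (h * ∣ D W v ∣)            ≡⟨ e h ∣ D W v ∣ ⟩
        h * h * (∣ D W v ∣ * ∣ D W v ∣)            ∎
        where
        e : ∀ h d → h * d * (h * d) ≡ h * h * (d * d)
        e = solve-∀
      few : count (not ∘ good) Q ≤ 9 * s * (h * h)
      few = *-cancelˡ-≤ (q * q * (q * q)) (begin
        q * q * (q * q) * count (not ∘ good) Q               ≡⟨ ∑-* Q (q * q * (q * q)) _ ⟨
        ∑ Q (λ v → q * q * (q * q) * 𝟙 (not (good v)))       ≤⟨ ∑-mono (All.universal bad-point Q) ⟩
        ∑ Q (λ v → h * h * (∣ D W v ∣ * ∣ D W v ∣))          ≡⟨ ∑-* Q (h * h) _ ⟩
        h * h * Φ W                                          ≤⟨ *-monoʳ-≤ (h * h) low ⟩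
        h * h * (T * (9 * s * r * M))                        ≡⟨ e₁ h T s r q ⟩
        9 * s * (h * h) * (q * (q * q)) * (r * T)            ≤⟨ *-monoʳ-≤ (9 * s * (h * h) * (q * (q * q))) rT≤q ⟩
        9 * s * (h * h) * (q * (q * q)) * q                  ≡⟨ e₂ s h q ⟩
        q * q * (q * q) * (9 * s * (h * h))                  ∎)
        where
        e₁ : ∀ h T s r q → h * h * (T * (9 * s * r * (q * (q * q)))) ≡ 9 * s * (h * h) * (q * (q * q)) * (r * T)
        e₁ = solve-∀
        e₂ : ∀ s h q → 9 * s * (h * h) * (q * (q * q)) * q ≡ q * q * (q * q) * (9 * s * (h * h))
        e₂ = solve-∀
      balance : ∀ v → (q * nd W v ≤ length W * nd Q v + ∣ D W v ∣) × (length W * nd Q v ≤ q * nd W v + ∣ D W v ∣)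
      balance v = ≤-from-difference {d = D W v} (≡.trans (cong (ℤ._+ D W v) (ℤP.pos-* q (nd W v)))
        (≡.trans (identity (+ q) (+ nd W v) (+ deg W v) (+ length W) (+ nd Q v) (+ deg Q v) (len W) (len Q)) (≡.sym (ℤP.pos-* (length W) (nd Q v)))))
        where
        len : ∀ P → + length P ≡ + deg P v ℤ.+ + nd P v
        len P = ≡.trans (cong +_ (≡.sym (deg+nd P v))) (ℤP.pos-+ (deg P v) (nd P v))
        identity : ∀ q nW dW W nQ dQ → W ≡ dW ℤ.+ nW → q ≡ dQ ℤ.+ nQ → q ℤ.* nW ℤ.+ (q ℤ.* dW ℤ.- W ℤ.* dQ) ≡ W ℤ.* nQ
        identity q nW dW W nQ dQ ≡.refl ≡.refl = e nW dW nQ dQ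
          where
          e : ∀ nW dW nQ dQ → (dQ ℤ.+ nQ) ℤ.* nW ℤ.+ ((dQ ℤ.+ nQ) ℤ.* dW ℤ.- (dW ℤ.+ nW) ℤ.* dQ) ≡ (dW ℤ.+ nW) ℤ.* nQ
          e = ℤSolver.solve-∀
      scale : ∀ v → good v ≡ true → ∀ {x y} → x ≤ y + ∣ D W v ∣ → h * x ≤ h * y + q * q
      scale v g {x} {y} le = begin
        h * x                       ≤⟨ *-monoʳ-≤ h le ⟩
        h * (y + ∣ D W v ∣)         ≡⟨ *-distribˡ-+ h y _ ⟩
        h * y + h * ∣ D W v ∣       ≤⟨ +-monoʳ-≤ (h * y) (≤ᵇ-true⁻ {h * ∣ D W v ∣} {q * q} g) ⟩
        h * y + q * q               ∎

    module _ {e₀ s T : ℕ} (e₀>0 : 0 < e₀) (lt : (8 * e₀ * k) ^ suc κ * a < s) (r≤s : r ≤ s) where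

      phase : ∀ {Q} → Q ⊑ V → All (λ v → e₀ * (k * nd Q v) + length Q ≤ e₀ * length Q) Q →
        4 * e₀ ≤ length Q → 4 * e₀ * (r * T) ≤ length Q → s + r * T ≤ length Q → ∀ h → Phase Q s T h
      phase {Q} QV dense q-large T-small s+rT≤q h = spread⇒phase q>0 (≤-trans (m≤n+m (r * T) s) s+rT≤q) h (Iterate.spread {Q} {B} {c} {8 * e₀ * k} {s} {T} QV dense′ slack fine m>0 lt r≤s s+rT≤q half T ≤-refl)
        where
        q : ℕ
        q = length Q
        instance
          nz : NonZero e₀
          nz = >-nonZero e₀>0
          nz₄ : NonZero (4 * e₀)
          nz₄ = m*n≢0 4 e₀
        k>0 : 0 < k
        k>0 = ≤-trans (s≤s z≤n) (≤-reflexive (≡.sym k≡))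
        -- The slack q/e₀ is cut into four parts `c`: two for the light cliques and two for the at
        -- most rT vertices that leave `Q` on the way.
        c B : ℕ
        c = q / (4 * e₀)
        B = q ∸ 4 * c
        4ec≤q : 4 * e₀ * c ≤ q
        4ec≤q = ≤-trans (≤-reflexive (*-comm (4 * e₀) c)) (m/n*n≤m q (4 * e₀))
        c>0 : 0 < c
        c>0 = m≥n⇒m/n>0 q-large
        q≤8ec : q ≤ 8 * e₀ * c
        q≤8ec = begin
          q                                       ≡⟨ m≡m%n+[m/n]*n q (4 * e₀) ⟩
          q % (4 * e₀) + c * (4 * e₀)             ≤⟨ +-monoˡ-≤ _ (<⇒≤ (m%n<n q (4 * e₀))) ⟩
          4 * e₀ + c * (4 * e₀)                   ≤⟨ +-monoˡ-≤ _ (m≤n*m (4 * e₀) c {{>-nonZero c>0}}) ⟩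
          c * (4 * e₀) + c * (4 * e₀)             ≡⟨ e c e₀ ⟩
          8 * e₀ * c                              ∎
          where
          open ≤-Reasoning
          e : ∀ c e → c * (4 * e) + c * (4 * e) ≡ 8 * e * c
          e = solve-∀
        4c≤q : 4 * c ≤ q
        4c≤q = ≤-trans (*-monoˡ-≤ c (m≤m*n 4 e₀)) 4ec≤q
        dense′ : Dense B Q Q
        dense′ = All.map (λ {v} d → m+n≤o⇒m≤o∸n (k * nd Q v) (*-cancelˡ-≤ e₀ (begin
          e₀ * (k * nd Q v + 4 * c)         ≡⟨ e e₀ (k * nd Q v) c ⟩
          e₀ * (k * nd Q v) + 4 * e₀ * c    ≤⟨ +-monoʳ-≤ _ 4ec≤q ⟩
          e₀ * (k * nd Q v) + q             ≤⟨ d ⟩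
          e₀ * q                            ∎))) dense
          where
          open ≤-Reasoning
          e : ∀ e x c → e * (x + 4 * c) ≡ e * x + 4 * e * c
          e = solve-∀
        rT≤2c : r * T ≤ 2 * c
        rT≤2c = *-cancelˡ-≤ (4 * e₀) (begin
          4 * e₀ * (r * T)     ≤⟨ T-small ⟩
          q                    ≤⟨ q≤8ec ⟩
          8 * e₀ * c           ≡⟨ e e₀ c ⟩
          4 * e₀ * (2 * c)     ∎)
          where
          open ≤-Reasoning
          e : ∀ e c → 8 * e * c ≡ 4 * e * (2 * c)
          e = solve-∀
        slack : B + (c + c) + r * T ≤ q
        slack = begin
          B + (c + c) + r * T     ≤⟨ +-monoʳ-≤ (B + (c + c)) rT≤2c ⟩
          B + (c + c) + 2 * c     ≡⟨ e B c ⟩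
          B + 4 * c               ≡⟨ m∸n+n≡m 4c≤q ⟩
          q                       ∎
          where
          open ≤-Reasoning
          e : ∀ B c → B + (c + c) + 2 * c ≡ B + 4 * c
          e = solve-∀
        fine : k * q ≤ 8 * e₀ * k * c
        fine = ≤-trans (*-monoʳ-≤ k q≤8ec) (≤-reflexive (e k e₀ c))
          where
          e : ∀ k e c → k * (8 * e * c) ≡ 8 * e * k * c
          e = solve-∀
        m>0 : 0 < 8 * e₀ * k
        m>0 = *-mono-≤ {1} {8 * e₀} (*-mono-≤ {1} {8} (s≤s z≤n) e₀>0) k>0
        half : 2 * (r * T) ≤ q
        half = ≤-trans (*-monoˡ-≤ (r * T) (≤-trans (m≤m+n 2 2) (m≤m*n 4 e₀))) T-small
        q>0 : 0 < q
        q>0 = ≤-trans (*-mono-≤ {1} {4} (s≤s z≤n) e₀>0) q-large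

    -- Almost perfect tilings

    nd-split : ∀ {Q} W U → Q ↭ W ++ U → ∀ v → nd Q v ≡ nd W v + nd U v
    nd-split W U e v = ≡.trans (∑-↭ _ e) (∑-++ W U _)

    -- The surplus of non-neighbours in U is the deficit in W, so a lower bound for W becomes an
    -- upper bound for U with the same error.
    rest-nd : ∀ h q w u nQ nW nU → q ≡ w + u → nQ ≡ nW + nU → h * (w * nQ) ≤ h * (q * nW) + q * q →
      h * (q * nU) ≤ h * (u * nQ) + q * q
    rest-nd h q w u nQ nW nU ≡.refl ≡.refl le = +-cancelʳ-≤ (h * (q * nW)) _ _ (begin
      h * (q * nU) + h * (q * nW)                ≡⟨ e h w u nW nU ⟩
      h * (u * nQ) + h * (w * nQ)                ≤⟨ +-monoʳ-≤ (h * (u * nQ)) le ⟩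
      h * (u * nQ) + (h * (q * nW) + q * q)      ≡⟨ e′ (h * (u * nQ)) (h * (q * nW)) (q * q) ⟩
      h * (u * nQ) + q * q + h * (q * nW)        ∎)
      where
      open ≤-Reasoning
      e : ∀ h w u nW nU → h * ((w + u) * nU) + h * ((w + u) * nW) ≡ h * (u * (nW + nU)) + h * (w * (nW + nU))
      e = solve-∀
      e′ : ∀ x y z → x + (y + z) ≡ x + z + y
      e′ = solve-∀

    -- Passing to the N good vertices left costs one unit of y, that is 1 / Z of the density.
    ratio : ∀ Z k q u y N b nQ nU → 0 < q → u ≡ N + b →
      4 * (Z * k) * (q * nU) ≤ 4 * (Z * k) * (u * nQ) + q * q → Z * (k * nQ) ≤ y * q → 4 * (y * b) + q ≤ 4 * N →
      Z * (k * nU) ≤ suc y * N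
    ratio Z k q u y N b nQ nU q>0 u≡ le dQ small = *-cancelˡ-≤ (4 * q) {{m*n≢0 4 q {{_}} {{>-nonZero q>0}}}} (begin
      4 * q * (Z * (k * nU))                         ≡⟨ e₁ q Z k nU ⟩
      4 * (Z * k) * (q * nU)                         ≤⟨ le ⟩
      4 * (Z * k) * (u * nQ) + q * q                 ≡⟨ e₂ Z k u nQ (q * q) ⟩
      4 * u * (Z * (k * nQ)) + q * q                 ≤⟨ +-monoˡ-≤ (q * q) (*-monoʳ-≤ (4 * u) dQ) ⟩
      4 * u * (y * q) + q * q                        ≡⟨ cong (λ u → 4 * u * (y * q) + q * q) u≡ ⟩
      4 * (N + b) * (y * q) + q * q                  ≡⟨ e₃ N b y q ⟩
      q * (4 * N * y + (4 * (y * b) + q))            ≤⟨ *-monoʳ-≤ q (+-monoʳ-≤ (4 * N * y) small) ⟩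
      q * (4 * N * y + 4 * N)                        ≡⟨ e₄ q N y ⟩
      4 * q * (suc y * N)                            ∎)
      where
      open ≤-Reasoning
      e₁ : ∀ q Z k n → 4 * q * (Z * (k * n)) ≡ 4 * (Z * k) * (q * n)
      e₁ = solve-∀
      e₂ : ∀ Z k u n x → 4 * (Z * k) * (u * n) + x ≡ 4 * u * (Z * (k * n)) + x
      e₂ = solve-∀
      e₃ : ∀ N b y q → 4 * (N + b) * (y * q) + q * q ≡ q * (4 * N * y + (4 * (y * b) + q))
      e₃ = solve-∀
      e₄ : ∀ q N y → q * (4 * N * y + 4 * N) ≡ 4 * q * (suc y * N)
      e₄ = solve-∀

    small-loss : ∀ y Z b β w q N → y ≤ Z → 0 < Z → b ≤ β → 4 * (Z * β) ≤ q → 4 * w ≤ q → q ≡ w + (N + b) → 4 * (y * b) + q ≤ 4 * N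
    small-loss y Z b β w q N y≤Z Z>0 b≤β Zβ w≤ q≡ = +-cancelʳ-≤ (4 * w + 4 * b) _ _ (begin
      4 * (y * b) + q + (4 * w + 4 * b)       ≤⟨ +-mono-≤ (+-monoˡ-≤ q (≤-trans (*-monoʳ-≤ 4 (*-mono-≤ y≤Z b≤β)) Zβ))
                                                   (+-mono-≤ w≤ (≤-trans (*-monoʳ-≤ 4 (≤-trans b≤β (m≤n*m β Z {{>-nonZero Z>0}}))) Zβ)) ⟩
      q + q + (q + q)                         ≡⟨ e q ⟩
      4 * q                                   ≡⟨ cong (4 *_) q≡ ⟩
      4 * (w + (N + b))                       ≡⟨ e′ w N b ⟩
      4 * N + (4 * w + 4 * b)                 ∎)
      where
      open ≤-Reasoning
      e : ∀ q → q + q + (q + q) ≡ 4 * q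
      e = solve-∀
      e′ : ∀ w N b → 4 * (w + (N + b)) ≡ 4 * N + (4 * w + 4 * b)
      e′ = solve-∀

    -- The number of bad vertices at accuracy h = 4Zk, where Z = p e₀. At this accuracy the error of
    -- a phase amounts to q/4 in Zk times the number of non-neighbours.
    step-loss : ℕ → ℕ → ℕ → ℕ
    step-loss p e₀ s = 9 * s * (4 * (p * e₀ * k) * (4 * (p * e₀ * k)))

    module Phases {e₀ p s T N₀ : ℕ} (e₀>0 : 0 < e₀) (p>0 : 0 < p)
      (lt : (8 * e₀ * k) ^ suc κ * a < s) (r≤s : r ≤ s)
      (N₀-large : 4 * e₀ ≤ N₀) (T-small : 4 * e₀ * (r * T) ≤ N₀) (s-small : s + r * T ≤ N₀)
      (β-small : 4 * (p * e₀ * step-loss p e₀ s) ≤ N₀) where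

      private
        Z h β : ℕ
        Z = p * e₀
        h = 4 * (Z * k)
        β = step-loss p e₀ s

        Z>0 : 0 < Z
        Z>0 = *-mono-≤ {1} {p} p>0 e₀>0

      -- Density in units of 1/Z. Each phase raises `y` by one, and p phases started with y + p + p
      -- ≤ Z keep y + p ≤ Z, which is the slack 1/e₀ that `phase` requires.
      Ratio : ℕ → List A → Set
      Ratio y Q = All (λ v → Z * (k * nd Q v) ≤ y * length Q) Q

      record Step (y : ℕ) (Q : List A) : Set where
        field
          W Q′ R : List A
          split  : Q ↭ W ++ Q′ ++ R
          |W|    : length W ≡ r * T
          tile   : Tile W
          few    : length R ≤ β
          dense  : Ratio (suc y) Q′

      step : ∀ {y Q} → Q ⊑ V → y + p ≤ Z → Ratio y Q → N₀ ≤ length Q → Step y Q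
      step {y} {Q} QV y+p≤Z dense N₀≤q = result (phase {e₀} {s} {T} e₀>0 lt r≤s QV (All.map loosen dense)
          (≤-trans N₀-large N₀≤q) (≤-trans T-small N₀≤q) (≤-trans s-small N₀≤q) h)
        where
        open ≤-Reasoning
        q : ℕ
        q = length Q
        loosen : ∀ {v} → Z * (k * nd Q v) ≤ y * q → e₀ * (k * nd Q v) + q ≤ e₀ * q
        loosen {v} d = *-cancelˡ-≤ p {{>-nonZero p>0}} (begin
          p * (e₀ * (k * nd Q v) + q)       ≡⟨ e p e₀ (k * nd Q v) q ⟩
          Z * (k * nd Q v) + p * q          ≤⟨ +-monoˡ-≤ (p * q) d ⟩
          y * q + p * q                     ≡⟨ *-distribʳ-+ q y p ⟨
          (y + p) * q                       ≤⟨ *-monoˡ-≤ q y+p≤Z ⟩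
          p * e₀ * q                        ≡⟨ *-assoc p e₀ q ⟩
          p * (e₀ * q)                      ∎)
          where
          e : ∀ p e x q → p * (e * x + q) ≡ p * e * x + p * q
          e = solve-∀
        result : Phase Q s T h → Step y Q
        result Ph = record { W = W ; Q′ = Q′ ; R = R
          ; split = ↭-trans split (++⁺ˡ W (partition-↭ good U))
          ; |W| = |W| ; tile = tile ; few = R≤β
          ; dense = All.tabulate dense′ }
          where
          open Phase Ph
          Q′ R : List A
          Q′ = filterᵇ good U
          R  = filterᵇ (not ∘ good) U
          UQ : U ⊑ Q
          UQ = sub (↭-trans split (++-comm W U))
          R≤β : length R ≤ β
          R≤β = ≤-trans (≤-reflexive (length-filterᵇ (not ∘ good) U)) (≤-trans (∑-⊑ _ UQ) few)
          u≡ : length U ≡ length Q′ + length R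
          u≡ = ≡.trans (↭-length (partition-↭ good U)) (length-++ Q′)
          q≡ : q ≡ length W + length U
          q≡ = ≡.trans (↭-length split) (length-++ W)
          4w≤q : 4 * length W ≤ q
          4w≤q = ≤-trans (*-mono-≤ (m≤m*n 4 e₀ {{>-nonZero e₀>0}}) (≤-reflexive |W|)) (≤-trans T-small N₀≤q)
          q>0 : 0 < q
          q>0 = ≤-trans (*-mono-≤ {1} {4} (s≤s z≤n) e₀>0) (≤-trans N₀-large N₀≤q)
          dense′ : ∀ {v} → v ∈ Q′ → Z * (k * nd Q′ v) ≤ suc y * length Q′
          dense′ {v} v∈ = ≤-trans (*-monoʳ-≤ Z (*-monoʳ-≤ k (nd-⊑ (filter-⊑ good U) v)))
            (ratio Z k q (length U) y (length Q′) (length R) (nd Q v) (nd U v) q>0 u≡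
              (rest-nd h q (length W) (length U) (nd Q v) (nd W v) (nd U v) q≡ (nd-split W U split v)
                (lower v (All.lookup (filter-All good U) v∈)))
              (All.lookup dense (⊑⇒∈ (⊑-trans (filter-⊑ good U) UQ) v∈))
              (small-loss y Z (length R) β (length W) q (length Q′) (≤-trans (m≤m+n y p) y+p≤Z) Z>0 R≤β
                (≤-trans β-small N₀≤q) 4w≤q (≡.trans q≡ (cong (λ z → length W + z) u≡))))

      NearCover : ℕ → List A → Set
      NearCover j Q = ∃[ W ] ∃[ L ] Q ↭ W ++ L × Tile W × length L ≤ N₀ + j * β

      -- A phase removes at least rT vertices, so the length bound limits the number of phases. The
      -- run stops early when fewer than `N₀` vertices remain, where `phase` may cease to apply.
      near-cover : ∀ j {y Q} → Q ⊑ V → y + j + p ≤ Z → Ratio y Q → length Q ≤ j * (r * T) → NearCover j Q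
      near-cover zero {y} {Q} QV le dense Q≤ = [] , Q , refl , tile-[] , ≤-trans Q≤ z≤n
      near-cover (suc j) {y} {Q} QV le dense Q≤ with N₀ ≤? length Q
      ... | no ¬p = [] , Q , refl , tile-[] , ≤-trans (<⇒≤ (≰⇒> ¬p)) (m≤m+n N₀ _)
      ... | yes p′ = first (step QV (≤-trans (+-monoˡ-≤ p (m≤m+n y (suc j))) le) dense p′)
        where
        first : Step y Q → NearCover (suc j) Q
        first S = second (near-cover j {suc y} {Q′} (⊑-trans Q′Q QV) (≤-trans (≤-reflexive (cong (_+ p) (≡.sym (+-suc y j)))) le) dense′ Q′≤)
          where
          open Step S renaming (dense to dense′)
          open ≤-Reasoning
          Q′Q : Q′ ⊑ Q
          Q′Q = ⊑-trans (⊑-++ˡ Q′ R) (sub (↭-trans split (++-comm W (Q′ ++ R))))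
          Q′≤ : length Q′ ≤ j * (r * T)
          Q′≤ = +-cancelˡ-≤ (r * T) _ _ (begin
            r * T + length Q′               ≡⟨ cong (_+ length Q′) |W| ⟨
            length W + length Q′            ≤⟨ +-monoʳ-≤ (length W) (length-⊑ (⊑-++ˡ Q′ R)) ⟩
            length W + length (Q′ ++ R)     ≡⟨ length-↭-++ W split ⟨
            length Q                        ≤⟨ Q≤ ⟩
            r * T + j * (r * T)             ∎)
          second : NearCover j Q′ → NearCover (suc j) Q
          second (W₁ , L , e , t , L≤) = W ++ W₁ , L ++ R
            , ↭-trans split (↭-trans (++⁺ˡ W (↭-trans (++⁺ʳ R e) (++-assoc W₁ L R))) (↭-sym (++-assoc W W₁ (L ++ R))))
            , tile-++ tile t
            , (begin
                length (L ++ R)              ≡⟨ length-++ L ⟩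
                length L + length R          ≤⟨ +-mono-≤ L≤ few ⟩
                N₀ + j * β + β               ≡⟨ +-assoc N₀ (j * β) β ⟩
                N₀ + (j * β + β)             ≡⟨ cong (λ z → N₀ + z) (+-comm (j * β) β) ⟩
                N₀ + suc j * β               ∎)

    -- Perfect tilings

    n : ℕ
    n = length V

    -- The accuracy h makes the error at most half of the slack 1/e of V, so a good vertex keeps the
    -- slack 1/(2e) towards X.
    transfer : ∀ e k n h x nV nX → 0 < n → 0 < h → e * (k * nV) + n ≤ e * n → 2 * e * k * n ≤ h * x →
      h * (n * nX) ≤ h * (x * nV) + n * n → 2 * e * (k * nX) + x ≤ 2 * e * x
    transfer e k n h x nV nX n>0 h>0 d le up = *-cancelˡ-≤ (h * n) {{m*n≢0 h n {{>-nonZero h>0}} {{>-nonZero n>0}}}} (begin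
      h * n * (2 * e * (k * nX) + x)                     ≡⟨ e₁ h n e k nX x ⟩
      2 * e * k * (h * (n * nX)) + h * n * x             ≤⟨ +-monoˡ-≤ (h * n * x) (*-monoʳ-≤ (2 * e * k) up) ⟩
      2 * e * k * (h * (x * nV) + n * n) + h * n * x     ≡⟨ e₂ h n e k nV x ⟩
      2 * h * x * (e * (k * nV)) + 2 * e * k * n * n + h * n * x
        ≤⟨ +-monoˡ-≤ (h * n * x) (+-monoʳ-≤ (2 * h * x * (e * (k * nV))) (*-monoˡ-≤ n le)) ⟩
      2 * h * x * (e * (k * nV)) + h * x * n + h * n * x ≡⟨ e₃ h x n (e * (k * nV)) ⟩
      2 * h * x * (e * (k * nV) + n)                     ≤⟨ *-monoʳ-≤ (2 * h * x) d ⟩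
      2 * h * x * (e * n)                                ≡⟨ e₄ h x e n ⟩
      h * n * (2 * e * x)                                ∎)
      where
      open ≤-Reasoning
      e₁ : ∀ h n e k z x → h * n * (2 * e * (k * z) + x) ≡ 2 * e * k * (h * (n * z)) + h * n * x
      e₁ = solve-∀
      e₂ : ∀ h n e k z x → 2 * e * k * (h * (x * z) + n * n) + h * n * x ≡ 2 * h * x * (e * (k * z)) + 2 * e * k * n * n + h * n * x
      e₂ = solve-∀
      e₃ : ∀ h x n z → 2 * h * x * z + h * x * n + h * n * x ≡ 2 * h * x * (z + n)
      e₃ = solve-∀
      e₄ : ∀ h x e n → 2 * h * x * (e * n) ≡ h * n * (2 * e * x)
      e₄ = solve-∀

    -- The slack 1/e is spent by halves: the at most `lost` vertices set aside before the tiling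
    -- leave 1/(2e), and the phases leave 1/(4e), which is why `phase` is run with 4e.
    module Assemble {e s T₁ h₁ x′ n′ p T N₀ : ℕ} (e>0 : 0 < e) (p>0 : 0 < p) (h₁>0 : 0 < h₁)
      (degree : ∀ v → e * (k * nd V v) + n ≤ e * n)
      (lt : (8 * (4 * e) * k) ^ suc κ * a < s) (r≤s : r ≤ s)
      (c₁ : 4 * (4 * e) ≤ n) (c₂ : 4 * (4 * e) * (r * T₁) ≤ n) (c₃ : s + r * T₁ ≤ n)
      (c₄ : 2 * e * k * n ≤ h₁ * (r * T₁)) (c₅ : e * n′ ≤ n)
      (c₆ : 2 * (r * T₁ + C₀ * (r * T₁) + suc r * (9 * s * (h₁ * h₁)) + a) ≤ n′)
      (c₇ : r * T₁ ≡ 2 * e * x′)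
      (d₁ : 4 * (4 * e) ≤ N₀) (d₂ : 4 * (4 * e) * (r * T) ≤ N₀) (d₃ : s + r * T ≤ N₀)
      (d₄ : 4 * (p * (4 * e) * step-loss p (4 * e) s) ≤ N₀)
      (d₅ : n ≤ p * (r * T)) (d₆ : 9 * s * (h₁ * h₁) + a + r * (N₀ + p * step-loss p (4 * e) s) < x′)
      (r∣n : r ∣ n)
      where

      private
        instance
          nze : NonZero e
          nze = >-nonZero e>0

        e₀>0 : 0 < 4 * e
        e₀>0 = *-mono-≤ {1} {4} (s≤s z≤n) e>0
        n>0 : 0 < n
        n>0 = ≤-trans (*-mono-≤ {1} {4} (s≤s z≤n) e₀>0) c₁
        x b₁ lost B₀ B₁ : ℕ
        x    = r * T₁
        b₁   = 9 * s * (h₁ * h₁)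
        lost = x + C₀ * x + suc r * b₁
        B₀   = n ∸ n′
        B₁   = x ∸ x′

        lost+a<n′ : lost + a < n′
        lost+a<n′ = ≤-trans (≤-trans (+-monoˡ-≤ (lost + a) (≤-trans a>0 (m≤n+m a lost))) (≤-reflexive (e′ (lost + a)))) c₆
          where
          e′ : ∀ z → z + z ≡ 2 * z
          e′ = solve-∀

        n′≤n : n′ ≤ n
        n′≤n = ≤-trans (m≤n*m n′ e) c₅

        x′≤x : x′ ≤ x
        x′≤x = ≤-trans (m≤n*m x′ (2 * e) {{m*n≢0 2 e}}) (≤-reflexive (≡.sym c₇))

        dense₀ : ∀ v → k * nd V v ≤ B₀
        dense₀ v = m+n≤o⇒m≤o∸n (k * nd V v) (*-cancelˡ-≤ e (begin
          e * (k * nd V v + n′)         ≡⟨ *-distribˡ-+ e (k * nd V v) n′ ⟩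
          e * (k * nd V v) + e * n′     ≤⟨ +-monoʳ-≤ _ c₅ ⟩
          e * (k * nd V v) + n          ≤⟨ degree v ⟩
          e * n                         ∎))
          where open ≤-Reasoning

        denseV : Dense B₀ V V
        denseV = All.universal dense₀ V

        room : ∀ {used free} → n ≤ used + free → ∀ {z} → used + z ≤ lost → B₀ + a + z < free
        room {used} {free} le {z} le′ = +-cancelˡ-< used _ _ (begin-strict
          used + (B₀ + a + z)       ≡⟨ e₁ used B₀ a z ⟩
          used + z + a + B₀         ≤⟨ +-monoˡ-≤ B₀ (+-monoˡ-≤ a le′) ⟩
          lost + a + B₀             <⟨ +-monoˡ-< B₀ lost+a<n′ ⟩
          n′ + B₀                   ≡⟨ m+[n∸m]≡n n′≤n ⟩
          n                         ≤⟨ le ⟩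
          used + free               ∎)
          where
          open ≤-Reasoning
          e₁ : ∀ u b a z → u + (b + a + z) ≡ u + z + a + b
          e₁ = solve-∀

      -- Nothing is known about the neighbours in X of a bad vertex. Those outside X are therefore
      -- covered first, by cliques avoiding X; those inside X are left for absorption. The leftover
      -- of the tiling is then good and can be covered from the good part of X.
      module Stage₁ (Ph : Phase V s T₁ h₁) where
        open Phase Ph renaming (W to X)

        Xg Xb Ug Ub : List A
        Xg = filterᵇ good X
        Xb = filterᵇ (not ∘ good) X
        Ug = filterᵇ good U
        Ub = filterᵇ (not ∘ good) U

        XV : X ⊑ V
        XV = sub split
        UV : U ⊑ V
        UV = sub (↭-trans split (++-comm X U))
        UgV : Ug ⊑ V
        UgV = ⊑-trans (filter-⊑ good U) UV
        XgV : Xg ⊑ V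
        XgV = ⊑-trans (filter-⊑ good X) XV

        Ub≤ : length Ub ≤ b₁
        Ub≤ = ≤-trans (≤-reflexive (length-filterᵇ (not ∘ good) U)) (≤-trans (∑-⊑ _ UV) few)
        Xb≤ : length Xb ≤ b₁
        Xb≤ = ≤-trans (≤-reflexive (length-filterᵇ (not ∘ good) X)) (≤-trans (∑-⊑ _ XV) few)

        V↭ : V ↭ X ++ Ug ++ Ub
        V↭ = ↭-trans split (++⁺ˡ X (partition-↭ good U))

        n≡ : n ≡ x + (length Ug + length Ub)
        n≡ = ≡.trans (length-↭-++ X V↭) (cong₂ _+_ |W| (length-++ Ug))

        denseX : ∀ v → good v ≡ true → k * nd Xg v ≤ B₁
        denseX v g = ≤-trans (*-monoʳ-≤ k (nd-⊑ (filter-⊑ good X) v)) (m+n≤o⇒m≤o∸n (k * nd X v)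
          (*-cancelˡ-≤ (2 * e) {{m*n≢0 2 e}} (begin
            2 * e * (k * nd X v + x′)           ≡⟨ *-distribˡ-+ (2 * e) (k * nd X v) x′ ⟩
            2 * e * (k * nd X v) + 2 * e * x′   ≡⟨ cong (λ z → 2 * e * (k * nd X v) + z) (≡.sym c₇) ⟩
            2 * e * (k * nd X v) + x            ≤⟨ transfer e k n h₁ x (nd V v) (nd X v) n>0 h₁>0 (degree v) c₄
                                                     (subst (λ w → h₁ * (n * nd X v) ≤ h₁ * (w * nd V v) + n * n) |W| (upper v g)) ⟩
            2 * e * x                           ∎)))
          where open ≤-Reasoning

        module Stage₂ (S P₁ : List A) (e₂ : Ug ↭ S ++ P₁) (S≤ : length S ≤ r * length Ub) (t₂ : Tile (Ub ++ S)) where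

          P₁V : P₁ ⊑ V
          P₁V = rest-⊑ S e₂ UgV

          used₁ : length Ub + length S ≤ suc r * b₁
          used₁ = ≤-trans (+-mono-≤ Ub≤ (≤-trans S≤ (*-monoʳ-≤ r Ub≤))) ≤-refl

          n≡₁ : n ≡ x + (length Ub + length S) + length P₁
          n≡₁ = ≡.trans n≡ (≡.trans (cong (λ z → x + (z + length Ub)) (length-↭-++ S e₂)) (e′ x (length S) (length P₁) (length Ub)))
            where
            e′ : ∀ x s p u → x + (s + p + u) ≡ x + (u + s) + p
            e′ = solve-∀

          module Stage₃ (Γ Q : List A) (e₃ : P₁ ↭ Γ ++ Q) (Γ≤ : length Γ ≤ C₀ * length X)
            (absorb : ∀ {Y} → Y ⊑ X → r ∣ length Y + length Γ → Tile (Y ++ Γ)) where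

            QV : Q ⊑ V
            QV = rest-⊑ Γ e₃ P₁V

            n≤ : n ≤ lost + length Q
            n≤ = begin
              n                                                              ≡⟨ n≡₁ ⟩
              x + (length Ub + length S) + length P₁                         ≡⟨ cong (λ z → x + (length Ub + length S) + z) (length-↭-++ Γ e₃) ⟩
              x + (length Ub + length S) + (length Γ + length Q)             ≤⟨ +-mono-≤ (+-monoʳ-≤ x used₁) (+-monoˡ-≤ (length Q) (≤-trans Γ≤ (≤-reflexive (cong (C₀ *_) |W|)))) ⟩
              x + suc r * b₁ + (C₀ * x + length Q)                           ≡⟨ e′ x (suc r * b₁) (C₀ * x) (length Q) ⟩
              lost + length Q                                                ∎
              where
              open ≤-Reasoning
              e′ : ∀ x b c q → x + b + (c + q) ≡ x + c + b + q
              e′ = solve-∀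

            -- With Z = p(4e), y/Z is 1 - 1/(2e). Of the 2p units still free, the phases consume p.
            y : ℕ
            y = p * (4 * e) ∸ (p + p)

            y≡ : y + (p + p) ≡ p * (4 * e)
            y≡ = m∸n+n≡m (≤-trans (≤-reflexive (e′ p)) (*-monoʳ-≤ p (≤-trans (m≤m+n 2 2) (m≤m*n 4 e))))
              where
              e′ : ∀ p → p + p ≡ p * 2
              e′ = solve-∀

            ratio₄ : ∀ v → p * (4 * e) * (k * nd Q v) ≤ y * length Q
            ratio₄ v = +-cancelʳ-≤ ((p + p) * q) _ _ (begin
              p * (4 * e) * (k * nd Q v) + (p + p) * q         ≡⟨ e₁ p e (k * nd Q v) q ⟩
              p * (4 * (e * (k * nd Q v)) + 2 * q)             ≤⟨ *-monoʳ-≤ p inner ⟩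
              p * (4 * e * q)                                  ≡⟨ *-assoc p (4 * e) q ⟨
              p * (4 * e) * q                                  ≡⟨ cong (_* q) y≡ ⟨
              (y + (p + p)) * q                                ≡⟨ *-distribʳ-+ q y (p + p) ⟩
              y * q + (p + p) * q                              ∎)
              where
              open ≤-Reasoning
              q : ℕ
              q = length Q
              e₁ : ∀ p e z q → p * (4 * e) * z + (p + p) * q ≡ p * (4 * (e * z) + 2 * q)
              e₁ = solve-∀
              e₂′ : ∀ z n → 4 * z + 2 * n + 2 * n ≡ 4 * (z + n)
              e₂′ = solve-∀
              e₃′ : ∀ e l q → 4 * (e * (l + q)) ≡ 4 * e * q + 2 * (e * (2 * l))
              e₃′ = solve-∀
              2lost : e * (2 * lost) ≤ n
              2lost = ≤-trans (*-monoʳ-≤ e (≤-trans (*-monoʳ-≤ 2 (m≤m+n lost a)) c₆)) c₅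
              inner : 4 * (e * (k * nd Q v)) + 2 * q ≤ 4 * e * q
              inner = +-cancelʳ-≤ (2 * n) _ _ (begin
                4 * (e * (k * nd Q v)) + 2 * q + 2 * n       ≤⟨ +-monoˡ-≤ (2 * n) (+-mono-≤ (*-monoʳ-≤ 4 (*-monoʳ-≤ e (*-monoʳ-≤ k (nd-⊑ QV v)))) (*-monoʳ-≤ 2 (length-⊑ QV))) ⟩
                4 * (e * (k * nd V v)) + 2 * n + 2 * n       ≡⟨ e₂′ (e * (k * nd V v)) n ⟩
                4 * (e * (k * nd V v) + n)                   ≤⟨ *-monoʳ-≤ 4 (degree v) ⟩
                4 * (e * n)                                  ≤⟨ *-monoʳ-≤ 4 (*-monoʳ-≤ e n≤) ⟩
                4 * (e * (lost + q))                         ≡⟨ e₃′ e lost q ⟩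
                4 * e * q + 2 * (e * (2 * lost))             ≤⟨ +-monoʳ-≤ (4 * e * q) (*-monoʳ-≤ 2 2lost) ⟩
                4 * e * q + 2 * n                            ∎)

            module Stage₄ (W₄ L : List A) (e₄ : Q ↭ W₄ ++ L) (t₄ : Tile W₄) (L≤ : length L ≤ N₀ + p * step-loss p (4 * e) s) where

              L-good : All (λ v → good v ≡ true) L
              L-good = All-⊑ (⊑-trans (rest-⊑ W₄ e₄ ⊑-refl) (⊑-trans (rest-⊑ Γ e₃ ⊑-refl) (rest-⊑ S e₂ ⊑-refl))) (filter-All good U)

              room₅ : B₁ + a + r * length L < length Xg
              room₅ = +-cancelʳ-< b₁ _ _ (begin-strict
                B₁ + a + r * length L + b₁                            ≤⟨ +-monoˡ-≤ b₁ (+-monoʳ-≤ (B₁ + a) (*-monoʳ-≤ r L≤)) ⟩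
                B₁ + a + r * (N₀ + p * step-loss p (4 * e) s) + b₁    ≡⟨ e′ B₁ a (r * (N₀ + p * step-loss p (4 * e) s)) b₁ ⟩
                b₁ + a + r * (N₀ + p * step-loss p (4 * e) s) + B₁    <⟨ +-monoˡ-< B₁ d₆ ⟩
                x′ + B₁                                               ≡⟨ m+[n∸m]≡n x′≤x ⟩
                x                                                     ≡⟨ |W| ⟨
                length X                                              ≡⟨ length-↭-++ Xg (partition-↭ good X) ⟩
                length Xg + length Xb                                 ≤⟨ +-monoʳ-≤ (length Xg) Xb≤ ⟩
                length Xg + b₁                                        ∎)
                where
                open ≤-Reasoning
                e′ : ∀ B a z b → B + a + z + b ≡ b + a + z + B
                e′ = solve-∀

              module Stage₅ (S₅ P₅ : List A) (e₅ : Xg ↭ S₅ ++ P₅) (t₅ : Tile (L ++ S₅)) where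

                Y : List A
                Y = P₅ ++ Xb

                X↭ : X ↭ S₅ ++ Y
                X↭ = ↭-trans (partition-↭ good X) (↭-trans (++⁺ʳ Xb e₅) (++-assoc S₅ P₅ Xb))

                tiled : List A
                tiled = (Ub ++ S) ++ W₄ ++ L ++ S₅

                t : Tile tiled
                t = tile-++ t₂ (tile-++ t₄ t₅)

                V↭tiled : V ↭ tiled ++ Y ++ Γ
                V↭tiled = begin
                  V                                                ↭⟨ V↭ ⟩
                  X ++ Ug ++ Ub                                    ↭⟨ ++⁺ X↭ (++-comm Ug Ub) ⟩
                  (S₅ ++ Y) ++ Ub ++ Ug                            ↭⟨ ++⁺ˡ (S₅ ++ Y) (++⁺ˡ Ub e₂) ⟩
                  (S₅ ++ Y) ++ Ub ++ S ++ P₁                       ↭⟨ ++⁺ˡ (S₅ ++ Y) (++-assoc Ub S P₁) ⟨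
                  (S₅ ++ Y) ++ (Ub ++ S) ++ P₁                     ↭⟨ shifts (S₅ ++ Y) (Ub ++ S) ⟩
                  (Ub ++ S) ++ (S₅ ++ Y) ++ P₁                     ↭⟨ ++⁺ˡ (Ub ++ S) inner ⟩
                  (Ub ++ S) ++ (W₄ ++ L ++ S₅) ++ Y ++ Γ           ↭⟨ ++-assoc (Ub ++ S) (W₄ ++ L ++ S₅) (Y ++ Γ) ⟨
                  tiled ++ Y ++ Γ                                  ∎
                  where
                  open PermutationReasoning
                  inner : (S₅ ++ Y) ++ P₁ ↭ (W₄ ++ L ++ S₅) ++ Y ++ Γ
                  inner = begin
                    (S₅ ++ Y) ++ P₁                    ↭⟨ ++⁺ˡ (S₅ ++ Y) (↭-trans e₃ (++⁺ˡ Γ e₄)) ⟩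
                    (S₅ ++ Y) ++ Γ ++ W₄ ++ L          ↭⟨ ++⁺ˡ (S₅ ++ Y) (++-comm Γ (W₄ ++ L)) ⟩
                    (S₅ ++ Y) ++ (W₄ ++ L) ++ Γ        ↭⟨ ++-interchange S₅ Y (W₄ ++ L) Γ ⟩
                    (S₅ ++ W₄ ++ L) ++ Y ++ Γ          ↭⟨ ++⁺ʳ (Y ++ Γ) (++-comm S₅ (W₄ ++ L)) ⟩
                    ((W₄ ++ L) ++ S₅) ++ Y ++ Γ        ↭⟨ ++⁺ʳ (Y ++ Γ) (++-assoc W₄ L S₅) ⟩
                    (W₄ ++ L ++ S₅) ++ Y ++ Γ          ∎

                tile-V : Tile V
                tile-V = tile-↭ (↭-sym V↭tiled) (tile-++ t (absorb (sub (↭-trans X↭ (++-comm S₅ Y)))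
                  (subst (r ∣_) (length-++ Y) (∣m+n∣m⇒∣n (subst (r ∣_) (length-↭-++ tiled V↭tiled) r∣n) (tile-∣ t)))))

              run₅ : ∃[ S₅ ] ∃[ P₅ ] Xg ↭ S₅ ++ P₅ × length S₅ ≤ r * length L × Tile (L ++ S₅) × Tile (L ++ S₅) → Tile V
              run₅ (S₅ , P₅ , e₅ , _ , t₅ , _) = Stage₅.tile-V S₅ P₅ e₅ t₅

              tile-V : Tile V
              tile-V = run₅ (swaps-in XgV (All.map (λ {v} → denseX v) (filter-All good X)) L L ≡.refl dL dL ⊑-refl room₅)
                where
                dL : Dense B₁ Xg L
                dL = All.map (λ {v} → denseX v) L-good

            run₄ : ∃[ W₄ ] ∃[ L ] Q ↭ W₄ ++ L × Tile W₄ × length L ≤ N₀ + p * step-loss p (4 * e) s → Tile V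
            run₄ (W₄ , L , e₄ , t₄ , L≤) = Stage₄.tile-V W₄ L e₄ t₄ L≤

            tile-V : Tile V
            tile-V = run₄ (Phases.near-cover {4 * e} {p} {s} {T} {N₀} e₀>0 p>0 lt r≤s d₁ d₂ d₃ d₄ p {y} {Q} QV
              (≤-reflexive (≡.trans (+-assoc y p p) y≡)) (All.universal ratio₄ Q) (≤-trans (length-⊑ QV) d₅))

          run₃ : ∃[ Γ ] ∃[ Q ] P₁ ↭ Γ ++ Q × length Γ ≤ C₀ * length X × (∀ {Y} → Y ⊑ X → r ∣ length Y + length Γ → Tile (Y ++ Γ)) → Tile V
          run₃ (Γ , Q , e₃ , Γ≤ , absorb) = Stage₃.tile-V Γ Q e₃ Γ≤ absorb

          tile-V : Tile V
          tile-V = run₃ (absorbing-set denseV XV P₁V (room (≤-reflexive n≡₁) (begin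
            x + (length Ub + length S) + C₀ * length X     ≤⟨ +-mono-≤ (+-monoʳ-≤ x used₁) (≤-reflexive (cong (C₀ *_) |W|)) ⟩
            x + suc r * b₁ + C₀ * x                        ≡⟨ e′ x (suc r * b₁) (C₀ * x) ⟩
            lost                                           ∎)))
            where
            open ≤-Reasoning
            e′ : ∀ x b c → x + b + c ≡ x + c + b
            e′ = solve-∀

        run₂ : ∃[ S ] ∃[ P₁ ] Ug ↭ S ++ P₁ × length S ≤ r * length Ub × Tile (Ub ++ S) × Tile (Ub ++ S) → Tile V
        run₂ (S , P₁ , e₂ , S≤ , t₂ , _) = Stage₂.tile-V S P₁ e₂ S≤ t₂

        tile-V : Tile V
        tile-V = run₂ (swaps-in ⊑-refl denseV Ub Ub ≡.refl dU dU UgV (room (≤-reflexive n≡′) (begin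
            x + length Ub + r * length Ub        ≡⟨ +-assoc x (length Ub) (r * length Ub) ⟩
            x + suc r * length Ub                ≤⟨ +-mono-≤ (m≤m+n x (C₀ * x)) (*-monoʳ-≤ (suc r) Ub≤) ⟩
            lost                                 ∎)))
          where
          open ≤-Reasoning
          dU : Dense B₀ V Ub
          dU = All.universal dense₀ Ub
          n≡′ : n ≡ x + length Ub + length Ug
          n≡′ = ≡.trans n≡ (e′ x (length Ug) (length Ub))
            where
            e′ : ∀ x g b → x + (g + b) ≡ x + b + g
            e′ = solve-∀

      tile-V : Tile V
      tile-V = Stage₁.tile-V (phase {4 * e} {s} {T₁} e₀>0 lt r≤s ⊑-refl (All.universal degree′ V) c₁ c₂ c₃ h₁)
        where
        open ≤-Reasoning
        degree′ : ∀ v → 4 * e * (k * nd V v) + n ≤ 4 * e * n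
        degree′ v = begin
          4 * e * (k * nd V v) + n          ≤⟨ +-monoʳ-≤ _ (m≤m+n n (3 * n)) ⟩
          4 * e * (k * nd V v) + (n + 3 * n)  ≡⟨ e′ e (k * nd V v) n ⟩
          4 * (e * (k * nd V v) + n)        ≤⟨ *-monoʳ-≤ 4 (degree v) ⟩
          4 * (e * n)                       ≡⟨ *-assoc 4 e n ⟨
          4 * e * n                         ∎
          where
          e′ : ∀ e z n → 4 * e * z + (n + 3 * n) ≡ 4 * (e * z + n)
          e′ = solve-∀

    perfect-tiling : ∀ {e} → 0 < e → (∀ v → e * ((2 + κ) * nd V v) + n ≤ e * n) →
      inverse-ε′ κ ℓ e * a ≤ n → n ≤ 2 * (inverse-ε′ κ ℓ e * a) → 1 + κ + ℓ ∣ n →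
      ∃[ Ks ] All (Clique (1 + κ + ℓ)) Ks × concat Ks ↭ V
    perfect-tiling {e} e>0 degree En nE r∣n = subst (λ r → ∃[ Ks ] All (Clique r) Ks × concat Ks ↭ V) r≡
      (Assemble.tile-V {e} {s} {T₁} {h₁} {x′} {n′} {p} {T} {N₀} e>0 p>0 h₁>0
        (λ v → subst (λ k → e * (k * nd V v) + n ≤ e * n) (≡.sym k≡) (degree v)) lt r≤s
        c₁ c₂ c₃ c₄ c₅ c₆ c₇ d₁ d₂ d₃ d₄ d₅ d₆ (subst (_∣ n) (≡.sym r≡) r∣n))
      where
      E≡ : inverse-ε′ κ ℓ e ≡ Constants.E κ e k r (blowup r)
      E≡ = ≡.sym (cong₂ (λ k r → Constants.E κ e k r (blowup r)) k≡ r≡)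
      open Constants κ e k r (blowup r) using (h₁; p; module Bounds)
      open Bounds e>0 (≤-trans (s≤s z≤n) (≤-reflexive (≡.sym k≡))) (≤-trans (s≤s z≤n) (≤-reflexive (≡.sym r≡)))
        using (p>0; h₁>0; module Conditions)
      open Conditions {a} {n} a>0 (subst (λ E → E * a ≤ n) E≡ En) (subst (λ E → n ≤ 2 * (E * a)) E≡ nE)

  -- Graphs on Fin n

  toℚᵘ-ℕ→ℚ : ∀ m → toℚᵘ (ℕ→ℚ m) ℚᵘ.≃ mkℚᵘ (+ m) 0
  toℚᵘ-ℕ→ℚ m = ℚP.toℚᵘ-fromℚᵘ (mkℚᵘ (+ m) 0)

  alpha-ℚ⇒ℕ : ∀ E m n → ℕ→ℚ m ℚ.≤ (+ 1 ℚ./ suc E) ℚ.* ℕ→ℚ n → m * suc E ≤ n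
  alpha-ℚ⇒ℕ E m n le = result (ℚᵘP.drop-*≤* le′)
    where
    le′ : mkℚᵘ (+ m) 0 ℚᵘ.≤ mkℚᵘ (+ 1) E ℚᵘ.* mkℚᵘ (+ n) 0
    le′ = ℚᵘP.≤-respˡ-≃ (toℚᵘ-ℕ→ℚ m) (ℚᵘP.≤-respʳ-≃
      (ℚᵘP.≃-trans (ℚP.toℚᵘ-homo-* (+ 1 ℚ./ suc E) (ℕ→ℚ n)) (ℚᵘP.*-cong (ℚP.toℚᵘ-fromℚᵘ (mkℚᵘ (+ 1) E)) (toℚᵘ-ℕ→ℚ n)))
      (ℚP.toℚᵘ-mono-≤ le))
    result : + m ℤ.* (+ suc E ℤ.* + 1) ℤ.≤ (+ 1 ℤ.* + n) ℤ.* + 1 → m * suc E ≤ n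
    result p = ℤP.drop‿+≤+ (ℤP.≤-trans (ℤP.≤-reflexive (≡.trans (ℤP.pos-* m (suc E)) (cong (λ z → + m ℤ.* z) (≡.sym (ℤP.*-identityʳ (+ suc E))))))
      (ℤP.≤-trans p (ℤP.≤-reflexive (≡.trans (ℤP.*-identityʳ _) (ℤP.*-identityˡ (+ n))))))

  -- A positive rational is at least the reciprocal of its denominator, so the denominator of `ε`
  -- can serve as e.
  degree-ℚ⇒ℕ : ∀ K (ε : ℚ) → Positive ε → ∀ n d →
    (+ K ℚ./ suc K) ℚ.* ℕ→ℚ n ℚ.+ ε ℚ.* ℕ→ℚ n ℚ.≤ ℕ→ℚ d →
    K * n * ℚ.↧ₙ ε + n ≤ d * (suc K * ℚ.↧ₙ ε)
  degree-ℚ⇒ℕ K ε@(mkℚ (+ suc a) e c) pos n d le = result (ℚᵘP.drop-*≤* le′)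
    where
    le′ : mkℚᵘ (+ K) K ℚᵘ.* mkℚᵘ (+ n) 0 ℚᵘ.+ mkℚᵘ (+ suc a) e ℚᵘ.* mkℚᵘ (+ n) 0 ℚᵘ.≤ mkℚᵘ (+ d) 0
    le′ = ℚᵘP.≤-respʳ-≃ (toℚᵘ-ℕ→ℚ d) (ℚᵘP.≤-respˡ-≃
      (ℚᵘP.≃-trans (ℚP.toℚᵘ-homo-+ ((+ K ℚ./ suc K) ℚ.* ℕ→ℚ n) (ε ℚ.* ℕ→ℚ n)) (ℚᵘP.+-cong
        (ℚᵘP.≃-trans (ℚP.toℚᵘ-homo-* (+ K ℚ./ suc K) (ℕ→ℚ n)) (ℚᵘP.*-cong (ℚP.toℚᵘ-fromℚᵘ (mkℚᵘ (+ K) K)) (toℚᵘ-ℕ→ℚ n)))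
        (ℚᵘP.≃-trans (ℚP.toℚᵘ-homo-* ε (ℕ→ℚ n)) (ℚᵘP.*-cong (ℚᵘP.≃-refl {toℚᵘ ε}) (toℚᵘ-ℕ→ℚ n)))))
      (ℚP.toℚᵘ-mono-≤ le))
    left : + ((K * n * (suc e * 1) + suc a * n * (suc K * 1)) * 1) ≡
      ((+ K ℤ.* + n) ℤ.* (+ (suc e * 1)) ℤ.+ (+ suc a ℤ.* + n) ℤ.* (+ (suc K * 1))) ℤ.* + 1
    left = ≡.trans (ℤP.pos-* (K * n * (suc e * 1) + suc a * n * (suc K * 1)) 1) (cong (ℤ._* + 1) (≡.trans (ℤP.pos-+ (K * n * (suc e * 1)) _)
      (cong₂ ℤ._+_ (≡.trans (ℤP.pos-* (K * n) _) (cong (ℤ._* + (suc e * 1)) (ℤP.pos-* K n)))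
                   (≡.trans (ℤP.pos-* (suc a * n) _) (cong (ℤ._* + (suc K * 1)) (ℤP.pos-* (suc a) n))))))
    result : ((+ K ℤ.* + n) ℤ.* (+ (suc e * 1)) ℤ.+ (+ suc a ℤ.* + n) ℤ.* (+ (suc K * 1))) ℤ.* + 1 ℤ.≤ + d ℤ.* + ((suc K * 1) * (suc e * 1)) →
      K * n * suc e + n ≤ d * (suc K * suc e)
    result q = begin
      K * n * suc e + n                                              ≤⟨ +-monoʳ-≤ (K * n * suc e) (≤-trans (m≤n*m n (suc a)) (m≤m*n (suc a * n) (suc K))) ⟩
      K * n * suc e + suc a * n * suc K                              ≡⟨ i K n e a ⟩
      (K * n * (suc e * 1) + suc a * n * (suc K * 1)) * 1            ≤⟨ ℤP.drop‿+≤+ (ℤP.≤-trans (ℤP.≤-reflexive left) (ℤP.≤-trans q (ℤP.≤-reflexive (≡.sym (ℤP.pos-* d _))))) ⟩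
      d * ((suc K * 1) * (suc e * 1))                                ≡⟨ cong (d *_) (cong₂ _*_ (*-identityʳ (suc K)) (*-identityʳ (suc e))) ⟩
      d * (suc K * suc e)                                            ∎
      where
      open ≤-Reasoning
      i : ∀ K n e a → K * n * suc e + suc a * n * suc K ≡ (K * n * (suc e * 1) + suc a * n * (suc K * 1)) * 1
      i = solve-∀

  ∣tabulate∣ : ∀ {n} (f : Fin n → Bool) → ∣ Vec.tabulate f ∣ₛ ≡ count f (allFin n)
  ∣tabulate∣ {n} f = go n (λ i → i) f
    where
    go : ∀ {A : Set} m (g : Fin m → A) (f : A → Bool) → ∣ Vec.tabulate (f ∘ g) ∣ₛ ≡ count f (tabulate g)
    go zero    g f = ≡.refl
    go (suc m) g f with f (g zero)
    ... | true  = cong suc (go m (g ∘ suc) f)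
    ... | false = go m (g ∘ suc) f

  does⇒ : ∀ {X : Set} (d : Dec X) → does d ≡ true → X
  does⇒ (yes x) _ = x

  module Bridge {n : ℕ} (G : Graph n) where

    open Cliques (adj G) (Defs.sym G) (irrefl G)

    -- a decidable form of HasCliqueIn
    HasCl : ℕ → List (Fin n) → Set
    HasCl zero    P = ⊤
    HasCl (suc m) P = Any (λ v → HasCl m (N v P)) P

    hasCl? : ∀ m P → Dec (HasCl m P)
    hasCl? zero    P = yes tt
    hasCl? (suc m) P = any? (λ v → hasCl? m (N v P)) P

    hasCl⇒clique : ∀ m P → HasCl m P → ∃[ S ] Clique m S × S ⊆ P
    hasCl⇒clique zero    P _ = [] , (≡.refl , []) , λ ()
    hasCl⇒clique (suc m) P c =
      let v , v∈P , c′ = find c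
          S , cl , s   = hasCl⇒clique m (N v P) c′
      in v ∷ S , extend {P = P} cl s , λ { (here ≡.refl) → v∈P ; (there x∈) → N-⊆ v P (s x∈) }

    ∈-N : ∀ {v x P} → Adj v x → x ∈ P → x ∈ N v P
    ∈-N {v} a m = ∈-filter⁺ (T? ∘ adj G v) m (Equivalence.from T-≡ a)

    clique⇒hasCl : ∀ m P (f : Fin m → Fin n) → (∀ i → f i ∈ P) → IsClique G m f → HasCl m P
    clique⇒hasCl zero    P f f∈ c = tt
    clique⇒hasCl (suc m) P f f∈ c = Any.map (λ { ≡.refl → clique⇒hasCl m (N (f zero) P) (f ∘ suc)
      (λ i → ∈-N (c zero (suc i) λ ()) (f∈ (suc i))) (λ i j i≢j → c (suc i) (suc j) (i≢j ∘ FinP.suc-injective)) }) (f∈ zero)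

    member : List (Fin n) → Fin n → Bool
    member P v = does (mem? Fin._≟_ v P)

    -- A list `P` without a K_ℓ would be a vertex set of at least a + 1 elements, more than the
    -- bound on `AlphaLE` permits. Deciding `HasCl` turns this refutation into an actual clique.
    find-clique : ∀ E {ℓ a} → n < suc a * suc E → AlphaLE G ℓ ((+ 1 ℚ./ suc E) ℚ.* ℕ→ℚ n) →
      ∀ {P} → P ⊑ allFin n → a < length P → ∃[ S ] Clique ℓ S × (∀ {x} → x ∈ S → x ∈ P)
    find-clique E {ℓ} {a} n< α {P} PV a<P with hasCl? ℓ P
    ... | yes c = hasCl⇒clique ℓ P c
    ... | no ¬c = contradiction (≤-trans (*-monoˡ-≤ (suc E) large) (alpha-ℚ⇒ℕ E ∣ U ∣ₛ n (α U no-clique))) (<⇒≱ n<)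
      where
      U : Subset n
      U = Vec.tabulate (member P)
      large : suc a ≤ ∣ U ∣ₛ
      large = ≤-trans a<P (≤-trans (count-⊑ {p = member P} PV (All.tabulate λ {x} x∈ → dec-true (mem? Fin._≟_ x P) x∈)) (≤-reflexive (≡.sym (∣tabulate∣ (member P)))))
      U⇒P : ∀ {v} → v ∈ₛ U → v ∈ P
      U⇒P {v} v∈U = does⇒ (mem? Fin._≟_ v P) (≡.trans (≡.sym (lookup∘tabulate (member P) v)) ([]=⇒lookup v∈U))
      no-clique : ¬ HasCliqueIn G ℓ U
      no-clique (f , f∈ , c) = ¬c (clique⇒hasCl ℓ P f (λ i → U⇒P (f∈ i)) c)

    -- A single vertex contains no K_ℓ when ℓ ≥ 2, so the bound on independent sets itself forces a
    -- nonempty graph to have at least 1/ε′ vertices. This covers all small n at once.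
    nonempty⇒large : ∀ E {ℓ} → 2 ≤ ℓ → AlphaLE G ℓ ((+ 1 ℚ./ suc E) ℚ.* ℕ→ℚ n) → Fin n → suc E ≤ n
    nonempty⇒large E {suc (suc ℓ)} (s≤s (s≤s _)) α v = ≤-trans (≤-reflexive (≡.sym (≡.trans (cong (_* suc E) (∣⁅x⁆∣≡1 v)) (+-identityʳ (suc E)))))
      (alpha-ℚ⇒ℕ E ∣ ⁅ v ⁆ ∣ₛ n (α ⁅ v ⁆ λ { (f , f∈ , c) → contradiction
        (≡.trans (≡.sym (c zero (suc zero) λ ())) (≡.trans (cong₂ (adj G) (x∈⁅y⁆⇒x≡y v (f∈ zero)) (x∈⁅y⁆⇒x≡y v (f∈ (suc zero)))) (irrefl G v))) λ () }))

    length-allFin : length (allFin n) ≡ n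
    length-allFin = length-tabulate (λ i → i)

    deg≡ : ∀ v → Defs.deg G v ≡ deg (allFin n) v
    deg≡ v = ∣tabulate∣ (adj G v)

    min-degree : ∀ κ (ε : ℚ) → Positive ε →
      Defs.MinDegGE G ((+ suc κ ℚ./ suc (suc κ)) ℚ.* ℕ→ℚ n ℚ.+ ε ℚ.* ℕ→ℚ n) →
      ∀ v → ℚ.↧ₙ ε * ((2 + κ) * nd (allFin n) v) + n ≤ ℚ.↧ₙ ε * n
    min-degree κ ε pos md v = +-cancelʳ-≤ (d * ((2 + κ) * e)) _ _ (begin
      e * ((2 + κ) * x) + n + d * ((2 + κ) * e)         ≡⟨ i e κ x n d ⟩
      (d + x) * ((2 + κ) * e) + n                       ≡⟨ cong (λ z → z * ((2 + κ) * e) + n) d+x ⟩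
      n * ((2 + κ) * e) + n                             ≡⟨ j n κ e ⟩
      e * n + (suc κ * n * e + n)                       ≤⟨ +-monoʳ-≤ (e * n) (degree-ℚ⇒ℕ (suc κ) ε pos n d (subst (λ z → _ ℚ.≤ ℕ→ℚ z) (deg≡ v) (md v))) ⟩
      e * n + d * ((2 + κ) * e)                         ∎)
      where
      open ≤-Reasoning
      e d x : ℕ
      e = ℚ.↧ₙ ε
      d = deg (allFin n) v
      x = nd (allFin n) v
      d+x : d + x ≡ n
      d+x = ≡.trans (deg+nd (allFin n) v) length-allFin
      i : ∀ e κ x n d → e * ((2 + κ) * x) + n + d * ((2 + κ) * e) ≡ (d + x) * ((2 + κ) * e) + n
      i = solve-∀
      j : ∀ n κ e → n * ((2 + κ) * e) + n ≡ e * n + (suc κ * n * e + n)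
      j = solve-∀

  -- From a tiling to a K_r-factor

  AllPairs-++⁻ : ∀ {A : Set} {R : A → A → Set} xs {ys} → AllPairs R (xs ++ ys) →
    AllPairs R xs × AllPairs R ys × (∀ {x y} → x ∈ xs → y ∈ ys → R x y)
  AllPairs-++⁻ [] p = [] , p , λ ()
  AllPairs-++⁻ {A} {R} (x ∷ xs) {ys} (a ∷ p) = let q , q′ , f = AllPairs-++⁻ xs p in
    All.tabulate (λ m → All.lookup a (∈-++⁺ˡ m)) ∷ q , q′ , g f
    where
    g : (∀ {x y} → x ∈ xs → y ∈ ys → R x y) → ∀ {z y} → z ∈ x ∷ xs → y ∈ ys → R z y
    g f (here ≡.refl) m′ = All.lookup a (∈-++⁺ʳ xs m′)
    g f (there m) m′     = f m m′

  lookup-AllPairs : ∀ {A : Set} {R : A → A → Set} → (∀ {x y} → R x y → R y x) → ∀ {xs} → AllPairs R xs →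
    ∀ i j → i ≢ j → R (lookup xs i) (lookup xs j)
  lookup-AllPairs s (a ∷ p) zero    zero    i≢j = contradiction ≡.refl i≢j
  lookup-AllPairs s (a ∷ p) zero    (suc j) i≢j = All.lookup a (∈-lookup j)
  lookup-AllPairs s (a ∷ p) (suc i) zero    i≢j = s (All.lookup a (∈-lookup i))
  lookup-AllPairs s (a ∷ p) (suc i) (suc j) i≢j = lookup-AllPairs s p i j (i≢j ∘ cong suc)

  module Factor {n : ℕ} (G : Graph n) (r : ℕ) where

    open Cliques (adj G) (Defs.sym G) (irrefl G)
    open import Data.List.Relation.Binary.Permutation.Setoid.Properties (≡.setoid (Fin n)) using (Unique-resp-↭)

    at : ∀ {K} → Clique r K → Fin r → Fin n
    at {K} (|K| , _) j = lookup K (cast (≡.sym |K|) j)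

    cast-injective : ∀ {m n} .(eq : m ≡ n) {i j : Fin m} → cast eq i ≡ cast eq j → i ≡ j
    cast-injective eq {i} {j} p = FinP.toℕ-injective (≡.trans (≡.sym (FinP.toℕ-cast eq i)) (≡.trans (cong Fin.toℕ p) (FinP.toℕ-cast eq j)))

    adj-sym : ∀ {x y} → Adj x y → Adj y x
    adj-sym {x} {y} a = ≡.trans (Defs.sym G y x) a

    at-clique : ∀ {K} (c : Clique r K) → IsClique G r (at c)
    at-clique c i j i≢j = lookup-AllPairs adj-sym (proj₂ c) _ _ (i≢j ∘ cast-injective (≡.sym (proj₁ c)))

    at-injective : ∀ {K} (c : Clique r K) → Unique K → ∀ j j′ → at c j ≡ at c j′ → j ≡ j′
    at-injective c u j j′ eq with j Fin.≟ j′
    ... | yes p = p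
    ... | no ¬p = contradiction eq (lookup-AllPairs (λ f → f ∘ ≡.sym) u _ _ (¬p ∘ cast-injective (≡.sym (proj₁ c))))

    at-∈ : ∀ {K} (c : Clique r K) j → at c j ∈ K
    at-∈ c j = ∈-lookup _

    at-surjective : ∀ {K} (c : Clique r K) {v} → v ∈ K → ∃[ j ] at c j ≡ v
    at-surjective {K} (|K| , _) {v} v∈ = cast |K| (index v∈) , ≡.trans
      (cong (lookup K) (≡.trans (FinP.cast-trans |K| (≡.sym |K|) (index v∈)) (cast-is-id ≡.refl (index v∈)))) (≡.sym (lookup-index v∈))

    F : ∀ {Ks} → All (Clique r) Ks → Fin (length Ks) → Fin r → Fin n
    F (c ∷ cs) zero    = at c
    F (c ∷ cs) (suc i) = F cs i

    F-clique : ∀ {Ks} (cs : All (Clique r) Ks) i → IsClique G r (F cs i)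
    F-clique (c ∷ cs) zero    = at-clique c
    F-clique (c ∷ cs) (suc i) = F-clique cs i

    F-∈ : ∀ {Ks} (cs : All (Clique r) Ks) i j → F cs i j ∈ concat Ks
    F-∈ (c ∷ cs) zero    j = ∈-++⁺ˡ (at-∈ c j)
    F-∈ (_∷_ {K} c cs) (suc i) j = ∈-++⁺ʳ K (F-∈ cs i j)

    F-injective : ∀ {Ks} (cs : All (Clique r) Ks) → Unique (concat Ks) → ∀ i j i′ j′ → F cs i j ≡ F cs i′ j′ → i ≡ i′ × j ≡ j′
    F-injective (_∷_ {K} c cs) u zero    j zero     j′ eq = ≡.refl , at-injective c (proj₁ (AllPairs-++⁻ K u)) j j′ eq
    F-injective (_∷_ {K} c cs) u zero    j (suc i′) j′ eq = contradiction eq (proj₂ (proj₂ (AllPairs-++⁻ K u)) (at-∈ c j) (F-∈ cs i′ j′))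
    F-injective (_∷_ {K} c cs) u (suc i) j zero     j′ eq = contradiction (≡.sym eq) (proj₂ (proj₂ (AllPairs-++⁻ K u)) (at-∈ c j′) (F-∈ cs i j))
    F-injective (_∷_ {K} c cs) u (suc i) j (suc i′) j′ eq =
      let p , q = F-injective cs (proj₁ (proj₂ (AllPairs-++⁻ K u))) i j i′ j′ eq in cong suc p , q

    F-surjective : ∀ {Ks} (cs : All (Clique r) Ks) {v} → v ∈ concat Ks → Σ (Fin (length Ks)) λ i → Σ (Fin r) λ j → F cs i j ≡ v
    F-surjective (_∷_ {K} c cs) v∈ with ∈-++⁻ K v∈
    ... | inj₁ m = let j , eq = at-surjective c m in zero , j , eq
    ... | inj₂ m = let i , j , eq = F-surjective cs m in suc i , j , eq

    tiling⇒factor : ∀ {Ks} → All (Clique r) Ks → concat Ks ↭ allFin n → HasKFactor G r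
    tiling⇒factor {Ks} cs e = length Ks , F cs , F-clique cs , F-injective cs (Unique-resp-↭ (↭⇒↭ₛ (↭-sym e)) (allFin⁺ n))
      , λ v → F-surjective cs (∈-resp-↭ (↭-sym e) (∈-allFin v))

-- Choice of ε′ and of the unit of length

open import Defs
open import Data.Nat using (ℕ; suc; _∸_; _<_; _≤_)
open import Data.Nat.Divisibility using (_∣_)
open import Data.Integer using (+_)
open import Data.Rational using (ℚ; Positive; _/_; _+_; _*_)
open import Data.Product using (Σ; _×_)

open CliqueFactors
open import Data.Fin using (Fin; zero)
open import Data.List using (length; allFin)
open import Data.Nat as ℕ using (zero; pred; z≤n; s≤s; >-nonZero)
open import Data.Nat.DivMod using (m/n*n≤m; m≡m%n+[m/n]*n; m%n<n; m≥n⇒m/n>0)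
open import Data.Nat.Properties
open import Data.Product using (_,_)
open import Data.Rational using (↧ₙ_)
open import Data.Rational.Properties using (normalize-pos)
open import Relation.Binary.PropositionalEquality as ≡ using (_≡_; cong; subst)

module Main (κ ℓ : ℕ) (2≤ℓ : 2 ≤ ℓ) (ε : ℚ) (pos : Positive ε) where

  e>0 : 0 < ↧ₙ ε
  e>0 = s≤s z≤n

  D : ℕ
  D = pred (inverse-ε′ κ ℓ (↧ₙ ε))

  sucD : suc D ≡ inverse-ε′ κ ℓ (↧ₙ ε)
  sucD = suc-pred _ {{>-nonZero (inverse-ε′>0 κ ℓ e>0)}}

  ε′ : ℚ
  ε′ = + 1 / suc D

  module _ {n : ℕ} (r∣n : 1 ℕ.+ κ ℕ.+ ℓ ∣ n) (G : Graph n)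
    (md : MinDegGE G ((+ suc κ / suc (suc κ)) * ℕ→ℚ n + ε * ℕ→ℚ n)) (α : AlphaLE G ℓ (ε′ * ℕ→ℚ n)) (v₀ : Fin n) where

    open Bridge G

    a : ℕ
    a = n ℕ./ suc D

    a>0 : 0 < a
    a>0 = m≥n⇒m/n>0 (nonempty⇒large D 2≤ℓ α v₀)

    Da≤n : suc D ℕ.* a ≤ n
    Da≤n = ≤-trans (≤-reflexive (*-comm (suc D) a)) (m/n*n≤m n (suc D))

    n<Da : n < suc a ℕ.* suc D
    n<Da = ≤-trans (s≤s (≤-reflexive (m≡m%n+[m/n]*n n (suc D)))) (+-monoˡ-≤ (a ℕ.* suc D) (m%n<n n (suc D)))

    n≤2Da : n ≤ 2 ℕ.* (suc D ℕ.* a)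
    n≤2Da = ≤-trans (<⇒≤ n<Da) (≤-trans (+-mono-≤ (m≤m*n (suc D) a {{>-nonZero a>0}}) (≤-reflexive (*-comm a (suc D))))
      (≤-reflexive (cong (suc D ℕ.* a ℕ.+_) (≡.sym (+-identityʳ _)))))

    factor : HasKFactor G (1 ℕ.+ κ ℕ.+ ℓ)
    factor = let _ , cs , e = tiling in Factor.tiling⇒factor G (1 ℕ.+ κ ℕ.+ ℓ) cs e
      where
      n≡ : n ≡ length (allFin n)
      n≡ = ≡.sym length-allFin
      tiling = Tiling.perfect-tiling (adj G) (Graph.sym G) (irrefl G) (allFin n) κ ℓ a (≤-trans (s≤s z≤n) 2≤ℓ) a>0
        (find-clique D {ℓ} {a} n<Da α) {↧ₙ ε} e>0
        (λ v → subst (λ m → ↧ₙ ε ℕ.* ((2 ℕ.+ κ) ℕ.* Cliques.nd (adj G) (Graph.sym G) (irrefl G) (allFin n) v) ℕ.+ m ≤ ↧ₙ ε ℕ.* m) n≡ (min-degree κ ε pos md v))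
        (≡.subst₂ (λ E m → E ℕ.* a ≤ m) sucD n≡ Da≤n)
        (≡.subst₂ (λ E m → m ≤ 2 ℕ.* (E ℕ.* a)) sucD n≡ n≤2Da)
        (subst (1 ℕ.+ κ ℕ.+ ℓ ∣_) n≡ r∣n)

  main : (n : ℕ) → 1 ℕ.+ κ ℕ.+ ℓ ∣ n → (G : Graph n) →
    MinDegGE G ((+ suc κ / suc (suc κ)) * ℕ→ℚ n + ε * ℕ→ℚ n) → AlphaLE G ℓ (ε′ * ℕ→ℚ n) → HasKFactor G (1 ℕ.+ κ ℕ.+ ℓ)
  -- Without a vertex there is no lower bound on n and the unit `a` would be zero; the empty factor
  -- serves.
  main zero    _   G _  _ = 0 , (λ ()) , (λ ()) , (λ ()) , λ ()
  main (suc n) r∣n G md α = factor r∣n G md α zero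

theorem1p2 : (r ℓ : ℕ) → 2 ≤ ℓ → ℓ < r →
    (ε : ℚ) → Positive ε →
    Σ ℚ λ ε' → Positive ε' ×
    ((n : ℕ) → r ∣ n → (G : Graph n) →
    MinDegGE G ((+ (r ∸ ℓ) / suc (r ∸ ℓ)) * ℕ→ℚ n + ε * ℕ→ℚ n) →
    AlphaLE G ℓ (ε' * ℕ→ℚ n) →
    HasKFactor G r)
theorem1p2 r ℓ 2≤ℓ ℓ<r ε pos = ε′ , normalize-pos 1 (suc D) , λ n r∣n G md α →
  subst (HasKFactor G) (≡.sym r≡) (main n (subst (_∣ n) r≡ r∣n) G
    (subst (λ z → MinDegGE G ((+ z / suc z) * ℕ→ℚ n + ε * ℕ→ℚ n)) (≡.trans (cong (_∸ ℓ) r≡) (m+n∸n≡m (1 ℕ.+ κ) ℓ)) md) α)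
  where
  κ : ℕ
  κ = r ∸ suc ℓ
  r≡ : r ≡ 1 ℕ.+ κ ℕ.+ ℓ
  r≡ = ≡.trans (≡.sym (m∸n+n≡m ℓ<r)) (+-suc κ ℓ)
  open Main κ ℓ 2≤ℓ ε pos
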